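{- The Hopf monoid $\mathbf{ptt}_{\mathrm{NPtt}}$ is a free monoid (in the category of vector species): as a monoid it is isomorphic to the free monoid $A\mapsto\bigoplus_{(A_1,\ldots,A_\ell)\vDash A}\mathbf{q}[A_1]\otimes\cdots\otimes\mathbf{q}[A_\ell]$ on some vector species $\mathbf{q}$ with $\mathbf{q}[\emptyset]=0$.
   Context: Fix a finite field $\mathbb{F}_q$ with $q$ elements. All sets are finite; $\mathrm{PO}(A)$ is the set of partial orders on $A$. For $\mathcal{R}\in\mathrm{PO}(A)$, the pattern group is $\mathrm{UT}_{\mathcal{R}}=\{u:\{[i,j]\mid i\preceq_{\mathcal{R}}j\}\to\mathbb{F}_q\mid u([i,i])=1\}$ with product $(uv)([i,k])=\sum_{i\preceq_{\mathcal{R}}j\preceq_{\mathcal{R}}k}u([i,j])v([j,k])$. If $\mathcal{Q}$ is a subposet of $\mathcal{R}$ (i.e. $\mathcal{Q}\in\mathrm{PO}(A)$ and $i\preceq_{\mathcal{Q}}j\Rightarrow i\preceq_{\mathcal{R}}j$), $\mathrm{UT}_{\mathcal{Q}}\subseteq\mathrm{UT}_{\mathcal{R}}$ via extension by zero. $\mathrm{NPtt}(\mathcal{R})=\{\mathrm{UT}_{\mathcal{Q}}\triangleleft\mathrm{UT}_{\mathcal{R}}\mid\mathcal{Q}\text{ a subposet of }\mathcal{R}\}$, ordered by inclusion. $\mathrm{Cl}(\mathcal{R})$ is the partition of $\mathrm{UT}_{\mathcal{R}}$ into the sets $N_\circ=\{g\in N\mid g\text{ lies in no element of }\mathrm{NPtt}(\mathcal{R})\text{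 covered by }N\}$, $N\in\mathrm{NPtt}(\mathcal{R})$, and $\mathrm{f}(\mathrm{UT}_{\mathcal{R}};\mathrm{Cl}(\mathcal{R}))$ is the space of functions $\mathrm{UT}_{\mathcal{R}}\to\mathbb{C}$ constant on the blocks of $\mathrm{Cl}(\mathcal{R})$. The species is $\mathbf{ptt}_{\mathrm{NPtt}}[A]=\bigoplus_{\mathcal{R}\in\mathrm{PO}(A)}\mathrm{f}(\mathrm{UT}_{\mathcal{R}};\mathrm{Cl}(\mathcal{R}))$, a complex vector species. For disjoint $A,B$, the product $m_{A,B}:\mathrm{f}(\mathrm{UT}_{\mathcal{P}};\mathrm{Cl}(\mathcal{P}))\otimes\mathrm{f}(\mathrm{UT}_{\mathcal{Q}};\mathrm{Cl}(\mathcal{Q}))\to\mathrm{f}(\mathrm{UT}_{\mathcal{P}.\mathcal{Q}};\mathrm{Cl}(\mathcal{P}.\mathcal{Q}))$, for $\mathcal{P}\in\mathrm{PO}(A)$, $\mathcal{Q}\in\mathrm{PO}(B)$, is inflation $m_{A,B}(\phi\otimes\psi)(u)=\phi(u_A)\psi(u_B)$, where $u_A,u_B$ are the restrictions of $u$ to intervals with both endpoints in $A$, resp. $B$, and $\mathcal{P}.\mathcal{Q}\in\mathrm{PO}(A\cup B)$ has $i\preceq j$ iff $i\preceq_{\mathcal{P}}j$, or $i\preceq_{\mathcal{Q}}j$, or $i\in A$ and $j\in B$. The coproduct $\Delta_{A,B}$ is, for $\mathcal{P}\in\mathrm{PO}(A\cup B)$, restriction of functions from $\mathrm{UT}_{\mathcal{P}}$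 to the subgroup $\mathrm{UT}_{\mathcal{P}|_A}\times\mathrm{UT}_{\mathcal{P}|_B}$ of block elements (entries zero on intervals with one endpoint in $A$ and the other in $B$). A set composition $(A_1,\ldots,A_\ell)\vDash A$ is a sequence of nonempty disjoint sets with union $A$ (for $A=\emptyset$ the only one is the empty sequence, contributing $\mathbb{C}$). The free monoid on $\mathbf{q}$ has concatenation of tensors as product. -}

module Defs where

open import Algebra.Bundles using (CommutativeRing)
open import Algebra.Module.Bundles using (LeftModule)
open import Algebra.Module.Morphism.Structures using (module LeftModuleMorphisms)
import Algebra.Module.Properties.LeftModule as LeftModuleProperties
import Algebra.Properties.CommutativeMonoid.Sum as CommutativeMonoidSum
open import Data.Bool.Base using (Bool; true; false; T; if_then_else_)
open import Data.Bool.Properties using (T?; T-irrelevant)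
open import Data.Empty using (⊥; ⊥-elim)
open import Data.Fin.Base using (Fin; zero; suc; punchIn)
import Data.Fin.Properties as FinP
open import Data.Fin.Properties using (0↔⊥; +↔⊎; inj⇒≟)
open import Data.List.Base using (List; []; _∷_; _++_; map)
open import Data.List.Relation.Unary.All as All using (All; []; _∷_)
import Data.List.Relation.Unary.All.Properties as AllP
open import Data.List.Relation.Unary.AllPairs as AllPairs using (AllPairs; []; _∷_)
import Data.List.Relation.Unary.AllPairs.Properties as AllPairsP
open import Data.List.Relation.Unary.Any using (Any)
import Data.List.Relation.Unary.Any.Properties as AnyP
open import Data.Nat.Base as ℕ using (ℕ; zero; suc)
import Data.Nat.Induction as ℕI
import Data.Nat.Properties as ℕP
open import Data.Product.Base using (_×_; _,_; proj₁; proj₂; ∃; Σ; Σ-syntax; ∃-syntax)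
open import Data.Rational.Base as Q using (ℚ; 0ℚ; 1ℚ; ½)
import Data.Rational.Properties as ℚP
open import Data.Rational.Solver using (module +-*-Solver)
open import Data.Sum.Base using (_⊎_; inj₁; inj₂)
open import Data.Sum.Function.Propositional using (_⊎-↔_)
open import Data.Unit.Base using (tt)
open import Function.Base using (_∘_; id)
open import Function.Bundles using (_↔_; mk↔ₛ′; Inverse)
open import Function.Construct.Composition using (_↔-∘_)
open import Function.Construct.Identity using (↔-id)
open import Function.Construct.Symmetry using (↔-sym)
open import Function.Properties.Inverse using (↔⇒↣)
open import Function.Related.TypeIsomorphisms using (⊎-assoc)
open import Induction.WellFounded using (Acc; acc)
open import Level using (0ℓ)
open import Relation.Binary.Definitions using (Decidable; DecidableEquality)
open import Relation.Binary.PropositionalEquality as ≡ using (_≡_; _≢_; _≗_; refl)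
import Relation.Binary.Reasoning.Setoid as SetoidReasoning
open import Relation.Binary.Structures using (IsPartialOrder)
open import Relation.Nullary.Decidable as Dec using (Dec; yes; no; ⌊_⌋; toWitness; fromWitness; _×-dec_; _⊎-dec_; ¬?)
open import Relation.Nullary.Negation using (¬_; contradiction)

module CauchyReals where

  open +-*-Solver using (solve; _:+_; _:*_; _:-_; :-_; _:=_)
  open Q using (∣_∣)
  open ≡ using (cong; sym; trans; subst)

  Eventually : (ℕ → Set) → Set
  Eventually P = ∃[ N ] ∀ n → N ℕ.≤ n → P n

  Null : (ℕ → ℚ) → Set
  Null s = ∀ ε → 0ℚ Q.< ε → ∃[ N ] ∀ n → N ℕ.≤ n → ∣ s n ∣ Q.< ε

  Cauchy : (ℕ → ℚ) → Set
  Cauchy s = ∀ ε → 0ℚ Q.< ε → ∃[ N ] ∀ m n → N ℕ.≤ m → N ℕ.≤ n → ∣ s m Q.- s n ∣ Q.< ε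

  -- ℝ is the ring of Cauchy sequences of rationals modulo the null sequences (_≃_)
  record ℝ : Set where
    no-eta-equality
    constructor real
    field
      seq    : ℕ → ℚ
      cauchy : Cauchy seq
  open ℝ

  infix 4 _≃_
  record _≃_ (x y : ℝ) : Set where
    constructor ≃-intro
    field difference-null : Null (λ n → seq x n Q.- seq y n)
  open _≃_

  halves : ∀ ε → ½ Q.* ε Q.+ ½ Q.* ε ≡ ε
  halves ε = trans (sym (ℚP.*-distribʳ-+ ε ½ ½)) (ℚP.*-identityˡ ε)

  half-pos : ∀ {ε} → 0ℚ Q.< ε → 0ℚ Q.< ½ Q.* ε
  half-pos {ε} p = subst (Q._< ½ Q.* ε) (ℚP.*-zeroʳ ½) (ℚP.*-monoʳ-<-pos ½ p)

  sum-small : ∀ {a b ε} → ∣ a ∣ Q.< ½ Q.* ε → ∣ b ∣ Q.< ½ Q.* ε → ∣ a Q.+ b ∣ Q.< ε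
  sum-small {a} {b} {ε} p q =
    ℚP.≤-<-trans (ℚP.∣p+q∣≤∣p∣+∣q∣ a b)
      (subst (∣ a ∣ Q.+ ∣ b ∣ Q.<_) (halves ε) (ℚP.+-mono-< p q))

  -- a positive δ with B δ = ε
  shrink : ∀ B ε → 0ℚ Q.< B → 0ℚ Q.< ε → ∃[ δ ] 0ℚ Q.< δ × B Q.* δ ≡ ε
  shrink B ε B>0 ε>0 = δ , δ>0 , eq
    where
    instance
      _ = Q.positive B>0
      _ = Q.positive ε>0
      _ = ℚP.pos⇒nonZero B
      _ = ℚP.1/pos⇒pos B
    δ = Q.1/ B Q.* ε
    δ>0 : 0ℚ Q.< δ
    δ>0 = ℚP.positive⁻¹ δ {{ℚP.pos*pos⇒pos (Q.1/ B) ε}}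
    eq : B Q.* δ ≡ ε
    eq = trans (sym (ℚP.*-assoc B (Q.1/ B) ε))
               (trans (cong (Q._* ε) (ℚP.*-inverseʳ B)) (ℚP.*-identityˡ ε))

  product-small : ∀ {a b B δ ε} → 0ℚ Q.< δ → ∣ a ∣ Q.≤ B → ∣ b ∣ Q.< δ → 0ℚ Q.< B → B Q.* δ ≡ ε →
                  ∣ a Q.* b ∣ Q.< ε
  product-small {a} {b} {B} {δ} δ>0 a≤B b<δ B>0 eq =
    subst (∣ a Q.* b ∣ Q.<_) eq (subst (Q._< B Q.* δ) (sym (ℚP.∣p*q∣≡∣p∣*∣q∣ a b))
      (ℚP.≤-<-trans (ℚP.*-monoʳ-≤-nonNeg ∣ b ∣ {{ℚP.∣-∣-nonNeg b}} a≤B)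
                    (ℚP.*-monoʳ-<-pos B {{Q.positive B>0}} b<δ)))

  bounded : ∀ {s} → Cauchy s → ∃[ B ] 0ℚ Q.< B × Eventually (λ n → ∣ s n ∣ Q.≤ B)
  bounded {s} c = B , B>0 , N , λ n N≤n → ℚP.<⇒≤ (bound n N≤n)
    where
    one>0 : 0ℚ Q.< 1ℚ
    one>0 = ℚP.positive⁻¹ 1ℚ
    N = proj₁ (c 1ℚ one>0)
    B = 1ℚ Q.+ ∣ s N ∣
    B>0 : 0ℚ Q.< B
    B>0 = ℚP.+-mono-<-≤ one>0 (ℚP.0≤∣p∣ (s N))
    split : ∀ a b → (a Q.- b) Q.+ b ≡ a
    split = solve 2 (λ a b → (a :- b) :+ b := a) refl
    bound : ∀ n → N ℕ.≤ n → ∣ s n ∣ Q.< B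
    bound n N≤n = subst (λ t → ∣ t ∣ Q.< B) (split (s n) (s N))
      (ℚP.≤-<-trans (ℚP.∣p+q∣≤∣p∣+∣q∣ (s n Q.- s N) (s N))
        (ℚP.+-mono-<-≤ (proj₂ (c 1ℚ one>0) n N N≤n ℕP.≤-refl) ℚP.≤-refl))

  null-resp : ∀ s t → (∀ n → s n ≡ t n) → Null s → Null t
  null-resp s t e h ε ε>0 =
    proj₁ (h ε ε>0) , λ n N≤n → subst (λ t → ∣ t ∣ Q.< ε) (e n) (proj₂ (h ε ε>0) n N≤n)

  null-zero : Null (λ _ → 0ℚ)
  null-zero ε ε>0 = 0 , λ _ _ → ε>0

  null-neg : ∀ {s} → Null s → Null (λ n → Q.- s n)
  null-neg {s} h ε ε>0 with h ε ε>0
  ... | N , p = N , λ n N≤n → subst (Q._< ε) (sym (ℚP.∣-p∣≡∣p∣ (s n))) (p n N≤n)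

  null-+ : ∀ {s t} → Null s → Null t → Null (λ n → s n Q.+ t n)
  null-+ {s} {t} h k ε ε>0 = M ℕ.⊔ N , λ n le →
    sum-small {s n} {t n} {ε} (proj₂ p n (ℕP.m⊔n≤o⇒m≤o M N le)) (proj₂ q n (ℕP.m⊔n≤o⇒n≤o M N le))
    where
    p = h (½ Q.* ε) (half-pos {ε} ε>0)
    q = k (½ Q.* ε) (half-pos {ε} ε>0)
    M = proj₁ p
    N = proj₁ q

  null-bounded-* : ∀ {s t} → Cauchy s → Null t → Null (λ n → s n Q.* t n)
  null-bounded-* {s} {t} c h ε ε>0 = M ℕ.⊔ N , λ n le →
    product-small {s n} {t n} {B} {δ} {ε} δ>0
      (b n (ℕP.m⊔n≤o⇒m≤o M N le)) (proj₂ p n (ℕP.m⊔n≤o⇒n≤o M N le)) B>0 eq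
    where
    bd = bounded {s} c
    B = proj₁ bd
    B>0 = proj₁ (proj₂ bd)
    M = proj₁ (proj₂ (proj₂ bd))
    b = proj₂ (proj₂ (proj₂ bd))
    sh = shrink B ε B>0 ε>0
    δ = proj₁ sh
    δ>0 = proj₁ (proj₂ sh)
    eq = proj₂ (proj₂ sh)
    p = h δ δ>0
    N = proj₁ p

  ≃-pointwise : ∀ {x y} → (∀ n → seq x n ≡ seq y n) → x ≃ y
  ≃-pointwise {x} {y} e = ≃-intro
    (null-resp (λ _ → 0ℚ) (λ n → seq x n Q.- seq y n)
      (λ n → sym (trans (cong (Q._- seq y n) (e n)) (ℚP.+-inverseʳ (seq y n)))) null-zero)

  const : ℚ → ℝ
  const r = real (λ _ → r) λ ε ε>0 → 0 , λ _ _ _ _ → subst (λ t → ∣ t ∣ Q.< ε) (sym (ℚP.+-inverseʳ r)) ε>0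

  infixl 6 _+_
  infixl 7 _*_
  infix  8 -_

  _+_ : ℝ → ℝ → ℝ
  seq (x + y) n = seq x n Q.+ seq y n
  cauchy (x + y) ε ε>0 = M ℕ.⊔ N , λ m n hm hn →
    subst (λ u → ∣ u ∣ Q.< ε) (regroup (s m) (s n) (t m) (t n))
      (sum-small {s m Q.- s n} {t m Q.- t n} {ε}
        (proj₂ p m n (ℕP.m⊔n≤o⇒m≤o M N hm) (ℕP.m⊔n≤o⇒m≤o M N hn))
        (proj₂ q m n (ℕP.m⊔n≤o⇒n≤o M N hm) (ℕP.m⊔n≤o⇒n≤o M N hn)))
    where
    open ℝ x renaming (seq to s; cauchy to c)
    open ℝ y renaming (seq to t; cauchy to d)
    p = c (½ Q.* ε) (half-pos {ε} ε>0)
    q = d (½ Q.* ε) (half-pos {ε} ε>0)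
    M = proj₁ p
    N = proj₁ q
    regroup : ∀ a b c d → (a Q.- b) Q.+ (c Q.- d) ≡ (a Q.+ c) Q.- (b Q.+ d)
    regroup = solve 4 (λ a b c d → (a :- b) :+ (c :- d) := (a :+ c) :- (b :+ d)) refl

  -_ : ℝ → ℝ
  seq (- x) n = Q.- seq x n
  cauchy (- x) ε ε>0 = proj₁ (c ε ε>0) , λ m n hm hn →
    subst (Q._< ε) (trans (sym (ℚP.∣-p∣≡∣p∣ (s m Q.- s n))) (cong ∣_∣ (regroup (s m) (s n))))
      (proj₂ (c ε ε>0) m n hm hn)
    where
    open ℝ x renaming (seq to s; cauchy to c)
    regroup : ∀ a b → Q.- (a Q.- b) ≡ Q.- a Q.- (Q.- b)
    regroup = solve 2 (λ a b → :- (a :- b) := :- a :- (:- b)) refl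

  _*_ : ℝ → ℝ → ℝ
  seq (x * y) n = seq x n Q.* seq y n
  cauchy (x * y) ε ε>0 = M ℕ.⊔ N , λ m n hm hn →
    subst (λ u → ∣ u ∣ Q.< ε) (regroup (s m) (s n) (t m) (t n))
      (sum-small {s m Q.* (t m Q.- t n)} {t n Q.* (s m Q.- s n)} {ε}
        (first m n (ℕP.m⊔n≤o⇒m≤o M N hm) (ℕP.m⊔n≤o⇒m≤o M N hn))
        (second m n (ℕP.m⊔n≤o⇒n≤o M N hm) (ℕP.m⊔n≤o⇒n≤o M N hn)))
    where
    open ℝ x renaming (seq to s; cauchy to c)
    open ℝ y renaming (seq to t; cauchy to d)
    half : ∀ {s t} → Cauchy s → Cauchy t → ∃[ N ] ∀ i m n → N ℕ.≤ i → N ℕ.≤ m → N ℕ.≤ n →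
           ∣ s i Q.* (t m Q.- t n) ∣ Q.< ½ Q.* ε
    half {s} {t} c d = M ℕ.⊔ N , λ i m n hi hm hn →
      product-small {s i} {t m Q.- t n} {B} {δ} {½ Q.* ε} δ>0
        (b i (ℕP.m⊔n≤o⇒m≤o M N hi))
        (proj₂ p m n (ℕP.m⊔n≤o⇒n≤o M N hm) (ℕP.m⊔n≤o⇒n≤o M N hn)) B>0 eq
      where
      bd = bounded {s} c
      B = proj₁ bd
      B>0 = proj₁ (proj₂ bd)
      M = proj₁ (proj₂ (proj₂ bd))
      b = proj₂ (proj₂ (proj₂ bd))
      sh = shrink B (½ Q.* ε) B>0 (half-pos {ε} ε>0)
      δ = proj₁ sh
      δ>0 = proj₁ (proj₂ sh)
      eq = proj₂ (proj₂ sh)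
      p = d δ δ>0
      N = proj₁ p
    M = proj₁ (half {s} {t} c d)
    N = proj₁ (half {t} {s} d c)
    first = λ m n hm hn → proj₂ (half {s} {t} c d) m m n hm hm hn
    second = λ m n hm hn → proj₂ (half {t} {s} d c) n m n hn hm hn
    regroup : ∀ a b c d → a Q.* (c Q.- d) Q.+ d Q.* (a Q.- b) ≡ a Q.* c Q.- b Q.* d
    regroup = solve 4 (λ a b c d → a :* (c :- d) :+ d :* (a :- b) := a :* c :- b :* d) refl

  ≃-refl : ∀ {x} → x ≃ x
  ≃-refl {x} = ≃-pointwise {x} {x} (λ _ → refl)

  ≃-sym : ∀ {x y} → x ≃ y → y ≃ x
  ≃-sym {x} {y} (≃-intro h) = ≃-intro (null-resp (λ n → Q.- (seq x n Q.- seq y n)) (λ n → seq y n Q.- seq x n)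
    (λ n → flip (seq x n) (seq y n)) (null-neg h))
    where
    flip : ∀ a b → Q.- (a Q.- b) ≡ b Q.- a
    flip = solve 2 (λ a b → :- (a :- b) := b :- a) refl

  ≃-trans : ∀ {x y z} → x ≃ y → y ≃ z → x ≃ z
  ≃-trans {x} {y} {z} (≃-intro h) (≃-intro k) =
    ≃-intro (null-resp
      (λ n → (seq x n Q.- seq y n) Q.+ (seq y n Q.- seq z n)) (λ n → seq x n Q.- seq z n)
      (λ n → join (seq x n) (seq y n) (seq z n)) (null-+ h k))
    where
    join : ∀ a b c → (a Q.- b) Q.+ (b Q.- c) ≡ a Q.- c
    join = solve 3 (λ a b c → (a :- b) :+ (b :- c) := a :- c) refl

  +-cong : ∀ {x y u v} → x ≃ y → u ≃ v → x + u ≃ y + v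
  +-cong {x} {y} {u} {v} (≃-intro h) (≃-intro k) =
    ≃-intro (null-resp
      (λ n → (seq x n Q.- seq y n) Q.+ (seq u n Q.- seq v n))
      (λ n → (seq x n Q.+ seq u n) Q.- (seq y n Q.+ seq v n))
      (λ n → regroup (seq x n) (seq y n) (seq u n) (seq v n)) (null-+ h k))
    where
    regroup : ∀ a b c d → (a Q.- b) Q.+ (c Q.- d) ≡ (a Q.+ c) Q.- (b Q.+ d)
    regroup = solve 4 (λ a b c d → (a :- b) :+ (c :- d) := (a :+ c) :- (b :+ d)) refl

  -‿cong : ∀ {x y} → x ≃ y → - x ≃ - y
  -‿cong {x} {y} (≃-intro h) = ≃-intro (null-resp
      (λ n → Q.- (seq x n Q.- seq y n)) (λ n → Q.- seq x n Q.- (Q.- seq y n))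
      (λ n → regroup (seq x n) (seq y n)) (null-neg h))
    where
    regroup : ∀ a b → Q.- (a Q.- b) ≡ Q.- a Q.- (Q.- b)
    regroup = solve 2 (λ a b → :- (a :- b) := :- a :- (:- b)) refl

  *-cong : ∀ {x y u v} → x ≃ y → u ≃ v → x * u ≃ y * v
  *-cong {x} {y} {u} {v} (≃-intro h) (≃-intro k) =
    ≃-intro (null-resp
      (λ n → seq x n Q.* (seq u n Q.- seq v n) Q.+ seq v n Q.* (seq x n Q.- seq y n))
      (λ n → seq x n Q.* seq u n Q.- seq y n Q.* seq v n)
      (λ n → regroup (seq x n) (seq y n) (seq u n) (seq v n))
      (null-+ {λ n → seq x n Q.* (seq u n Q.- seq v n)} {λ n → seq v n Q.* (seq x n Q.- seq y n)} (null-bounded-* {seq x} (cauchy x) k) (null-bounded-* {seq v} (cauchy v) h)))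
    where
    regroup : ∀ a b c d → a Q.* (c Q.- d) Q.+ d Q.* (a Q.- b) ≡ a Q.* c Q.- b Q.* d
    regroup = solve 4 (λ a b c d → a :* (c :- d) :+ d :* (a :- b) := a :* c :- b :* d) refl

  +-assoc : ∀ x y z → (x + y) + z ≃ x + (y + z)
  +-assoc x y z = ≃-pointwise λ n → ℚP.+-assoc (seq x n) (seq y n) (seq z n)

  +-identityˡ : ∀ x → const 0ℚ + x ≃ x
  +-identityˡ x = ≃-pointwise λ n → ℚP.+-identityˡ (seq x n)

  +-identityʳ : ∀ x → x + const 0ℚ ≃ x
  +-identityʳ x = ≃-pointwise λ n → ℚP.+-identityʳ (seq x n)

  +-inverseˡ : ∀ x → - x + x ≃ const 0ℚ
  +-inverseˡ x = ≃-pointwise λ n → ℚP.+-inverseˡ (seq x n)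

  +-inverseʳ : ∀ x → x + - x ≃ const 0ℚ
  +-inverseʳ x = ≃-pointwise λ n → ℚP.+-inverseʳ (seq x n)

  +-comm : ∀ x y → x + y ≃ y + x
  +-comm x y = ≃-pointwise λ n → ℚP.+-comm (seq x n) (seq y n)

  *-assoc : ∀ x y z → (x * y) * z ≃ x * (y * z)
  *-assoc x y z = ≃-pointwise λ n → ℚP.*-assoc (seq x n) (seq y n) (seq z n)

  *-identityˡ : ∀ x → const 1ℚ * x ≃ x
  *-identityˡ x = ≃-pointwise λ n → ℚP.*-identityˡ (seq x n)

  *-identityʳ : ∀ x → x * const 1ℚ ≃ x
  *-identityʳ x = ≃-pointwise λ n → ℚP.*-identityʳ (seq x n)

  *-distribˡ-+ : ∀ x y z → x * (y + z) ≃ x * y + x * z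
  *-distribˡ-+ x y z = ≃-pointwise λ n → ℚP.*-distribˡ-+ (seq x n) (seq y n) (seq z n)

  *-distribʳ-+ : ∀ x y z → (y + z) * x ≃ y * x + z * x
  *-distribʳ-+ x y z = ≃-pointwise λ n → ℚP.*-distribʳ-+ (seq x n) (seq y n) (seq z n)

  *-comm : ∀ x y → x * y ≃ y * x
  *-comm x y = ≃-pointwise λ n → ℚP.*-comm (seq x n) (seq y n)

  ℝ-commutativeRing : CommutativeRing 0ℓ 0ℓ
  ℝ-commutativeRing = record
    { Carrier = ℝ ; _≈_ = _≃_ ; _+_ = _+_ ; _*_ = _*_ ; -_ = -_
    ; 0# = const 0ℚ ; 1# = const 1ℚ
    ; isCommutativeRing = record
      { isRing = record
        { +-isAbelianGroup = record
          { isGroup = record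
            { isMonoid = record
              { isSemigroup = record
                { isMagma = record
                  { isEquivalence = record { refl = ≃-refl ; sym = ≃-sym ; trans = ≃-trans }
                  ; ∙-cong = +-cong }
                ; assoc = +-assoc }
              ; identity = +-identityˡ
                         , +-identityʳ }
            ; inverse = +-inverseˡ
                      , +-inverseʳ
            ; ⁻¹-cong = -‿cong }
          ; comm = +-comm }
        ; *-cong = *-cong
        ; *-assoc = *-assoc
        ; *-identity = *-identityˡ
                     , *-identityʳ
        ; distrib = *-distribˡ-+
                  , *-distribʳ-+ }
      ; *-comm = *-comm } }

module ComplexNumbers where

  open +-*-Solver using (solve; con; _:+_; _:*_; _:-_; _:=_)
  open CauchyReals using (ℝ; ≃-pointwise; ℝ-commutativeRing)
  open CommutativeRing ℝ-commutativeRing renaming (refl to ≃-refl)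

  -- (a , b) stands for a + b i
  ℂ-commutativeRing : CommutativeRing 0ℓ 0ℓ
  ℂ-commutativeRing = record
    { Carrier = ℝ × ℝ
    ; _≈_ = λ (a , b) (c , d) → (a ≈ c) × (b ≈ d)
    ; _+_ = λ (a , b) (c , d) → (a + c) , (b + d)
    ; _*_ = λ (a , b) (c , d) → (a * c - b * d) , (a * d + b * c)
    ; -_ = λ (a , b) → (- a) , (- b)
    ; 0# = 0# , 0# ; 1# = 1# , 0#
    ; isCommutativeRing = record
      { isRing = record
        { +-isAbelianGroup = record
          { isGroup = record
            { isMonoid = record
              { isSemigroup = record
                { isMagma = record
                  { isEquivalence = record
                    { refl = ≃-refl , ≃-refl
                    ; sym = λ (p , q) → sym p , sym q
                    ; trans = λ (p , q) (r , s) → trans p r , trans q s }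
                  ; ∙-cong = λ (p , q) (r , s) → +-cong p r , +-cong q s }
                ; assoc = λ (a , b) (c , d) (e , f) → +-assoc a c e , +-assoc b d f }
              ; identity = (λ (a , b) → +-identityˡ a , +-identityˡ b) , (λ (a , b) → +-identityʳ a , +-identityʳ b) }
            ; inverse = (λ (a , b) → -‿inverseˡ a , -‿inverseˡ b) , (λ (a , b) → -‿inverseʳ a , -‿inverseʳ b)
            ; ⁻¹-cong = λ (p , q) → -‿cong p , -‿cong q }
          ; comm = λ (a , b) (c , d) → +-comm a c , +-comm b d }
        ; *-cong = λ (p , q) (r , s) → +-cong (*-cong p r) (-‿cong (*-cong q s)) , +-cong (*-cong p s) (*-cong q r)
        ; *-assoc = λ (a , b) (c , d) (e , f) →
              ≃-pointwise (λ n → assoc-re (seq a n) (seq b n) (seq c n) (seq d n) (seq e n) (seq f n))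
            , ≃-pointwise (λ n → assoc-im (seq a n) (seq b n) (seq c n) (seq d n) (seq e n) (seq f n))
        ; *-identity = (λ (a , b) → ≃-pointwise (λ n → idˡ-re (seq a n) (seq b n)) , ≃-pointwise (λ n → idˡ-im (seq a n) (seq b n)))
                     , (λ (a , b) → ≃-pointwise (λ n → idʳ-re (seq a n) (seq b n)) , ≃-pointwise (λ n → idʳ-im (seq a n) (seq b n)))
        ; distrib = (λ (a , b) (c , d) (e , f) →
                ≃-pointwise (λ n → dˡ-re (seq a n) (seq b n) (seq c n) (seq d n) (seq e n) (seq f n))
              , ≃-pointwise (λ n → dˡ-im (seq a n) (seq b n) (seq c n) (seq d n) (seq e n) (seq f n)))
                  , (λ (a , b) (c , d) (e , f) →
                ≃-pointwise (λ n → dʳ-re (seq a n) (seq b n) (seq c n) (seq d n) (seq e n) (seq f n))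
              , ≃-pointwise (λ n → dʳ-im (seq a n) (seq b n) (seq c n) (seq d n) (seq e n) (seq f n))) }
      ; *-comm = λ (a , b) (c , d) →
            ≃-pointwise (λ n → comm-re (seq a n) (seq b n) (seq c n) (seq d n))
          , ≃-pointwise (λ n → comm-im (seq a n) (seq b n) (seq c n) (seq d n)) } }
    where
    open ℝ
    assoc-re : ∀ a b c d e f → (a Q.* c Q.- b Q.* d) Q.* e Q.- (a Q.* d Q.+ b Q.* c) Q.* f
                             ≡ a Q.* (c Q.* e Q.- d Q.* f) Q.- b Q.* (c Q.* f Q.+ d Q.* e)
    assoc-re = solve 6 (λ a b c d e f → (a :* c :- b :* d) :* e :- (a :* d :+ b :* c) :* f := a :* (c :* e :- d :* f) :- b :* (c :* f :+ d :* e)) ≡.refl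
    assoc-im : ∀ a b c d e f → (a Q.* c Q.- b Q.* d) Q.* f Q.+ (a Q.* d Q.+ b Q.* c) Q.* e
                             ≡ a Q.* (c Q.* f Q.+ d Q.* e) Q.+ b Q.* (c Q.* e Q.- d Q.* f)
    assoc-im = solve 6 (λ a b c d e f → (a :* c :- b :* d) :* f :+ (a :* d :+ b :* c) :* e := a :* (c :* f :+ d :* e) :+ b :* (c :* e :- d :* f)) ≡.refl
    idˡ-re : ∀ a b → 1ℚ Q.* a Q.- 0ℚ Q.* b ≡ a
    idˡ-re = solve 2 (λ a b → con 1ℚ :* a :- con 0ℚ :* b := a) ≡.refl
    idˡ-im : ∀ a b → 1ℚ Q.* b Q.+ 0ℚ Q.* a ≡ b
    idˡ-im = solve 2 (λ a b → con 1ℚ :* b :+ con 0ℚ :* a := b) ≡.refl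
    idʳ-re : ∀ a b → a Q.* 1ℚ Q.- b Q.* 0ℚ ≡ a
    idʳ-re = solve 2 (λ a b → a :* con 1ℚ :- b :* con 0ℚ := a) ≡.refl
    idʳ-im : ∀ a b → a Q.* 0ℚ Q.+ b Q.* 1ℚ ≡ b
    idʳ-im = solve 2 (λ a b → a :* con 0ℚ :+ b :* con 1ℚ := b) ≡.refl
    dˡ-re : ∀ a b c d e f → a Q.* (c Q.+ e) Q.- b Q.* (d Q.+ f) ≡ (a Q.* c Q.- b Q.* d) Q.+ (a Q.* e Q.- b Q.* f)
    dˡ-re = solve 6 (λ a b c d e f → a :* (c :+ e) :- b :* (d :+ f) := (a :* c :- b :* d) :+ (a :* e :- b :* f)) ≡.refl
    dˡ-im : ∀ a b c d e f → a Q.* (d Q.+ f) Q.+ b Q.* (c Q.+ e) ≡ (a Q.* d Q.+ b Q.* c) Q.+ (a Q.* f Q.+ b Q.* e)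
    dˡ-im = solve 6 (λ a b c d e f → a :* (d :+ f) :+ b :* (c :+ e) := (a :* d :+ b :* c) :+ (a :* f :+ b :* e)) ≡.refl
    dʳ-re : ∀ a b c d e f → (c Q.+ e) Q.* a Q.- (d Q.+ f) Q.* b ≡ (c Q.* a Q.- d Q.* b) Q.+ (e Q.* a Q.- f Q.* b)
    dʳ-re = solve 6 (λ a b c d e f → (c :+ e) :* a :- (d :+ f) :* b := (c :* a :- d :* b) :+ (e :* a :- f :* b)) ≡.refl
    dʳ-im : ∀ a b c d e f → (c Q.+ e) Q.* b Q.+ (d Q.+ f) Q.* a ≡ (c Q.* b Q.+ d Q.* a) Q.+ (e Q.* b Q.+ f Q.* a)
    dʳ-im = solve 6 (λ a b c d e f → (c :+ e) :* b :+ (d :+ f) :* a := (c :* b :+ d :* a) :+ (e :* b :+ f :* a)) ≡.refl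
    comm-re : ∀ a b c d → a Q.* c Q.- b Q.* d ≡ c Q.* a Q.- d Q.* b
    comm-re = solve 4 (λ a b c d → a :* c :- b :* d := c :* a :- d :* b) ≡.refl
    comm-im : ∀ a b c d → a Q.* d Q.+ b Q.* c ≡ c Q.* b Q.+ d Q.* a
    comm-im = solve 4 (λ a b c d → a :* d :+ b :* c := c :* b :+ d :* a) ≡.refl

ℂ : CommutativeRing 0ℓ 0ℓ
ℂ = ComplexNumbers.ℂ-commutativeRing

record FinSet : Set₁ where
  no-eta-equality
  field
    El   : Set
    size : ℕ
    enum : El ↔ Fin size

open FinSet public

infix 4 _≅_

record _≅_ (A B : FinSet) : Set where
  no-eta-equality
  constructor bijection
  field
    bij : El A ↔ El B

  open Inverse bij public using (to; from; strictlyInverseˡ; strictlyInverseʳ)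

decEq : (A : FinSet) → DecidableEquality (El A)
decEq A = inj⇒≟ (↔⇒↣ (enum A))

∅ : FinSet
∅ .El   = ⊥
∅ .size = 0
∅ .enum = ↔-sym 0↔⊥

infixr 5 _⊔_

_⊔_ : FinSet → FinSet → FinSet
(A ⊔ B) .El   = El A ⊎ El B
(A ⊔ B) .size = size A ℕ.+ size B
(A ⊔ B) .enum = ↔-sym +↔⊎ ↔-∘ (enum A ⊎-↔ enum B)

Subset : FinSet → Set
Subset A = El A → Bool

module Enumeration where

  Σ-≡ : ∀ {X : Set} {S : X → Bool} {x y : Σ X (T ∘ S)} → proj₁ x ≡ proj₁ y → x ≡ y
  Σ-≡ {x = _ , p} {y = _ , q} refl = ≡.cong (_ ,_) (T-irrelevant p q)

  card : ∀ n → (Fin n → Bool) → ℕ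
  card zero    S = 0
  card (suc n) S = (if S zero then 1 else 0) ℕ.+ card n (S ∘ suc)

  T↔Fin : ∀ b → T b ↔ Fin (if b then 1 else 0)
  T↔Fin true  = mk↔ₛ′ (λ _ → zero) (λ _ → tt) (λ { zero → refl }) (λ _ → refl)
  T↔Fin false = mk↔ₛ′ (λ ()) (λ ()) (λ ()) (λ ())

  ΣFin-suc : ∀ n (S : Fin (suc n) → Bool) →
             Σ (Fin (suc n)) (T ∘ S) ↔ (T (S zero) ⊎ Σ (Fin n) (T ∘ S ∘ suc))
  ΣFin-suc n S = mk↔ₛ′
    (λ { (zero , p) → inj₁ p ; (suc i , p) → inj₂ (i , p) })
    (λ { (inj₁ p) → zero , p ; (inj₂ (i , p)) → suc i , p })
    (λ { (inj₁ p) → refl ; (inj₂ (i , p)) → refl })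
    (λ { (zero , p) → refl ; (suc i , p) → refl })

  ΣFin : ∀ n (S : Fin n → Bool) → Σ (Fin n) (T ∘ S) ↔ Fin (card n S)
  ΣFin zero    S = mk↔ₛ′ (λ ()) (λ ()) (λ ()) (λ ())
  ΣFin (suc n) S = (↔-sym +↔⊎ ↔-∘ (T↔Fin (S zero) ⊎-↔ ΣFin n (S ∘ suc))) ↔-∘ ΣFin-suc n S

  Σ-reindex : ∀ {X Y : Set} (σ : X ↔ Y) (S : X → Bool) → Σ X (T ∘ S) ↔ Σ Y (T ∘ S ∘ Inverse.from σ)
  Σ-reindex σ S = mk↔ₛ′
    (λ (x , p) → to x , ≡.subst (T ∘ S) (≡.sym (strictlyInverseʳ x)) p)
    (λ (y , p) → from y , p)
    (λ (y , p) → Σ-≡ (strictlyInverseˡ y))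
    (λ (x , p) → Σ-≡ (strictlyInverseʳ x))
    where open Inverse σ

open Enumeration using (Σ-≡; Σ-reindex)
open _≅_ public

infix 9 _↾_

_↾_ : (A : FinSet) → Subset A → FinSet
(A ↾ S) .El   = Σ (El A) (T ∘ S)
(A ↾ S) .size = Enumeration.card (size A) (S ∘ Inverse.from (enum A))
(A ↾ S) .enum = Enumeration.ΣFin (size A) (S ∘ Inverse.from (enum A)) ↔-∘ Σ-reindex (enum A) S

id≅ : (A : FinSet) → A ≅ A
id≅ A .bij = ↔-id (El A)

infixr 9 _∘≅_

_∘≅_ : {A B C : FinSet} → B ≅ C → A ≅ B → A ≅ C
(τ ∘≅ σ) .bij = bij τ ↔-∘ bij σ

_⊔≅_ : {A A' B B' : FinSet} → A ≅ A' → B ≅ B' → A ⊔ B ≅ A' ⊔ B'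
(σ ⊔≅ τ) .bij = bij σ ⊎-↔ bij τ

⊔-assoc : (A B C : FinSet) → (A ⊔ B) ⊔ C ≅ A ⊔ (B ⊔ C)
⊔-assoc A B C .bij = ⊎-assoc 0ℓ (El A) (El B) (El C)

⊔-identityˡ : (A : FinSet) → ∅ ⊔ A ≅ A
⊔-identityˡ A .bij = mk↔ₛ′ (λ { (inj₁ ()) ; (inj₂ a) → a }) inj₂ (λ _ → refl) (λ { (inj₁ ()) ; (inj₂ a) → refl })

⊔-identityʳ : (A : FinSet) → A ⊔ ∅ ≅ A
⊔-identityʳ A .bij = mk↔ₛ′ (λ { (inj₁ a) → a ; (inj₂ ()) }) inj₁ (λ _ → refl) (λ { (inj₁ a) → refl ; (inj₂ ()) })

↾-cong : {A : FinSet} {S S' : Subset A} → S ≗ S' → A ↾ S ≅ A ↾ S'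
↾-cong e .bij = mk↔ₛ′
  (λ (a , p) → a , ≡.subst T (e a) p) (λ (a , p) → a , ≡.subst T (≡.sym (e a)) p)
  (λ _ → Σ-≡ refl) (λ _ → Σ-≡ refl)

image : {A B : FinSet} → A ≅ B → Subset A → Subset B
image σ S b = S (from σ b)

image-≅ : {A B : FinSet} (σ : A ≅ B) (S : Subset A) → A ↾ S ≅ B ↾ image σ S
image-≅ σ S .bij = Σ-reindex (bij σ) S

inl : (A B : FinSet) → Subset A → Subset (A ⊔ B)
inl A B S (inj₁ a) = S a
inl A B S (inj₂ b) = false

inr : (A B : FinSet) → Subset B → Subset (A ⊔ B)
inr A B S (inj₁ a) = false
inr A B S (inj₂ b) = S b

inl-≅ : (A B : FinSet) (S : Subset A) → A ↾ S ≅ (A ⊔ B) ↾ inl A B S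
inl-≅ A B S .bij = mk↔ₛ′
  (λ (a , p) → inj₁ a , p) (λ { (inj₁ a , p) → a , p })
  (λ { (inj₁ a , p) → refl }) (λ (a , p) → refl)

inr-≅ : (A B : FinSet) (S : Subset B) → B ↾ S ≅ (A ⊔ B) ↾ inr A B S
inr-≅ A B S .bij = mk↔ₛ′
  (λ (b , p) → inj₂ b , p) (λ { (inj₂ b , p) → b , p })
  (λ { (inj₂ b , p) → refl }) (λ (b , p) → refl)

record SetComposition (A : FinSet) : Set where
  no-eta-equality
  field
    blocks   : List (Subset A)
    nonempty : All (λ S → ∃[ a ] T (S a)) blocks
    disjoint : AllPairs (λ S S' → ∀ a → T (S a) → T (S' a) → ⊥) blocks
    covering : ∀ a → Any (λ S → T (S a)) blocks

open SetComposition public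

empty-composition : SetComposition ∅
empty-composition .blocks   = []
empty-composition .nonempty = []
empty-composition .disjoint = []
empty-composition .covering = λ ()

image-composition : {A B : FinSet} → A ≅ B → SetComposition A → SetComposition B
image-composition σ α .blocks   = map (image σ) (blocks α)
image-composition σ α .nonempty = AllP.map⁺ (All.map
  (λ {S} (a , p) → to σ a , ≡.subst (T ∘ S) (≡.sym (strictlyInverseʳ σ a)) p) (nonempty α))
image-composition σ α .disjoint = AllPairsP.map⁺ (AllPairs.map (λ d b → d (from σ b)) (disjoint α))
image-composition σ α .covering b = AnyP.map⁺ (covering α (from σ b))

infixr 5 _⋅_

_⋅_ : {A B : FinSet} → SetComposition A → SetComposition B → SetComposition (A ⊔ B)
_⋅_ {A} {B} α β .blocks   = map (inl A B) (blocks α) ++ map (inr A B) (blocks β)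
_⋅_ {A} {B} α β .nonempty = AllP.++⁺
  (AllP.map⁺ (All.map (λ (a , p) → inj₁ a , p) (nonempty α)))
  (AllP.map⁺ (All.map (λ (b , p) → inj₂ b , p) (nonempty β)))
_⋅_ {A} {B} α β .disjoint = AllPairsP.++⁺
  (AllPairsP.map⁺ (AllPairs.map (λ d → λ { (inj₁ a) → d a ; (inj₂ b) → λ () }) (disjoint α)))
  (AllPairsP.map⁺ (AllPairs.map (λ d → λ { (inj₁ a) → λ () ; (inj₂ b) → d b }) (disjoint β)))
  (AllP.map⁺ (All.universal (λ S → AllP.map⁺ (All.universal
    (λ S' → λ { (inj₁ a) _ () ; (inj₂ b) () _ }) (blocks β))) (blocks α)))
_⋅_ {A} {B} α β .covering (inj₁ a) = AnyP.++⁺ˡ (AnyP.map⁺ (covering α a))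
_⋅_ {A} {B} α β .covering (inj₂ b) = AnyP.++⁺ʳ (map (inl A B) (blocks α)) (AnyP.map⁺ (covering β b))

module LinearAlgebra (K : CommutativeRing 0ℓ 0ℓ) where

  private module K = CommutativeRing K

  VectorSpace : Set₁
  VectorSpace = LeftModule K.ring 0ℓ 0ℓ

  Vector : VectorSpace → Set
  Vector = LeftModule.Carrierᴹ

  module _ (V W : VectorSpace) where

    private
      module V = LeftModule V
      module W = LeftModule W
      module M = LeftModuleMorphisms V.rawLeftModule W.rawLeftModule

    IsLinear : (Vector V → Vector W) → Set
    IsLinear = M.IsLeftModuleHomomorphism

    IsLinearIsomorphism : (Vector V → Vector W) → Set
    IsLinearIsomorphism = M.IsLeftModuleIsomorphism

  module _ {V W : VectorSpace} where

    private
      module V = LeftModule V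
      module W = LeftModule W

    -- preservation of 0 and of negatives is automatic
    isLinear : ∀ {f} → (∀ {x y} → x V.≈ᴹ y → f x W.≈ᴹ f y) →
               (∀ x y → f (x V.+ᴹ y) W.≈ᴹ f x W.+ᴹ f y) →
               (∀ c x → f (c V.*ₗ x) W.≈ᴹ c W.*ₗ f x) → IsLinear V W f
    isLinear {f} f-cong f-+ f-* = record
      { +ᴹ-isGroupHomomorphism = record
        { isMonoidHomomorphism = record
          { isMagmaHomomorphism = record
            { isRelHomomorphism = record { cong = f-cong } ; homo = f-+ }
          ; ε-homo = f-0 }
        ; ⁻¹-homo = λ x → inverseˡ-uniqueᴹ (f (V.-ᴹ x)) (f x)
            (W.≈ᴹ-trans (W.≈ᴹ-sym (f-+ (V.-ᴹ x) x)) (W.≈ᴹ-trans (f-cong (V.-ᴹ‿inverseˡ x)) f-0)) }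
      ; *ₗ-homo = f-* }
      where
      open LeftModuleProperties W using (inverseˡ-uniqueᴹ)
      f-0 : f V.0ᴹ W.≈ᴹ W.0ᴹ
      f-0 = W.≈ᴹ-trans (f-cong (V.≈ᴹ-sym (V.*ₗ-zeroˡ V.0ᴹ)))
              (W.≈ᴹ-trans (f-* K.0# V.0ᴹ) (W.*ₗ-zeroˡ (f V.0ᴹ)))

  record IsBilinear (U V W : VectorSpace) (b : Vector U → Vector V → Vector W) : Set where
    field
      linearˡ : ∀ y → IsLinear U W (λ x → b x y)
      linearʳ : ∀ x → IsLinear V W (b x)

  infixl 6 _⊞_
  infixr 7 _⊡_

  data Comb (G : Set) : Set where
    𝟘   : Comb G
    gen : G → Comb G
    _⊞_ : Comb G → Comb G → Comb G
    _⊡_ : K.Carrier → Comb G → Comb G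

  module _ {G : Set} (Rel : Comb G → Comb G → Set) where

    infix 4 _≈_

    data _≈_ : Comb G → Comb G → Set where
      rel         : ∀ {x y} → Rel x y → x ≈ y
      ≈-refl      : ∀ {x} → x ≈ x
      ≈-sym       : ∀ {x y} → x ≈ y → y ≈ x
      ≈-trans     : ∀ {x y z} → x ≈ y → y ≈ z → x ≈ z
      ⊞-cong      : ∀ {x y u v} → x ≈ y → u ≈ v → x ⊞ u ≈ y ⊞ v
      ⊡-cong      : ∀ {c d x y} → c K.≈ d → x ≈ y → c ⊡ x ≈ d ⊡ y
      ⊞-assoc     : ∀ x y z → (x ⊞ y) ⊞ z ≈ x ⊞ (y ⊞ z)
      ⊞-comm      : ∀ x y → x ⊞ y ≈ y ⊞ x
      ⊞-identityˡ : ∀ x → 𝟘 ⊞ x ≈ x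
      ⊡-zeroˡ     : ∀ x → K.0# ⊡ x ≈ 𝟘
      ⊡-identityˡ : ∀ x → K.1# ⊡ x ≈ x
      ⊡-assoc     : ∀ c d x → (c K.* d) ⊡ x ≈ c ⊡ d ⊡ x
      ⊡-distribʳ  : ∀ x c d → (c K.+ d) ⊡ x ≈ c ⊡ x ⊞ d ⊡ x
      ⊡-distribˡ  : ∀ c x y → c ⊡ (x ⊞ y) ≈ c ⊡ x ⊞ c ⊡ y

    Presented : VectorSpace
    Presented = record
      { Carrierᴹ = Comb G ; _≈ᴹ_ = _≈_ ; _+ᴹ_ = _⊞_ ; _*ₗ_ = _⊡_ ; 0ᴹ = 𝟘 ; -ᴹ_ = K.- K.1# ⊡_
      ; isLeftModule = record
        { isLeftSemimodule = record
          { +ᴹ-isCommutativeMonoid = record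
            { isMonoid = record
              { isSemigroup = record
                { isMagma = record
                  { isEquivalence = record { refl = ≈-refl ; sym = ≈-sym ; trans = ≈-trans }
                  ; ∙-cong = ⊞-cong }
                ; assoc = ⊞-assoc }
              ; identity = ⊞-identityˡ , λ x → ≈-trans (⊞-comm x 𝟘) (⊞-identityˡ x) }
            ; comm = ⊞-comm }
          ; isPreleftSemimodule = record
            { *ₗ-cong = ⊡-cong
            ; *ₗ-zeroˡ = ⊡-zeroˡ
            ; *ₗ-distribʳ = ⊡-distribʳ
            ; *ₗ-identityˡ = ⊡-identityˡ
            ; *ₗ-assoc = ⊡-assoc
            ; *ₗ-zeroʳ = λ c → ≈-trans (⊡-cong K.refl (≈-sym (⊡-zeroˡ 𝟘)))
                (≈-trans (≈-sym (⊡-assoc c K.0# 𝟘)) (≈-trans (⊡-cong (K.zeroʳ c) ≈-refl) (⊡-zeroˡ 𝟘)))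
            ; *ₗ-distribˡ = ⊡-distribˡ } }
        ; -ᴹ‿cong = ⊡-cong K.refl
        ; -ᴹ‿inverse = inverseˡ , λ x → ≈-trans (⊞-comm x _) (inverseˡ x) } }
      where
      inverseˡ : ∀ x → K.- K.1# ⊡ x ⊞ x ≈ 𝟘
      inverseˡ x = ≈-trans (⊞-cong ≈-refl (≈-sym (⊡-identityˡ x)))
        (≈-trans (≈-sym (⊡-distribʳ x (K.- K.1#) K.1#))
          (≈-trans (⊡-cong (K.-‿inverseˡ K.1#) ≈-refl) (⊡-zeroˡ x)))

  module Extension (W : VectorSpace) where

    private module W = LeftModule W
    open SetoidReasoning W.≈ᴹ-setoid

    module _ {G : Set} where

      extend : (G → Vector W) → Comb G → Vector W
      extend f 𝟘       = W.0ᴹ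
      extend f (gen g) = f g
      extend f (x ⊞ y) = extend f x W.+ᴹ extend f y
      extend f (c ⊡ x) = c W.*ₗ extend f x

      Respects : (Comb G → Comb G → Set) → (G → Vector W) → Set
      Respects Rel f = ∀ {x y} → Rel x y → extend f x W.≈ᴹ extend f y

      extend-cong : ∀ {Rel : Comb G → Comb G → Set} {f} → Respects Rel f → ∀ {x y} → _≈_ Rel x y → extend f x W.≈ᴹ extend f y
      extend-cong r (rel p) = r p
      extend-cong r ≈-refl = W.≈ᴹ-refl
      extend-cong r (≈-sym p) = W.≈ᴹ-sym (extend-cong r p)
      extend-cong r (≈-trans p q) = W.≈ᴹ-trans (extend-cong r p) (extend-cong r q)
      extend-cong r (⊞-cong p q) = W.+ᴹ-cong (extend-cong r p) (extend-cong r q)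
      extend-cong r (⊡-cong e p) = W.*ₗ-cong e (extend-cong r p)
      extend-cong r (⊞-assoc x y z) = W.+ᴹ-assoc _ _ _
      extend-cong r (⊞-comm x y) = W.+ᴹ-comm _ _
      extend-cong r (⊞-identityˡ x) = W.+ᴹ-identityˡ _
      extend-cong r (⊡-zeroˡ x) = W.*ₗ-zeroˡ _
      extend-cong r (⊡-identityˡ x) = W.*ₗ-identityˡ _
      extend-cong r (⊡-assoc c d x) = W.*ₗ-assoc _ _ _
      extend-cong r (⊡-distribʳ x c d) = W.*ₗ-distribʳ _ _ _
      extend-cong r (⊡-distribˡ c x y) = W.*ₗ-distribˡ _ _ _

      extend-linear : ∀ {Rel : Comb G → Comb G → Set} {f} → Respects Rel f → IsLinear (Presented Rel) W (extend f)
      extend-linear {Rel} r = isLinear {Presented Rel} {W} (extend-cong r) (λ _ _ → W.≈ᴹ-refl) (λ _ _ → W.≈ᴹ-refl)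

      linear-ext : ∀ {Rel : Comb G → Comb G → Set} {f g} → IsLinear (Presented Rel) W f → IsLinear (Presented Rel) W g →
                   (∀ a → f (gen a) W.≈ᴹ g (gen a)) → ∀ x → f x W.≈ᴹ g x
      linear-ext {f = f} {g} Lf Lg e = go
        where
        module F = LeftModuleMorphisms.IsLeftModuleHomomorphism Lf
        module G = LeftModuleMorphisms.IsLeftModuleHomomorphism Lg
        go : ∀ x → f x W.≈ᴹ g x
        go 𝟘 = W.≈ᴹ-trans F.0ᴹ-homo (W.≈ᴹ-sym G.0ᴹ-homo)
        go (gen a) = e a
        go (x ⊞ y) = W.≈ᴹ-trans (F.+ᴹ-homo x y) (W.≈ᴹ-trans (W.+ᴹ-cong (go x) (go y)) (W.≈ᴹ-sym (G.+ᴹ-homo x y)))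
        go (c ⊡ x) = W.≈ᴹ-trans (F.*ₗ-homo c x) (W.≈ᴹ-trans (W.*ₗ-cong K.refl (go x)) (W.≈ᴹ-sym (G.*ₗ-homo c x)))

      extend-≗ : ∀ {f g} → (∀ a → f a W.≈ᴹ g a) → ∀ x → extend f x W.≈ᴹ extend g x
      extend-≗ e 𝟘 = W.≈ᴹ-refl
      extend-≗ e (gen a) = e a
      extend-≗ e (x ⊞ y) = W.+ᴹ-cong (extend-≗ e x) (extend-≗ e y)
      extend-≗ e (c ⊡ x) = W.*ₗ-cong K.refl (extend-≗ e x)

      extend-0 : ∀ x → extend (λ _ → W.0ᴹ) x W.≈ᴹ W.0ᴹ
      extend-0 𝟘 = W.≈ᴹ-refl
      extend-0 (gen a) = W.≈ᴹ-refl
      extend-0 (x ⊞ y) = W.≈ᴹ-trans (W.+ᴹ-cong (extend-0 x) (extend-0 y)) (W.+ᴹ-identityˡ _)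
      extend-0 (c ⊡ x) = W.≈ᴹ-trans (W.*ₗ-cong K.refl (extend-0 x)) (W.*ₗ-zeroʳ c)

      extend-+ : ∀ f g x → extend (λ a → f a W.+ᴹ g a) x W.≈ᴹ extend f x W.+ᴹ extend g x
      extend-+ f g 𝟘 = W.≈ᴹ-sym (W.+ᴹ-identityˡ _)
      extend-+ f g (gen a) = W.≈ᴹ-refl
      extend-+ f g (x ⊞ y) = begin
        extend (λ a → f a W.+ᴹ g a) x W.+ᴹ extend (λ a → f a W.+ᴹ g a) y
          ≈⟨ W.+ᴹ-cong (extend-+ f g x) (extend-+ f g y) ⟩
        (extend f x W.+ᴹ extend g x) W.+ᴹ (extend f y W.+ᴹ extend g y)
          ≈⟨ W.+ᴹ-assoc _ _ _ ⟩
        extend f x W.+ᴹ (extend g x W.+ᴹ (extend f y W.+ᴹ extend g y))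
          ≈⟨ W.+ᴹ-cong W.≈ᴹ-refl (W.≈ᴹ-sym (W.+ᴹ-assoc _ _ _)) ⟩
        extend f x W.+ᴹ ((extend g x W.+ᴹ extend f y) W.+ᴹ extend g y)
          ≈⟨ W.+ᴹ-cong W.≈ᴹ-refl (W.+ᴹ-cong (W.+ᴹ-comm _ _) W.≈ᴹ-refl) ⟩
        extend f x W.+ᴹ ((extend f y W.+ᴹ extend g x) W.+ᴹ extend g y)
          ≈⟨ W.+ᴹ-cong W.≈ᴹ-refl (W.+ᴹ-assoc _ _ _) ⟩
        extend f x W.+ᴹ (extend f y W.+ᴹ (extend g x W.+ᴹ extend g y))
          ≈⟨ W.+ᴹ-assoc _ _ _ ⟨
        (extend f x W.+ᴹ extend f y) W.+ᴹ (extend g x W.+ᴹ extend g y) ∎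
      extend-+ f g (c ⊡ x) = W.≈ᴹ-trans (W.*ₗ-cong K.refl (extend-+ f g x)) (W.*ₗ-distribˡ c _ _)

      extend-* : ∀ c f x → extend (λ a → c W.*ₗ f a) x W.≈ᴹ c W.*ₗ extend f x
      extend-* c f 𝟘 = W.≈ᴹ-sym (W.*ₗ-zeroʳ c)
      extend-* c f (gen a) = W.≈ᴹ-refl
      extend-* c f (x ⊞ y) = W.≈ᴹ-trans (W.+ᴹ-cong (extend-* c f x) (extend-* c f y)) (W.≈ᴹ-sym (W.*ₗ-distribˡ c _ _))
      extend-* c f (d ⊡ x) = begin
        d W.*ₗ extend (λ a → c W.*ₗ f a) x ≈⟨ W.*ₗ-cong K.refl (extend-* c f x) ⟩
        d W.*ₗ (c W.*ₗ extend f x)         ≈⟨ W.*ₗ-assoc d c _ ⟨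
        (d K.* c) W.*ₗ extend f x          ≈⟨ W.*ₗ-cong (K.*-comm d c) W.≈ᴹ-refl ⟩
        (c K.* d) W.*ₗ extend f x          ≈⟨ W.*ₗ-assoc c d _ ⟩
        c W.*ₗ (d W.*ₗ extend f x)         ∎

    module _ {G H : Set} where

      extend₂ : (G → H → Vector W) → Comb G → Comb H → Vector W
      extend₂ b x y = extend (λ g → extend (b g) y) x

      extend-swap : ∀ b x y → extend₂ b x y W.≈ᴹ extend (λ h → extend (λ g → b g h) x) y
      extend-swap b 𝟘 y = W.≈ᴹ-sym (extend-0 y)
      extend-swap b (gen g) y = W.≈ᴹ-refl
      extend-swap b (x ⊞ x') y = W.≈ᴹ-trans (W.+ᴹ-cong (extend-swap b x y) (extend-swap b x' y)) (W.≈ᴹ-sym (extend-+ _ _ y))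
      extend-swap b (c ⊡ x) y = W.≈ᴹ-trans (W.*ₗ-cong K.refl (extend-swap b x y)) (W.≈ᴹ-sym (extend-* c _ y))

      extend₂-bilinear : ∀ {R S} b → (∀ h → Respects R (λ g → b g h)) → (∀ g → Respects S (b g)) →
                         IsBilinear (Presented R) (Presented S) W (extend₂ b)
      extend₂-bilinear {R} {S} b l r = record
        { linearˡ = λ y → extend-linear (λ {x} {x'} p →
            W.≈ᴹ-trans (extend-swap b x y) (W.≈ᴹ-trans (extend-≗ (λ h → l h p) y) (W.≈ᴹ-sym (extend-swap b x' y))))
        ; linearʳ = λ x → isLinear {Presented S} {W} (λ p → extend-≗ (λ g → extend-cong (r g) p) x)
            (λ y y' → extend-+ _ _ x) (λ c y → extend-* c _ x) }

  -- ⨁ over the indices i up to the identification that ∼ makes: v ∼ w says that v and w are the same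
  -- vector, lying in one summand that has both i and j as its index

  module _ {I : Set} (V : I → VectorSpace) (_∼_ : ∀ {i j} → Vector (V i) → Vector (V j) → Set) where

    private module V i = LeftModule (V i)

    data ⨁-Rel : Comb (Σ I (Vector ∘ V)) → Comb (Σ I (Vector ∘ V)) → Set where
      inj-≈ : ∀ {i v w} → V._≈ᴹ_ i v w → ⨁-Rel (gen (i , v)) (gen (i , w))
      inj-∼ : ∀ {i j} {v : Vector (V i)} {w : Vector (V j)} → v ∼ w → ⨁-Rel (gen (i , v)) (gen (j , w))
      inj-+ : ∀ {i} v w → ⨁-Rel (gen (i , V._+ᴹ_ i v w)) (gen (i , v) ⊞ gen (i , w))
      inj-* : ∀ {i} c v → ⨁-Rel (gen (i , V._*ₗ_ i c v)) (c ⊡ gen (i , v))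

    ⨁ : VectorSpace
    ⨁ = Presented ⨁-Rel

    inj-linear : ∀ i → IsLinear (V i) ⨁ (λ v → gen (i , v))
    inj-linear i = isLinear {V i} {⨁} (λ e → rel (inj-≈ e)) (λ v w → rel (inj-+ v w)) (λ c v → rel (inj-* c v))

    module _ (W : VectorSpace) where

      private module W = LeftModule W
      open Extension W

      ⨁-respects : (f : ∀ i → Vector (V i) → Vector W) → (∀ i → IsLinear (V i) W (f i)) →
                   (∀ {i j} {v : Vector (V i)} {w : Vector (V j)} → v ∼ w → f i v W.≈ᴹ f j w) →
                   Respects ⨁-Rel (λ (i , v) → f i v)
      ⨁-respects f L e (inj-≈ {i} p) = LeftModuleMorphisms.IsLeftModuleHomomorphism.⟦⟧-cong (L i) p
      ⨁-respects f L e (inj-∼ p) = e p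
      ⨁-respects f L e (inj-+ {i} v w) = LeftModuleMorphisms.IsLeftModuleHomomorphism.+ᴹ-homo (L i) v w
      ⨁-respects f L e (inj-* {i} c v) = LeftModuleMorphisms.IsLeftModuleHomomorphism.*ₗ-homo (L i) c v

  -- the tensor product of V i₁ , … , V iₗ for a list of indices, generated by the pure tensors;
  -- over the empty list it is K

  module _ {I : Set} (V : I → VectorSpace) where

    private module V i = LeftModule (V i)

    Vectors : List I → Set
    Vectors = All (Vector ∘ V)

    data _≋_ : ∀ {is} → Vectors is → Vectors is → Set where
      []  : [] ≋ []
      _∷_ : ∀ {i is} {v w : Vector (V i)} {vs ws : Vectors is} → V._≈ᴹ_ i v w → vs ≋ ws → (v ∷ vs) ≋ (w ∷ ws)

    -- AddAt us vs ws: equal except at one place, where u = v + w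
    data AddAt : ∀ {is} → Vectors is → Vectors is → Vectors is → Set where
      here  : ∀ {i is u v w} {vs : Vectors is} → V._≈ᴹ_ i u (V._+ᴹ_ i v w) → AddAt (u ∷ vs) (v ∷ vs) (w ∷ vs)
      there : ∀ {i is} {v : Vector (V i)} {us vs ws : Vectors is} → AddAt us vs ws → AddAt (v ∷ us) (v ∷ vs) (v ∷ ws)

    -- ScaleAt c us vs: equal except at one place, where u = c v
    data ScaleAt (c : K.Carrier) : ∀ {is} → Vectors is → Vectors is → Set where
      here  : ∀ {i is u v} {vs : Vectors is} → V._≈ᴹ_ i u (V._*ₗ_ i c v) → ScaleAt c (u ∷ vs) (v ∷ vs)
      there : ∀ {i is} {v : Vector (V i)} {us vs : Vectors is} → ScaleAt c us vs → ScaleAt c (v ∷ us) (v ∷ vs)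

    data ⨂-Rel {is : List I} : Comb (Vectors is) → Comb (Vectors is) → Set where
      pure-≋ : ∀ {vs ws} → vs ≋ ws → ⨂-Rel (gen vs) (gen ws)
      pure-+ : ∀ {us vs ws} → AddAt us vs ws → ⨂-Rel (gen us) (gen vs ⊞ gen ws)
      pure-* : ∀ {c us vs} → ScaleAt c us vs → ⨂-Rel (gen us) (c ⊡ gen vs)

    ⨂ : List I → VectorSpace
    ⨂ is = Presented (⨂-Rel {is})

module Species (K : CommutativeRing 0ℓ 0ℓ) where

  open LinearAlgebra K

  private
    module K = CommutativeRing K

  record VectorSpecies : Set₁ where
    field
      obj        : FinSet → VectorSpace
      transport  : ∀ {A B} → A ≅ B → Vector (obj A) → Vector (obj B)

    module Obj A = LeftModule (obj A)

    field
      transport-linear : ∀ {A B} (σ : A ≅ B) → IsLinear (obj A) (obj B) (transport σ)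
      transport-cong   : ∀ {A B} {σ τ : A ≅ B} → to σ ≗ to τ → ∀ x → Obj._≈ᴹ_ B (transport σ x) (transport τ x)
      transport-id     : ∀ {A} x → Obj._≈ᴹ_ A (transport (id≅ A) x) x
      transport-∘      : ∀ {A B C} (τ : B ≅ C) (σ : A ≅ B) x →
                         Obj._≈ᴹ_ C (transport (τ ∘≅ σ) x) (transport τ (transport σ x))

  VanishesAt∅ : VectorSpecies → Set
  VanishesAt∅ 𝐪 = ∀ x → Obj._≈ᴹ_ ∅ x (Obj.0ᴹ ∅)
    where open VectorSpecies 𝐪

  -- monoids for the Cauchy product: a map out of M[A] ⊗ M[B] is given as a bilinear map, and the
  -- union of disjoint sets is ⊔; a decomposition of another set is reached by transport and naturality
  record MonoidInSpecies : Set₁ where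
    field
      species : VectorSpecies

    open VectorSpecies species public

    field
      unit      : Vector (obj ∅)
      mult      : ∀ {A B} → Vector (obj A) → Vector (obj B) → Vector (obj (A ⊔ B))
      bilinear  : ∀ {A B} → IsBilinear (obj A) (obj B) (obj (A ⊔ B)) mult
      natural   : ∀ {A A' B B'} (σ : A ≅ A') (τ : B ≅ B') x y →
                  Obj._≈ᴹ_ (A' ⊔ B') (transport (σ ⊔≅ τ) (mult x y)) (mult (transport σ x) (transport τ y))
      assoc     : ∀ {A B C} x y z →
                  Obj._≈ᴹ_ (A ⊔ (B ⊔ C)) (transport (⊔-assoc A B C) (mult (mult x y) z)) (mult x (mult y z))
      identityˡ : ∀ {A} x → Obj._≈ᴹ_ A (transport (⊔-identityˡ A) (mult unit x)) x
      identityʳ : ∀ {A} x → Obj._≈ᴹ_ A (transport (⊔-identityʳ A) (mult x unit)) x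

  record MonoidIsomorphism (M N : MonoidInSpecies) : Set₁ where
    private
      module M = MonoidInSpecies M
      module N = MonoidInSpecies N
    field
      hom             : ∀ A → Vector (M.obj A) → Vector (N.obj A)
      hom-isomorphism : ∀ A → IsLinearIsomorphism (M.obj A) (N.obj A) (hom A)
      hom-natural     : ∀ {A B} (σ : A ≅ B) x → N.Obj._≈ᴹ_ B (hom B (M.transport σ x)) (N.transport σ (hom A x))
      hom-unit        : N.Obj._≈ᴹ_ ∅ (hom ∅ M.unit) N.unit
      hom-mult        : ∀ {A B} x y → N.Obj._≈ᴹ_ (A ⊔ B) (hom (A ⊔ B) (M.mult x y)) (N.mult (hom A x) (hom B y))

  linear-∘ : ∀ {U V W : VectorSpace} {f : Vector V → Vector W} {g : Vector U → Vector V} →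
             IsLinear V W f → IsLinear U V g → IsLinear U W (f ∘ g)
  linear-∘ {U} {V} {W} F G = isLinear {U} {W}
    (λ e → F.⟦⟧-cong (G.⟦⟧-cong e))
    (λ x y → W.≈ᴹ-trans (F.⟦⟧-cong (G.+ᴹ-homo x y)) (F.+ᴹ-homo _ _))
    (λ c x → W.≈ᴹ-trans (F.⟦⟧-cong (G.*ₗ-homo c x)) (F.*ₗ-homo c _))
    where
    module W = LeftModule W
    module F = LeftModuleMorphisms.IsLeftModuleHomomorphism F
    module G = LeftModuleMorphisms.IsLeftModuleHomomorphism G

  linear-id : ∀ {V : VectorSpace} → IsLinear V V id
  linear-id {V} = isLinear {V} {V} id (λ _ _ → V.≈ᴹ-refl) (λ _ _ → V.≈ᴹ-refl)
    where module V = LeftModule V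

  -- The free monoid on q: A ↦ ⨁ over (A₁ , … , Aₗ) ⊨ A of q[A₁] ⊗ ⋯ ⊗ q[Aₗ]

  module Free (q : VectorSpecies) where

    open VectorSpecies q

    blockSpace : (A : FinSet) → Subset A → VectorSpace
    blockSpace A S = obj (A ↾ S)

    Tuple : (A : FinSet) → List (Subset A) → Set
    Tuple A = Vectors (blockSpace A)

    Tensor : (A : FinSet) → SetComposition A → VectorSpace
    Tensor A α = ⨂ (blockSpace A) (blocks α)

    private
      module B A S = LeftModule (blockSpace A S)

    -- a set composition has its blocks given up to ≗ (and carries proofs), so it too is represented by
    -- several α; SameTensor identifies the copies of v₁ ⊗ ⋯ ⊗ vₗ
    data SameTuple {A} : ∀ {Ss Ts} → Tuple A Ss → Tuple A Ts → Set where
      []  : SameTuple [] []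
      _∷_ : ∀ {S T Ss Ts} {v : Vector (blockSpace A S)} {w : Vector (blockSpace A T)} {vs : Tuple A Ss} {ws : Tuple A Ts} →
            Σ[ e ∈ S ≗ T ] B._≈ᴹ_ A T (transport (↾-cong e) v) w → SameTuple vs ws → SameTuple (v ∷ vs) (w ∷ ws)

    data SameTensor {A} : {α β : SetComposition A} → Vector (Tensor A α) → Vector (Tensor A β) → Set where
      same-pure : ∀ {α β} {vs : Tuple A (blocks α)} {ws : Tuple A (blocks β)} → SameTuple vs ws →
                  SameTensor {α = α} {β} (gen vs) (gen ws)

    freeObj : FinSet → VectorSpace
    freeObj A = ⨁ (Tensor A) (λ {α} {β} → SameTensor {A} {α} {β})

    private module F A = LeftModule (freeObj A)

    pure : ∀ {A} (α : SetComposition A) → Tuple A (blocks α) → Vector (freeObj A)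
    pure α vs = gen (α , gen vs)

    pure-same : ∀ {A α β} {vs : Tuple A (blocks α)} {ws : Tuple A (blocks β)} → SameTuple vs ws →
                F._≈ᴹ_ A (pure α vs) (pure β ws)
    pure-same {α = α} {β} e = rel (inj-∼ (same-pure {α = α} {β} e))

    free-ext : ∀ {A} (W : VectorSpace) {f g : Vector (freeObj A) → Vector W} →
               IsLinear (freeObj A) W f → IsLinear (freeObj A) W g →
               (∀ α vs → LeftModule._≈ᴹ_ W (f (pure α vs)) (g (pure α vs))) →
               ∀ x → LeftModule._≈ᴹ_ W (f x) (g x)
    free-ext {A} W Lf Lg e = Extension.linear-ext W Lf Lg λ (α , t) →
      Extension.linear-ext W (linear-∘ {Tensor A α} {freeObj A} {W} Lf (inj-linear _ _ α))
                             (linear-∘ {Tensor A α} {freeObj A} {W} Lg (inj-linear _ _ α)) (e α) t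

    module Coherence where

      follow : ∀ {A B C} (τ : B ≅ C) {ρ : A ≅ B} {v y} → Obj._≈ᴹ_ B y (transport ρ v) →
               Obj._≈ᴹ_ C (transport τ y) (transport (τ ∘≅ ρ) v)
      follow {A} {B} {C} τ {ρ} {v} e = Obj.≈ᴹ-trans C
        (LeftModuleMorphisms.IsLeftModuleHomomorphism.⟦⟧-cong (transport-linear τ) e)
        (Obj.≈ᴹ-sym C (transport-∘ τ ρ v))

      along : ∀ {A B} (σ : A ≅ B) {v} → Obj._≈ᴹ_ B (transport σ v) (transport σ v)
      along {A} {B} σ = Obj.≈ᴹ-refl B

      stay : ∀ {A v} → Obj._≈ᴹ_ A v (transport (id≅ A) v)
      stay {A} {v} = Obj.≈ᴹ-sym A (transport-id v)

      coherent : ∀ {A B} {ρ ρ' : A ≅ B} {v y z} → Obj._≈ᴹ_ B y (transport ρ v) → Obj._≈ᴹ_ B z (transport ρ' v) →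
                 to ρ ≗ to ρ' → Obj._≈ᴹ_ B y z
      coherent {A} {B} {ρ} {ρ'} {v} p q e =
        Obj.≈ᴹ-trans B p (Obj.≈ᴹ-trans B (transport-cong {σ = ρ} {ρ'} e v) (Obj.≈ᴹ-sym B q))

    open Coherence

    -- tuples along a family of linear maps  q[A ↾ S] → q[B ↾ f S]
    module Push {A B : FinSet} (f : Subset A → Subset B) (σ : ∀ S → A ↾ S ≅ B ↾ f S) where

      push : ∀ {Ss} → Tuple A Ss → Tuple B (map f Ss)
      push []             = []
      push (_∷_ {S} v vs) = transport (σ S) v ∷ push vs

      private module L S = LeftModuleMorphisms.IsLeftModuleHomomorphism (transport-linear (σ S))

      push-≋ : ∀ {Ss} {vs ws : Tuple A Ss} → _≋_ (blockSpace A) vs ws → _≋_ (blockSpace B) (push vs) (push ws)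
      push-≋ [] = []
      push-≋ (_∷_ {S} e es) = L.⟦⟧-cong S e ∷ push-≋ es

      push-+ : ∀ {Ss} {us vs ws : Tuple A Ss} → AddAt (blockSpace A) us vs ws → AddAt (blockSpace B) (push us) (push vs) (push ws)
      push-+ (here {S} e) = here (B.≈ᴹ-trans B (f S) (L.⟦⟧-cong S e) (L.+ᴹ-homo S _ _))
      push-+ (there p) = there (push-+ p)

      push-* : ∀ {c Ss} {us vs : Tuple A Ss} → ScaleAt (blockSpace A) c us vs → ScaleAt (blockSpace B) c (push us) (push vs)
      push-* (here {S} e) = here (B.≈ᴹ-trans B (f S) (L.⟦⟧-cong S e) (L.*ₗ-homo S _ _))
      push-* (there p) = there (push-* p)

      push-same : (f-cong : ∀ {S T} → S ≗ T → f S ≗ f T) →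
                  (∀ {S T} (e : S ≗ T) x → to (↾-cong {B} (f-cong e)) (to (σ S) x) ≡ to (σ T) (to (↾-cong {A} e) x)) →
                  ∀ {Ss Ts} {vs : Tuple A Ss} {ws : Tuple A Ts} → SameTuple vs ws → SameTuple (push vs) (push ws)
      push-same c sq [] = []
      push-same c sq (_∷_ {S} {T} {v = v} {w} (e , p) ps) =
        (c e , coherent {ρ = ↾-cong (c e) ∘≅ σ S} {σ T ∘≅ ↾-cong e}
                 (follow (↾-cong (c e)) (along (σ S)))
                 (follow (σ T) (Obj.≈ᴹ-sym _ p)) (sq e))
        ∷ push-same c sq ps

    module _ {A : FinSet} where

      private
        V = blockSpace A
        infixr 5 _⧺_
        _⧺_ : ∀ {Ss Ts} → Tuple A Ss → Tuple A Ts → Tuple A (Ss ++ Ts)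
        _⧺_ = AllP.++⁺

      ≋-refl : ∀ {Ss} {vs : Tuple A Ss} → _≋_ V vs vs
      ≋-refl {vs = []} = []
      ≋-refl {vs = _∷_ {S} v vs} = B.≈ᴹ-refl A S ∷ ≋-refl

      ++-≋ : ∀ {Ss Ts} {vs vs' : Tuple A Ss} {ws ws' : Tuple A Ts} → _≋_ V vs vs' → _≋_ V ws ws' → _≋_ V (vs ⧺ ws) (vs' ⧺ ws')
      ++-≋ [] e = e
      ++-≋ (d ∷ ds) e = d ∷ ++-≋ ds e

      ++-+ˡ : ∀ {Ss Ts} {us vs ws : Tuple A Ss} {xs : Tuple A Ts} → AddAt V us vs ws → AddAt V (us ⧺ xs) (vs ⧺ xs) (ws ⧺ xs)
      ++-+ˡ (here e) = here e
      ++-+ˡ (there p) = there (++-+ˡ p)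

      ++-+ʳ : ∀ {Ss Ts} {us vs ws : Tuple A Ts} (xs : Tuple A Ss) → AddAt V us vs ws → AddAt V (xs ⧺ us) (xs ⧺ vs) (xs ⧺ ws)
      ++-+ʳ [] p = p
      ++-+ʳ (x ∷ xs) p = there (++-+ʳ xs p)

      ++-*ˡ : ∀ {c Ss Ts} {us vs : Tuple A Ss} {xs : Tuple A Ts} → ScaleAt V c us vs → ScaleAt V c (us ⧺ xs) (vs ⧺ xs)
      ++-*ˡ (here e) = here e
      ++-*ˡ (there p) = there (++-*ˡ p)

      ++-*ʳ : ∀ {c Ss Ts} {us vs : Tuple A Ts} (xs : Tuple A Ss) → ScaleAt V c us vs → ScaleAt V c (xs ⧺ us) (xs ⧺ vs)
      ++-*ʳ [] p = p
      ++-*ʳ (x ∷ xs) p = there (++-*ʳ xs p)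

      same-refl : ∀ {Ss} {vs : Tuple A Ss} → SameTuple vs vs
      same-refl {vs = []} = []
      same-refl {vs = _∷_ {S} v vs} =
        ((λ _ → refl) , coherent {ρ = ↾-cong (λ _ → refl)} {id≅ (A ↾ S)} (along (↾-cong (λ _ → refl))) stay (λ _ → Σ-≡ refl)) ∷ same-refl

      same-++ : ∀ {Ss Ss' Ts Ts'} {vs : Tuple A Ss} {vs' : Tuple A Ss'} {ws : Tuple A Ts} {ws' : Tuple A Ts'} →
                SameTuple vs vs' → SameTuple ws ws' → SameTuple (vs ⧺ ws) (vs' ⧺ ws')
      same-++ [] q = q
      same-++ (p ∷ ps) q = p ∷ same-++ ps q

    module _ {A B : FinSet} (σ : A ≅ B) where

      open Push {A} {B} (image σ) (image-≅ σ) public using () renaming (push to transportTuple)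
      private module P = Push {A} {B} (image σ) (image-≅ σ)

      transportTensor : (α : SetComposition A) → Vector (Tensor A α) → Vector (Tensor B (image-composition σ α))
      transportTensor α = Extension.extend (Tensor B (image-composition σ α)) (λ vs → gen (transportTuple vs))

      transportTensor-linear : ∀ α → IsLinear (Tensor A α) (Tensor B (image-composition σ α)) (transportTensor α)
      transportTensor-linear α = Extension.extend-linear (Tensor B (image-composition σ α)) λ
        { (pure-≋ e) → rel (pure-≋ (P.push-≋ e))
        ; (pure-+ p) → rel (pure-+ (P.push-+ p))
        ; (pure-* p) → rel (pure-* (P.push-* p)) }

      freeTransport : Vector (freeObj A) → Vector (freeObj B)
      freeTransport = Extension.extend (freeObj B) (λ (α , t) → gen (image-composition σ α , transportTensor α t))

      transportTuple-same : ∀ {Ss Ts} {vs : Tuple A Ss} {ws : Tuple A Ts} → SameTuple vs ws →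
                            SameTuple (transportTuple vs) (transportTuple ws)
      transportTuple-same = P.push-same (λ e b → e (from σ b)) (λ {S} {T} e x → Σ-≡ {S = image σ T} refl)

      freeTransport-linear : IsLinear (freeObj A) (freeObj B) freeTransport
      freeTransport-linear = Extension.extend-linear (freeObj B)
        (⨁-respects _ _ (freeObj B) _
          (λ α → linear-∘ {Tensor A α} {Tensor B (image-composition σ α)} {freeObj B}
                   (inj-linear _ _ (image-composition σ α)) (transportTensor-linear α))
          (λ { (same-pure {α} {β} e) → pure-same {α = image-composition σ α} {image-composition σ β} (transportTuple-same e) }))

    transportTuple-cong : ∀ {A B} {σ τ : A ≅ B} → to σ ≗ to τ → ∀ {Ss} (vs : Tuple A Ss) →
                          SameTuple (transportTuple σ vs) (transportTuple τ vs)
    transportTuple-cong e [] = []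
    transportTuple-cong {A} {B} {σ} {τ} e (_∷_ {S} v vs) =
      (d , coherent {ρ = ↾-cong d ∘≅ image-≅ σ S} {image-≅ τ S}
             (follow (↾-cong d) (along (image-≅ σ S))) (along (image-≅ τ S)) (λ (a , p) → Σ-≡ (e a)))
      ∷ transportTuple-cong e vs
      where
      d : image σ S ≗ image τ S
      d b = ≡.cong S (≡.trans (≡.sym (strictlyInverseʳ τ (from σ b)))
              (≡.cong (from τ) (≡.trans (≡.sym (e (from σ b))) (strictlyInverseˡ σ b))))

    transportTuple-id : ∀ {A Ss} (vs : Tuple A Ss) → SameTuple (transportTuple (id≅ A) vs) vs
    transportTuple-id [] = []
    transportTuple-id {A} (_∷_ {S} v vs) =
      (d , coherent {ρ = ↾-cong d ∘≅ image-≅ (id≅ A) S} {id≅ (A ↾ S)}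
             (follow (↾-cong d) (along (image-≅ (id≅ A) S))) stay (λ x → Σ-≡ refl))
      ∷ transportTuple-id vs
      where
      d : image (id≅ A) S ≗ S
      d _ = refl

    transportTuple-∘ : ∀ {A B C} (τ : B ≅ C) (σ : A ≅ B) {Ss} (vs : Tuple A Ss) →
                       SameTuple (transportTuple (τ ∘≅ σ) vs) (transportTuple τ (transportTuple σ vs))
    transportTuple-∘ τ σ [] = []
    transportTuple-∘ τ σ (_∷_ {S} v vs) =
      (d , coherent {ρ = ↾-cong d ∘≅ image-≅ (τ ∘≅ σ) S} {image-≅ τ (image σ S) ∘≅ image-≅ σ S}
             (follow (↾-cong d) (along (image-≅ (τ ∘≅ σ) S)))
             (follow (image-≅ τ (image σ S)) (along (image-≅ σ S))) (λ x → Σ-≡ refl))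
      ∷ transportTuple-∘ τ σ vs
      where
      d : image (τ ∘≅ σ) S ≗ image τ (image σ S)
      d _ = refl

    freeSpecies : VectorSpecies
    freeSpecies = record
      { obj = freeObj
      ; transport = freeTransport
      ; transport-linear = freeTransport-linear
      ; transport-cong = λ {A} {B} {σ} {τ} e → free-ext (freeObj B) (freeTransport-linear σ) (freeTransport-linear τ)
          (λ α vs → pure-same {α = image-composition σ α} {image-composition τ α} (transportTuple-cong e vs))
      ; transport-id = λ {A} → free-ext (freeObj A) (freeTransport-linear (id≅ A)) (linear-id {freeObj A})
          (λ α vs → pure-same {α = image-composition (id≅ A) α} {α} (transportTuple-id vs))
      ; transport-∘ = λ {A} {B} {C} τ σ → free-ext (freeObj C) (freeTransport-linear (τ ∘≅ σ))
          (linear-∘ {freeObj A} {freeObj B} {freeObj C} (freeTransport-linear τ) (freeTransport-linear σ))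
          (λ α vs → pure-same {α = image-composition (τ ∘≅ σ) α} {image-composition τ (image-composition σ α)}
                      (transportTuple-∘ τ σ vs))
      }

    module _ {A B : FinSet} where

      private
        module L = Push {A} {A ⊔ B} (inl A B) (inl-≅ A B)
        module R = Push {B} {A ⊔ B} (inr A B) (inr-≅ A B)

      concatTuple : ∀ {Ss Ts} → Tuple A Ss → Tuple B Ts → Tuple (A ⊔ B) (map (inl A B) Ss ++ map (inr A B) Ts)
      concatTuple vs ws = AllP.++⁺ (L.push vs) (R.push ws)

      concatTensor : (α : SetComposition A) (β : SetComposition B) →
                     Vector (Tensor A α) → Vector (Tensor B β) → Vector (Tensor (A ⊔ B) (α ⋅ β))
      concatTensor α β = Extension.extend₂ (Tensor (A ⊔ B) (α ⋅ β)) (λ vs ws → gen (concatTuple vs ws))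

      concatTensor-bilinear : ∀ α β → IsBilinear (Tensor A α) (Tensor B β) (Tensor (A ⊔ B) (α ⋅ β)) (concatTensor α β)
      concatTensor-bilinear α β = Extension.extend₂-bilinear (Tensor (A ⊔ B) (α ⋅ β)) _
        (λ ws → λ
          { (pure-≋ e) → rel (pure-≋ (++-≋ (L.push-≋ e) ≋-refl))
          ; (pure-+ p) → rel (pure-+ (++-+ˡ (L.push-+ p)))
          ; (pure-* p) → rel (pure-* (++-*ˡ (L.push-* p))) })
        (λ vs → λ
          { (pure-≋ e) → rel (pure-≋ (++-≋ ≋-refl (R.push-≋ e)))
          ; (pure-+ p) → rel (pure-+ (++-+ʳ (L.push vs) (R.push-+ p)))
          ; (pure-* p) → rel (pure-* (++-*ʳ (L.push vs) (R.push-* p))) })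

      private module C α β = IsBilinear (concatTensor-bilinear α β)

      freeMult : Vector (freeObj A) → Vector (freeObj B) → Vector (freeObj (A ⊔ B))
      freeMult = Extension.extend₂ (freeObj (A ⊔ B)) (λ (α , s) (β , t) → gen (α ⋅ β , concatTensor α β s t))

      concat-sameˡ : ∀ {Ss Ss' Ts} {vs : Tuple A Ss} {vs' : Tuple A Ss'} {ws : Tuple B Ts} → SameTuple vs vs' →
                     SameTuple (concatTuple vs ws) (concatTuple vs' ws)
      concat-sameˡ e = same-++ (L.push-same (λ { e (inj₁ a) → e a ; e (inj₂ b) → refl }) (λ {S} {T} e x → Σ-≡ {S = inl A B T} refl) e) same-refl

      concat-sameʳ : ∀ {Ss Ts Ts'} {vs : Tuple A Ss} {ws : Tuple B Ts} {ws' : Tuple B Ts'} → SameTuple ws ws' →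
                     SameTuple (concatTuple vs ws) (concatTuple vs ws')
      concat-sameʳ {vs = vs} e = same-++ (same-refl {vs = L.push vs})
        (R.push-same (λ { e (inj₁ a) → refl ; e (inj₂ b) → e b }) (λ {S} {T} e x → Σ-≡ {S = inr A B T} refl) e)

      freeMult-bilinear : IsBilinear (freeObj A) (freeObj B) (freeObj (A ⊔ B)) freeMult
      freeMult-bilinear = Extension.extend₂-bilinear (freeObj (A ⊔ B)) _
        (λ (β , t) → ⨁-respects _ _ (freeObj (A ⊔ B)) _
          (λ α → linˡ α β t)
          (λ { (same-pure {α} {α'} {vs} {vs'} e) → Extension.linear-ext (freeObj (A ⊔ B)) (linʳ α β (gen vs)) (linʳ α' β (gen vs'))
                 (λ ws → pure-same {α = α ⋅ β} {α' ⋅ β} (concat-sameˡ e)) t }))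
        (λ (α , s) → ⨁-respects _ _ (freeObj (A ⊔ B)) _
          (λ β → linʳ α β s)
          (λ { (same-pure {β} {β'} {ws} {ws'} e) → Extension.linear-ext (freeObj (A ⊔ B)) (linˡ α β (gen ws)) (linˡ α β' (gen ws'))
                 (λ vs → pure-same {α = α ⋅ β} {α ⋅ β'} (concat-sameʳ {vs = vs} e)) s }))
        where
        linˡ : ∀ α β t → IsLinear (Tensor A α) (freeObj (A ⊔ B)) (λ s → gen (α ⋅ β , concatTensor α β s t))
        linˡ α β t = linear-∘ {Tensor A α} {Tensor (A ⊔ B) (α ⋅ β)} {freeObj (A ⊔ B)} (inj-linear _ _ (α ⋅ β)) (C.linearˡ α β t)
        linʳ : ∀ α β s → IsLinear (Tensor B β) (freeObj (A ⊔ B)) (λ t → gen (α ⋅ β , concatTensor α β s t))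
        linʳ α β s = linear-∘ {Tensor B β} {Tensor (A ⊔ B) (α ⋅ β)} {freeObj (A ⊔ B)} (inj-linear _ _ (α ⋅ β)) (C.linearʳ α β s)

    natural-tuple : ∀ {A A' B B'} (σ : A ≅ A') (τ : B ≅ B') {Ss Ts} (vs : Tuple A Ss) (ws : Tuple B Ts) →
                    SameTuple (transportTuple (σ ⊔≅ τ) (concatTuple vs ws)) (concatTuple (transportTuple σ vs) (transportTuple τ ws))
    natural-tuple σ τ [] [] = []
    natural-tuple {A} {A'} {B} {B'} σ τ [] (_∷_ {T} w ws) =
      (d , coherent {ρ = ↾-cong d ∘≅ (image-≅ (σ ⊔≅ τ) (inr A B T) ∘≅ inr-≅ A B T)} {inr-≅ A' B' (image τ T) ∘≅ image-≅ τ T}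
             (follow (↾-cong d) (follow (image-≅ (σ ⊔≅ τ) (inr A B T)) (along (inr-≅ A B T))))
             (follow (inr-≅ A' B' (image τ T)) (along (image-≅ τ T))) (λ x → Σ-≡ {S = inr A' B' (image τ T)} refl))
      ∷ natural-tuple σ τ [] ws
      where
      d : image (σ ⊔≅ τ) (inr A B T) ≗ inr A' B' (image τ T)
      d (inj₁ a) = refl
      d (inj₂ b) = refl
    natural-tuple {A} {A'} {B} {B'} σ τ (_∷_ {S} v vs) ws =
      (d , coherent {ρ = ↾-cong d ∘≅ (image-≅ (σ ⊔≅ τ) (inl A B S) ∘≅ inl-≅ A B S)} {inl-≅ A' B' (image σ S) ∘≅ image-≅ σ S}
             (follow (↾-cong d) (follow (image-≅ (σ ⊔≅ τ) (inl A B S)) (along (inl-≅ A B S))))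
             (follow (inl-≅ A' B' (image σ S)) (along (image-≅ σ S))) (λ x → Σ-≡ {S = inl A' B' (image σ S)} refl))
      ∷ natural-tuple σ τ vs ws
      where
      d : image (σ ⊔≅ τ) (inl A B S) ≗ inl A' B' (image σ S)
      d (inj₁ a) = refl
      d (inj₂ b) = refl

    module _ {A B C : FinSet} where

      private
        D = A ⊔ (B ⊔ C)
        α = ⊔-assoc A B C

      assoc-tuple : ∀ {Ss Ts Us} (vs : Tuple A Ss) (ws : Tuple B Ts) (us : Tuple C Us) →
                    SameTuple (transportTuple α (concatTuple (concatTuple vs ws) us)) (concatTuple vs (concatTuple ws us))
      assoc-tuple [] [] [] = []
      assoc-tuple [] [] (_∷_ {U} u us) =
        (d , coherent {ρ = ↾-cong d ∘≅ (image-≅ α (inr (A ⊔ B) C U) ∘≅ inr-≅ (A ⊔ B) C U)}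
                      {inr-≅ A (B ⊔ C) (inr B C U) ∘≅ inr-≅ B C U}
               (follow (↾-cong d) (follow (image-≅ α (inr (A ⊔ B) C U)) (along (inr-≅ (A ⊔ B) C U))))
               (follow (inr-≅ A (B ⊔ C) (inr B C U)) (along (inr-≅ B C U))) (λ x → Σ-≡ {S = inr A (B ⊔ C) (inr B C U)} refl))
        ∷ assoc-tuple [] [] us
        where
        d : image α (inr (A ⊔ B) C U) ≗ inr A (B ⊔ C) (inr B C U)
        d (inj₁ a) = refl
        d (inj₂ (inj₁ b)) = refl
        d (inj₂ (inj₂ c)) = refl
      assoc-tuple [] (_∷_ {T} w ws) us =
        (d , coherent {ρ = ↾-cong d ∘≅ (image-≅ α (inl (A ⊔ B) C (inr A B T)) ∘≅ (inl-≅ (A ⊔ B) C (inr A B T) ∘≅ inr-≅ A B T))}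
                      {inr-≅ A (B ⊔ C) (inl B C T) ∘≅ inl-≅ B C T}
               (follow (↾-cong d) (follow (image-≅ α (inl (A ⊔ B) C (inr A B T)))
                 (follow (inl-≅ (A ⊔ B) C (inr A B T)) (along (inr-≅ A B T)))))
               (follow (inr-≅ A (B ⊔ C) (inl B C T)) (along (inl-≅ B C T))) (λ x → Σ-≡ {S = inr A (B ⊔ C) (inl B C T)} refl))
        ∷ assoc-tuple [] ws us
        where
        d : image α (inl (A ⊔ B) C (inr A B T)) ≗ inr A (B ⊔ C) (inl B C T)
        d (inj₁ a) = refl
        d (inj₂ (inj₁ b)) = refl
        d (inj₂ (inj₂ c)) = refl
      assoc-tuple (_∷_ {S} v vs) ws us =
        (d , coherent {ρ = ↾-cong d ∘≅ (image-≅ α (inl (A ⊔ B) C (inl A B S)) ∘≅ (inl-≅ (A ⊔ B) C (inl A B S) ∘≅ inl-≅ A B S))}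
                      {inl-≅ A (B ⊔ C) S}
               (follow (↾-cong d) (follow (image-≅ α (inl (A ⊔ B) C (inl A B S)))
                 (follow (inl-≅ (A ⊔ B) C (inl A B S)) (along (inl-≅ A B S)))))
               (along (inl-≅ A (B ⊔ C) S)) (λ x → Σ-≡ {S = inl A (B ⊔ C) S} refl))
        ∷ assoc-tuple vs ws us
        where
        d : image α (inl (A ⊔ B) C (inl A B S)) ≗ inl A (B ⊔ C) S
        d (inj₁ a) = refl
        d (inj₂ (inj₁ b)) = refl
        d (inj₂ (inj₂ c)) = refl

    identityˡ-tuple : ∀ {A Ss} (vs : Tuple A Ss) → SameTuple (transportTuple (⊔-identityˡ A) (concatTuple {∅} {A} {[]} [] vs)) vs
    identityˡ-tuple [] = []
    identityˡ-tuple {A} (_∷_ {S} v vs) =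
      (d , coherent {ρ = ↾-cong d ∘≅ (image-≅ (⊔-identityˡ A) (inr ∅ A S) ∘≅ inr-≅ ∅ A S)} {id≅ (A ↾ S)}
             (follow (↾-cong d) (follow (image-≅ (⊔-identityˡ A) (inr ∅ A S)) (along (inr-≅ ∅ A S)))) stay (λ x → Σ-≡ {S = S} refl))
      ∷ identityˡ-tuple vs
      where
      d : image (⊔-identityˡ A) (inr ∅ A S) ≗ S
      d _ = refl

    identityʳ-tuple : ∀ {A Ss} (vs : Tuple A Ss) → SameTuple (transportTuple (⊔-identityʳ A) (concatTuple {A} {∅} {_} {[]} vs [])) vs
    identityʳ-tuple [] = []
    identityʳ-tuple {A} (_∷_ {S} v vs) =
      (d , coherent {ρ = ↾-cong d ∘≅ (image-≅ (⊔-identityʳ A) (inl A ∅ S) ∘≅ inl-≅ A ∅ S)} {id≅ (A ↾ S)}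
             (follow (↾-cong d) (follow (image-≅ (⊔-identityʳ A) (inl A ∅ S)) (along (inl-≅ A ∅ S)))) stay (λ x → Σ-≡ {S = S} refl))
      ∷ identityʳ-tuple vs
      where
      d : image (⊔-identityʳ A) (inl A ∅ S) ≗ S
      d _ = refl

    private
      module Mult {A B} = IsBilinear (freeMult-bilinear {A} {B})

    freeMonoid : MonoidInSpecies
    freeMonoid = record
      { species = freeSpecies
      ; unit = pure empty-composition []
      ; mult = freeMult
      ; bilinear = freeMult-bilinear
      ; natural = λ {A} {A'} {B} {B'} σ τ x y → let W = freeObj (A' ⊔ B') in free-ext W
          (linear-∘ {freeObj A} {freeObj (A ⊔ B)} {W} (freeTransport-linear (σ ⊔≅ τ)) (Mult.linearˡ y))
          (linear-∘ {freeObj A} {freeObj A'} {W} (Mult.linearˡ (freeTransport τ y)) (freeTransport-linear σ))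
          (λ α vs → free-ext W
            (linear-∘ {freeObj B} {freeObj (A ⊔ B)} {W} (freeTransport-linear (σ ⊔≅ τ)) (Mult.linearʳ (pure α vs)))
            (linear-∘ {freeObj B} {freeObj B'} {W} (Mult.linearʳ (freeTransport σ (pure α vs))) (freeTransport-linear τ))
            (λ β ws → pure-same {α = image-composition (σ ⊔≅ τ) (α ⋅ β)} {image-composition σ α ⋅ image-composition τ β}
                        (natural-tuple σ τ vs ws)) y) x
      ; assoc = λ {A} {B} {C} x y z → let W = freeObj (A ⊔ (B ⊔ C)) ; a = ⊔-assoc A B C in free-ext W
          (linear-∘ {freeObj A} {freeObj ((A ⊔ B) ⊔ C)} {W} (freeTransport-linear a)
            (linear-∘ {freeObj A} {freeObj (A ⊔ B)} {freeObj ((A ⊔ B) ⊔ C)} (Mult.linearˡ z) (Mult.linearˡ y)))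
          (Mult.linearˡ (freeMult y z))
          (λ α vs → free-ext W
            (linear-∘ {freeObj B} {freeObj ((A ⊔ B) ⊔ C)} {W} (freeTransport-linear a)
              (linear-∘ {freeObj B} {freeObj (A ⊔ B)} {freeObj ((A ⊔ B) ⊔ C)} (Mult.linearˡ z) (Mult.linearʳ (pure α vs))))
            (linear-∘ {freeObj B} {freeObj (B ⊔ C)} {W} (Mult.linearʳ (pure α vs)) (Mult.linearˡ z))
            (λ β ws → free-ext W
              (linear-∘ {freeObj C} {freeObj ((A ⊔ B) ⊔ C)} {W} (freeTransport-linear a)
                (Mult.linearʳ (freeMult (pure α vs) (pure β ws))))
              (linear-∘ {freeObj C} {freeObj (B ⊔ C)} {W} (Mult.linearʳ (pure α vs)) (Mult.linearʳ (pure β ws)))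
              (λ γ us → pure-same {α = image-composition a ((α ⋅ β) ⋅ γ)} {α ⋅ (β ⋅ γ)} (assoc-tuple vs ws us)) z) y) x
      ; identityˡ = λ {A} → free-ext (freeObj A)
          (linear-∘ {freeObj A} {freeObj (∅ ⊔ A)} {freeObj A} (freeTransport-linear (⊔-identityˡ A)) (Mult.linearʳ (pure empty-composition [])))
          (linear-id {freeObj A})
          (λ α vs → pure-same {α = image-composition (⊔-identityˡ A) (empty-composition ⋅ α)} {α} (identityˡ-tuple vs))
      ; identityʳ = λ {A} → free-ext (freeObj A)
          (linear-∘ {freeObj A} {freeObj (A ⊔ ∅)} {freeObj A} (freeTransport-linear (⊔-identityʳ A)) (Mult.linearˡ (pure empty-composition [])))
          (linear-id {freeObj A})
          (λ α vs → pure-same {α = image-composition (⊔-identityʳ A) (α ⋅ empty-composition)} {α} (identityʳ-tuple vs))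
      }

-- a relation on A is a subset of A × A, hence Bool-valued; compare by ≗ᴾ
record PO (A : FinSet) : Set where
  no-eta-equality
  field
    _≤ᵇ_           : El A → El A → Bool
    isPartialOrder : IsPartialOrder _≡_ (λ i j → T (i ≤ᵇ j))

  _⪯_ : El A → El A → Set
  i ⪯ j = T (i ≤ᵇ j)

  open IsPartialOrder isPartialOrder public
    using () renaming (refl to ⪯-refl; trans to ⪯-trans; antisym to ⪯-antisym)

open PO using () renaming (_≤ᵇ_ to order)

infix 4 _≗ᴾ_

_≗ᴾ_ : ∀ {A} → PO A → PO A → Set
R ≗ᴾ S = ∀ i j → order R i j ≡ order S i j

imagePO : ∀ {A B} → A ≅ B → PO A → PO B
imagePO σ R .PO._≤ᵇ_ b b' = order R (from σ b) (from σ b')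
imagePO σ R .PO.isPartialOrder = record
  { isPreorder = record
    { isEquivalence = ≡.isEquivalence
    ; reflexive = λ { refl → PO.⪯-refl R }
    ; trans = PO.⪯-trans R }
  ; antisym = λ p q → ≡.trans (≡.sym (strictlyInverseˡ σ _))
      (≡.trans (≡.cong (to σ) (PO.⪯-antisym R p q)) (strictlyInverseˡ σ _)) }

infixr 5 _∙_

_∙_ : ∀ {A B} → PO A → PO B → PO (A ⊔ B)
(P ∙ Q) .PO._≤ᵇ_ (inj₁ i) (inj₁ j) = order P i j
(P ∙ Q) .PO._≤ᵇ_ (inj₁ i) (inj₂ j) = true
(P ∙ Q) .PO._≤ᵇ_ (inj₂ i) (inj₁ j) = false
(P ∙ Q) .PO._≤ᵇ_ (inj₂ i) (inj₂ j) = order Q i j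
(P ∙ Q) .PO.isPartialOrder = record
  { isPreorder = record
    { isEquivalence = ≡.isEquivalence
    ; reflexive = λ { {inj₁ i} refl → PO.⪯-refl P ; {inj₂ j} refl → PO.⪯-refl Q }
    ; trans = λ
      { {inj₁ _} {inj₁ _} {inj₁ _} p q → PO.⪯-trans P p q
      ; {inj₁ _} {inj₁ _} {inj₂ _} p q → tt
      ; {inj₁ _} {inj₂ _} {inj₂ _} p q → tt
      ; {inj₂ _} {inj₂ _} {inj₂ _} p q → PO.⪯-trans Q p q } }
  ; antisym = λ
    { {inj₁ _} {inj₁ _} p q → ≡.cong inj₁ (PO.⪯-antisym P p q)
    ; {inj₂ _} {inj₂ _} p q → ≡.cong inj₂ (PO.⪯-antisym Q p q) } }

∅-order : PO ∅
∅-order .PO._≤ᵇ_ ()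
∅-order .PO.isPartialOrder = record
  { isPreorder = record { isEquivalence = ≡.isEquivalence ; reflexive = λ { {()} } ; trans = λ { {()} } }
  ; antisym = λ { {()} } }

record FiniteField (q : ℕ) : Set₁ where
  field
    commutativeRing : CommutativeRing 0ℓ 0ℓ

  open CommutativeRing commutativeRing public

  field
    1≉0     : ¬ (1# ≈ 0#)
    inverse : ∀ x → ¬ (x ≈ 0#) → ∃[ y ] x * y ≈ 1#
    finite  : Inverse setoid (≡.setoid (Fin q))

  _≈?_ : Decidable _≈_
  x ≈? y = Dec.map′
    (λ e → trans (sym (F.strictlyInverseʳ x)) (trans (F.from-cong e) (F.strictlyInverseʳ y))) F.to-cong
    (F.to x FinP.≟ F.to y)
    where module F = Inverse finite

module PatternGroups {q : ℕ} (𝔽 : FiniteField q) where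

  open FiniteField 𝔽 using (_≈?_; 1≉0) renaming
    ( Carrier to F; _≈_ to _≈ꟳ_; _+_ to _+ꟳ_; _*_ to _*ꟳ_; 0# to 0ꟳ; 1# to 1ꟳ; -_ to -ꟳ_
    ; refl to ≈-refl; sym to ≈-sym; trans to ≈-trans )
  private module 𝔽 = FiniteField 𝔽

  open CommutativeMonoidSum 𝔽.+-commutativeMonoid using (sum; sum-cong-≋; ∑-distrib-+; sum-remove; sum-replicate-zero)

  ∑ : (A : FinSet) → (El A → F) → F
  ∑ A f = sum (λ k → f (Inverse.from (enum A) k))

  when : (b : Bool) → (.(T b) → F) → F
  when true  f = f tt
  when false f = 0ꟳ

  module _ {A : FinSet} where

    -- the proof that i ⪯ j is irrelevant: entry is a function on the intervals [i,j]
    record UT (R : PO A) : Set where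
      no-eta-equality
      open PO R
      field
        entry : ∀ i j → .(i ⪯ j) → F
        unit  : ∀ i → entry i i ⪯-refl ≈ꟳ 1ꟳ

    open UT public

    -- extension by zero from the intervals of R to all pairs
    ext : ∀ {R} → UT R → El A → El A → F
    ext {R} u i j = when (order R i j) (entry u i j)

    infix 4 _≈ᵁ_

    _≈ᵁ_ : ∀ {R} → UT R → UT R → Set
    _≈ᵁ_ {R} u v = ∀ i j .(p : PO._⪯_ R i j) → entry u i j p ≈ꟳ entry v i j p

  module Sums (A : FinSet) where

    open SetoidReasoning 𝔽.setoid

    private _≟_ = decEq A

    ∑-cong : ∀ {f g : El A → F} → (∀ x → f x ≈ꟳ g x) → ∑ A f ≈ꟳ ∑ A g
    ∑-cong e = sum-cong-≋ {n = size A} (λ k → e (Inverse.from (enum A) k))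

    ∑-+ : ∀ f g → ∑ A (λ x → f x +ꟳ g x) ≈ꟳ ∑ A f +ꟳ ∑ A g
    ∑-+ f g = ∑-distrib-+ (λ k → f (Inverse.from (enum A) k)) (λ k → g (Inverse.from (enum A) k))

    sum-zero : ∀ {n} {f : Fin n → F} → (∀ k → f k ≈ꟳ 0ꟳ) → sum f ≈ꟳ 0ꟳ
    sum-zero {n} e = ≈-trans (sum-cong-≋ {n = n} e) (sum-replicate-zero n)

    ∑-zero : ∀ {f} → (∀ x → f x ≈ꟳ 0ꟳ) → ∑ A f ≈ꟳ 0ꟳ
    ∑-zero e = sum-zero {n = size A} (λ k → e (Inverse.from (enum A) k))

    sum-single : ∀ {n} (f : Fin n → F) k → (∀ l → l ≢ k → f l ≈ꟳ 0ꟳ) → sum f ≈ꟳ f k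
    sum-single {suc n} f k e = begin
      sum f                                     ≈⟨ sum-remove {i = k} f ⟩
      f k +ꟳ sum (λ l → f (punchIn k l))        ≈⟨ 𝔽.+-congˡ (sum-zero {n} (λ l → e (punchIn k l) (FinP.punchInᵢ≢i k l))) ⟩
      f k +ꟳ 0ꟳ                                 ≈⟨ 𝔽.+-identityʳ _ ⟩
      f k                                       ∎

    ∑-single : ∀ f a → (∀ x → x ≢ a → f x ≈ꟳ 0ꟳ) → ∑ A f ≈ꟳ f a
    ∑-single f a e = begin
      ∑ A f             ≈⟨ sum-single (λ k → f (E.from k)) (E.to a)
                             (λ l l≢ → e (E.from l) (λ eq → l≢ (≡.trans (≡.sym (E.strictlyInverseˡ l)) (≡.cong E.to eq)))) ⟩
      f (E.from (E.to a)) ≈⟨ 𝔽.reflexive (≡.cong f (E.strictlyInverseʳ a)) ⟩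
      f a               ∎
      where module E = Inverse (enum A)

  module _ {A : FinSet} {R : PO A} where

    open PO R
    open Sums A
    private _≟_ = decEq A

    ext-in : ∀ (u : UT R) i j .(p : i ⪯ j) → ext u i j ≈ꟳ entry u i j p
    ext-in u i j p = go (order R i j) (entry u i j) p
      where
      go : ∀ b (f : .(T b) → F) .(p : T b) → when b f ≈ꟳ f p
      go true f p = ≈-refl
      go false f ()

    ext-out : ∀ (u : UT R) i j → ¬ (i ⪯ j) → ext u i j ≈ꟳ 0ꟳ
    ext-out u i j = go (order R i j) (entry u i j)
      where
      go : ∀ b (f : .(T b) → F) → ¬ T b → when b f ≈ꟳ 0ꟳ
      go true f n = ⊥-elim (n tt)
      go false f n = ≈-refl

    ext-unit : ∀ (u : UT R) i → ext u i i ≈ꟳ 1ꟳ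
    ext-unit u i = ≈-trans (ext-in u i i ⪯-refl) (unit u i)

    -- the sum of u([i,j]) v([j,k]) over i ⪯ j ⪯ k: all other summands vanish
    product : UT R → UT R → El A → El A → F
    product u v i k = ∑ A (λ j → ext u i j *ꟳ ext v j k)

    product-term-out : ∀ (u v : UT R) i j k → ¬ (i ⪯ j × j ⪯ k) → ext u i j *ꟳ ext v j k ≈ꟳ 0ꟳ
    product-term-out u v i j k n with T? (order R i j) | T? (order R j k)
    ... | yes p | yes p' = ⊥-elim (n (p , p'))
    ... | no p  | _      = ≈-trans (𝔽.*-congʳ (ext-out u i j p)) (𝔽.zeroˡ _)
    ... | _     | no p'  = ≈-trans (𝔽.*-congˡ (ext-out v j k p')) (𝔽.zeroʳ _)

    infixl 7 _·_

    _·_ : UT R → UT R → UT R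
    (u · v) .entry i k _ = product u v i k
    (u · v) .unit i = ≈-trans
      (∑-single _ i (λ j j≢i → product-term-out u v i j i (λ (p , p') → j≢i (⪯-antisym p' p))))
      (≈-trans (𝔽.*-cong (ext-unit u i) (ext-unit v i)) (𝔽.*-identityˡ 1ꟳ))

    𝟙 : UT R
    𝟙 .entry i j _ = if ⌊ i ≟ j ⌋ then 1ꟳ else 0ꟳ
    𝟙 .unit i with i ≟ i
    ... | yes _ = ≈-refl
    ... | no n  = ⊥-elim (n refl)

  record Subposet {A : FinSet} (R : PO A) : Set where
    field
      poset  : PO A
      subset : ∀ {i j} → PO._⪯_ poset i j → PO._⪯_ R i j

  open Subposet public

  module _ {A : FinSet} {R : PO A} where

    embed : (Q : Subposet R) → UT (poset Q) → UT R
    embed Q v .entry i j _ = ext v i j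
    embed Q v .unit i = ext-unit v i

    infix 4 _∈_

    record _∈_ (u : UT R) (Q : Subposet R) : Set where
      constructor preimage
      field
        source    : UT (poset Q)
        source-eq : embed Q source ≈ᵁ u

    -- UT_Q ◁ UT_R: invariance under conjugation by g, where h is the inverse of g
    IsNormal : Subposet R → Set
    IsNormal Q = ∀ g h → g · h ≈ᵁ 𝟙 → h · g ≈ᵁ 𝟙 → ∀ u → u ∈ Q → (g · u) · h ∈ Q

  record NPtt {A : FinSet} (R : PO A) : Set where
    field
      subposet : Subposet R
      normal   : IsNormal subposet

  open NPtt public

  module _ {A : FinSet} {R : PO A} where

    infix 4 _⊆_ _⊂_ _⋖_ _∈∘_

    _⊆_ _⊂_ _⋖_ : NPtt R → NPtt R → Set
    M ⊆ N = ∀ u → u ∈ subposet M → u ∈ subposet N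
    M ⊂ N = M ⊆ N × ¬ (N ⊆ M)
    M ⋖ N = M ⊂ N × ¬ (Σ[ L ∈ NPtt R ] M ⊂ L × L ⊂ N)

    -- u ∈ N∘ ; M ⋖ N is "N covers M"
    _∈∘_ : UT R → NPtt R → Set
    u ∈∘ N = u ∈ subposet N × (∀ M → M ⋖ N → ¬ (u ∈ subposet M))

    SameBlock : UT R → UT R → Set
    SameBlock u v = Σ[ N ∈ NPtt R ] u ∈∘ N × v ∈∘ N

  module Blocks {A : FinSet} {R : PO A} where

    open PO R
    open Sums A
    open SetoidReasoning 𝔽.setoid
    private _≟_ = decEq A

    ∈⇒ : ∀ (Q : Subposet R) {u} → u ∈ Q → ∀ i j → ¬ PO._⪯_ (poset Q) i j → ext u i j ≈ꟳ 0ꟳ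
    ∈⇒ Q {u} (preimage v e) i j n with T? (order R i j)
    ... | yes p = ≈-trans (ext-in u i j p) (≈-trans (≈-sym (e i j p)) (ext-out v i j n))
    ... | no p  = ext-out u i j p

    ∈⇐ : ∀ (Q : Subposet R) {u} → (∀ i j → ¬ PO._⪯_ (poset Q) i j → ext u i j ≈ꟳ 0ꟳ) → u ∈ Q
    ∈⇐ Q {u} h = preimage v eq
      where
      v : UT (poset Q)
      v .entry i j p = entry u i j (subset Q p)
      v .unit i = unit u i
      eq : embed Q v ≈ᵁ u
      eq i j p with T? (order (poset Q) i j)
      ... | yes p' = ext-in v i j p'
      ... | no n   = ≈-trans (ext-out v i j n) (≈-trans (≈-sym (h i j n)) (ext-in u i j p))

    _∈?_ : ∀ u Q → Dec (u ∈ Q)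
    u ∈? Q = Dec.map′ (λ h → ∈⇐ Q (λ i j n → restrict (h′ h i j) n)) (λ m → λ k l → to-dec (∈⇒ Q m (E.from k) (E.from l)))
      (FinP.all? λ k → FinP.all? λ l → T? (order (poset Q) (E.from k) (E.from l)) ⊎-dec (ext u (E.from k) (E.from l) ≈? 0ꟳ))
      where
      module E = Inverse (enum A)
      P : El A → El A → Set
      P i j = PO._⪯_ (poset Q) i j ⊎ ext u i j ≈ꟳ 0ꟳ
      h′ : (∀ k l → P (E.from k) (E.from l)) → ∀ i j → P i j
      h′ h i j = ≡.subst₂ P (E.strictlyInverseʳ i) (E.strictlyInverseʳ j) (h (E.to i) (E.to j))
      restrict : ∀ {i j} → P i j → ¬ PO._⪯_ (poset Q) i j → ext u i j ≈ꟳ 0ꟳ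
      restrict (inj₁ p) n = contradiction p n
      restrict (inj₂ e) n = e
      to-dec : ∀ {i j} → (¬ PO._⪯_ (poset Q) i j → ext u i j ≈ꟳ 0ꟳ) → P i j
      to-dec {i} {j} f with T? (order (poset Q) i j)
      ... | yes p = inj₁ p
      ... | no n = inj₂ (f n)

    ext-· : ∀ u v i k → ext (u · v) i k ≈ꟳ product {R = R} u v i k
    ext-· u v i k with T? (order R i k)
    ... | yes p = ext-in (u · v) i k p
    ... | no n = ≈-trans (ext-out (u · v) i k n)
                   (≈-sym (∑-zero (λ j → product-term-out u v i j k (λ (p , p') → n (⪯-trans p p')))))

    δ : El A → El A → F
    δ a b = if ⌊ a ≟ b ⌋ then 1ꟳ else 0ꟳ

    δ-refl : ∀ a → δ a a ≈ꟳ 1ꟳ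
    δ-refl a with a ≟ a
    ... | yes _ = ≈-refl
    ... | no n = ⊥-elim (n refl)

    δ-≢ : ∀ {a b} → a ≢ b → δ a b ≈ꟳ 0ꟳ
    δ-≢ {a} {b} n with a ≟ b
    ... | yes e = ⊥-elim (n e)
    ... | no _ = ≈-refl

    ext-𝟙 : ∀ i j → ext {R = R} 𝟙 i j ≈ꟳ δ i j
    ext-𝟙 i j with T? (order R i j)
    ... | yes p = ext-in {R = R} 𝟙 i j p
    ... | no n = ≈-trans (ext-out {R = R} 𝟙 i j n) (≈-sym (δ-≢ (λ { refl → n ⪯-refl })))

    -- 1 + c e_ij
    module Elementary {i j} (i⪯j : i ⪯ j) (i≢j : i ≢ j) where

      at : F → El A → El A → F
      at c a b = if ⌊ a ≟ i ⌋ then (if ⌊ b ≟ j ⌋ then c else 0ꟳ) else 0ꟳ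

      at-hit : ∀ c → at c i j ≈ꟳ c
      at-hit c with i ≟ i | j ≟ j
      ... | yes _ | yes _ = ≈-refl
      ... | no n  | _     = ⊥-elim (n refl)
      ... | yes _ | no n  = ⊥-elim (n refl)

      at-missˡ : ∀ c {a b} → a ≢ i → at c a b ≈ꟳ 0ꟳ
      at-missˡ c {a} n with a ≟ i
      ... | yes e = ⊥-elim (n e)
      ... | no _ = ≈-refl

      at-missʳ : ∀ c {a b} → b ≢ j → at c a b ≈ꟳ 0ꟳ
      at-missʳ c {a} {b} n with a ≟ i | b ≟ j
      ... | _     | yes e = ⊥-elim (n e)
      ... | yes _ | no _  = ≈-refl
      ... | no _  | no _  = ≈-refl

      elem : F → UT R
      elem c .entry a b _ = δ a b +ꟳ at c a b
      elem c .unit a with a ≟ i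
      ... | no n  = ≈-trans (𝔽.+-cong (δ-refl a) ≈-refl) (𝔽.+-identityʳ _)
      ... | yes refl = ≈-trans (𝔽.+-cong (δ-refl a) rest) (𝔽.+-identityʳ _)
        where
        rest : (if ⌊ a ≟ j ⌋ then c else 0ꟳ) ≈ꟳ 0ꟳ
        rest with a ≟ j
        ... | yes e = ⊥-elim (i≢j e)
        ... | no _ = ≈-refl

      ext-elem : ∀ c a b → ext (elem c) a b ≈ꟳ δ a b +ꟳ at c a b
      ext-elem c a b with T? (order R a b)
      ... | yes p = ext-in (elem c) a b p
      ... | no n = ≈-trans (ext-out (elem c) a b n) (≈-sym
        (≈-trans (𝔽.+-cong (δ-≢ (λ { refl → n ⪯-refl })) miss) (𝔽.+-identityʳ _)))
        where
        miss : at c a b ≈ꟳ 0ꟳ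
        miss with a ≟ i | b ≟ j
        ... | yes refl | yes refl = ⊥-elim (n i⪯j)
        ... | yes _ | no _ = ≈-refl
        ... | no _ | _ = ≈-refl

      -- row i of (1 + c e_ij) w
      row : ∀ c w b → ext (elem c · w) i b ≈ꟳ ext w i b +ꟳ c *ꟳ ext w j b
      row c w b = begin
        ext (elem c · w) i b ≈⟨ ext-· (elem c) w i b ⟩
        ∑ A (λ x → ext (elem c) i x *ꟳ ext w x b)
          ≈⟨ ∑-cong (λ x → ≈-trans (𝔽.*-congʳ (ext-elem c i x)) (𝔽.distribʳ (ext w x b) (δ i x) (at c i x))) ⟩
        ∑ A (λ x → δ i x *ꟳ ext w x b +ꟳ at c i x *ꟳ ext w x b)
          ≈⟨ ∑-+ (λ x → δ i x *ꟳ ext w x b) (λ x → at c i x *ꟳ ext w x b) ⟩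
        ∑ A (λ x → δ i x *ꟳ ext w x b) +ꟳ ∑ A (λ x → at c i x *ꟳ ext w x b)
          ≈⟨ 𝔽.+-cong
               (∑-single (λ x → δ i x *ꟳ ext w x b) i (λ x n → ≈-trans (𝔽.*-congʳ (δ-≢ (λ e → n (≡.sym e)))) (𝔽.zeroˡ (ext w x b))))
               (∑-single (λ x → at c i x *ꟳ ext w x b) j (λ x n → ≈-trans (𝔽.*-congʳ (at-missʳ c n)) (𝔽.zeroˡ (ext w x b)))) ⟩
        δ i i *ꟳ ext w i b +ꟳ at c i j *ꟳ ext w j b
          ≈⟨ 𝔽.+-cong (≈-trans (𝔽.*-congʳ (δ-refl i)) (𝔽.*-identityˡ _)) (𝔽.*-congʳ (at-hit c)) ⟩
        ext w i b +ꟳ c *ꟳ ext w j b ∎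

      other-row : ∀ c w {a} b → a ≢ i → ext (elem c · w) a b ≈ꟳ ext w a b
      other-row c w {a} b a≢i = begin
        ext (elem c · w) a b ≈⟨ ext-· (elem c) w a b ⟩
        ∑ A (λ x → ext (elem c) a x *ꟳ ext w x b)
          ≈⟨ ∑-cong (λ x → 𝔽.*-congʳ {ext w x b} (≈-trans (ext-elem c a x) (≈-trans (𝔽.+-congˡ (at-missˡ c a≢i)) (𝔽.+-identityʳ _)))) ⟩
        ∑ A (λ x → δ a x *ꟳ ext w x b)
          ≈⟨ ∑-single (λ x → δ a x *ꟳ ext w x b) a (λ x n → ≈-trans (𝔽.*-congʳ (δ-≢ (λ e → n (≡.sym e)))) (𝔽.zeroˡ _)) ⟩
        δ a a *ꟳ ext w a b ≈⟨ ≈-trans (𝔽.*-congʳ (δ-refl a)) (𝔽.*-identityˡ _) ⟩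
        ext w a b ∎

      -- column j of w (1 + c e_ij)
      column : ∀ w c a → ext (w · elem c) a j ≈ꟳ ext w a j +ꟳ ext w a i *ꟳ c
      column w c a = begin
        ext (w · elem c) a j ≈⟨ ext-· w (elem c) a j ⟩
        ∑ A (λ x → ext w a x *ꟳ ext (elem c) x j)
          ≈⟨ ∑-cong (λ x → ≈-trans (𝔽.*-congˡ (ext-elem c x j)) (𝔽.distribˡ (ext w a x) (δ x j) (at c x j))) ⟩
        ∑ A (λ x → ext w a x *ꟳ δ x j +ꟳ ext w a x *ꟳ at c x j)
          ≈⟨ ∑-+ (λ x → ext w a x *ꟳ δ x j) (λ x → ext w a x *ꟳ at c x j) ⟩
        ∑ A (λ x → ext w a x *ꟳ δ x j) +ꟳ ∑ A (λ x → ext w a x *ꟳ at c x j)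
          ≈⟨ 𝔽.+-cong
               (∑-single (λ x → ext w a x *ꟳ δ x j) j (λ x n → ≈-trans (𝔽.*-congˡ (δ-≢ n)) (𝔽.zeroʳ (ext w a x))))
               (∑-single (λ x → ext w a x *ꟳ at c x j) i (λ x n → ≈-trans (𝔽.*-congˡ (at-missˡ c n)) (𝔽.zeroʳ _))) ⟩
        ext w a j *ꟳ δ j j +ꟳ ext w a i *ꟳ at c i j
          ≈⟨ 𝔽.+-cong (≈-trans (𝔽.*-congˡ (δ-refl j)) (𝔽.*-identityʳ _)) (𝔽.*-congˡ (at-hit c)) ⟩
        ext w a j +ꟳ ext w a i *ꟳ c ∎

      other-column : ∀ w c a {b} → b ≢ j → ext (w · elem c) a b ≈ꟳ ext w a b
      other-column w c a {b} b≢j = begin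
        ext (w · elem c) a b ≈⟨ ext-· w (elem c) a b ⟩
        ∑ A (λ x → ext w a x *ꟳ ext (elem c) x b)
          ≈⟨ ∑-cong (λ x → 𝔽.*-congˡ {ext w a x} (≈-trans (ext-elem c x b) (≈-trans (𝔽.+-congˡ (at-missʳ c b≢j)) (𝔽.+-identityʳ _)))) ⟩
        ∑ A (λ x → ext w a x *ꟳ δ x b)
          ≈⟨ ∑-single (λ x → ext w a x *ꟳ δ x b) b (λ x n → ≈-trans (𝔽.*-congˡ (δ-≢ n)) (𝔽.zeroʳ _)) ⟩
        ext w a b *ꟳ δ b b ≈⟨ ≈-trans (𝔽.*-congˡ (δ-refl b)) (𝔽.*-identityʳ _) ⟩
        ext w a b ∎

      inverses : ∀ c d → c +ꟳ d ≈ꟳ 0ꟳ → elem c · elem d ≈ᵁ 𝟙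
      inverses c d c+d a b p = ≈-trans (≈-sym (ext-in (elem c · elem d) a b p)) (go (a ≟ i) (b ≟ j))
        where
        go : Dec (a ≡ i) → Dec (b ≡ j) → ext (elem c · elem d) a b ≈ꟳ δ a b
        go (no a≢i) _ = ≈-trans (other-row c (elem d) b a≢i) (≈-trans (ext-elem d a b)
          (≈-trans (𝔽.+-congˡ (at-missˡ d a≢i)) (𝔽.+-identityʳ _)))
        go (yes refl) (no b≢j) = begin
          ext (elem c · elem d) i b ≈⟨ row c (elem d) b ⟩
          ext (elem d) i b +ꟳ c *ꟳ ext (elem d) j b
            ≈⟨ 𝔽.+-cong (≈-trans (ext-elem d i b) (≈-trans (𝔽.+-congˡ (at-missʳ d b≢j)) (𝔽.+-identityʳ _)))
                 (𝔽.*-congˡ (≈-trans (ext-elem d j b) (𝔽.+-cong (δ-≢ (λ e → b≢j (≡.sym e))) (at-missʳ d b≢j)))) ⟩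
          δ i b +ꟳ c *ꟳ (0ꟳ +ꟳ 0ꟳ)
            ≈⟨ 𝔽.+-congˡ (≈-trans (𝔽.*-congˡ (𝔽.+-identityˡ _)) (𝔽.zeroʳ c)) ⟩
          δ i b +ꟳ 0ꟳ ≈⟨ 𝔽.+-identityʳ _ ⟩
          δ i b ∎
        go (yes refl) (yes refl) = begin
          ext (elem c · elem d) i j ≈⟨ row c (elem d) j ⟩
          ext (elem d) i j +ꟳ c *ꟳ ext (elem d) j j
            ≈⟨ 𝔽.+-cong (≈-trans (ext-elem d i j) (𝔽.+-congˡ (at-hit d))) (𝔽.*-congˡ (ext-unit (elem d) j)) ⟩
          (δ i j +ꟳ d) +ꟳ c *ꟳ 1ꟳ ≈⟨ 𝔽.+-congˡ (𝔽.*-identityʳ c) ⟩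
          (δ i j +ꟳ d) +ꟳ c       ≈⟨ 𝔽.+-assoc _ _ _ ⟩
          δ i j +ꟳ (d +ꟳ c)       ≈⟨ 𝔽.+-congˡ (≈-trans (𝔽.+-comm d c) c+d) ⟩
          δ i j +ꟳ 0ꟳ             ≈⟨ 𝔽.+-identityʳ _ ⟩
          δ i j ∎

      elem-entry : ∀ c → ext (elem c) i j ≈ꟳ c
      elem-entry c = ≈-trans (ext-elem c i j) (≈-trans (𝔽.+-cong (δ-≢ i≢j) (at-hit c)) (𝔽.+-identityˡ c))

      elem-∈ : ∀ Q c → PO._⪯_ (poset Q) i j → elem c ∈ Q
      elem-∈ Q c q = ∈⇐ Q (λ a b n → ≈-trans (ext-elem c a b)
        (≈-trans (𝔽.+-cong (δ-≢ (λ { refl → n (PO.⪯-refl (poset Q)) })) (miss a b n)) (𝔽.+-identityʳ _)))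
        where
        miss : ∀ a b → ¬ PO._⪯_ (poset Q) a b → at c a b ≈ꟳ 0ꟳ
        miss a b n with a ≟ i | b ≟ j
        ... | yes refl | yes refl = ⊥-elim (n q)
        ... | yes _ | no _ = ≈-refl
        ... | no _ | _ = ≈-refl

    Closed : Subposet R → Set
    Closed Q = ∀ {i j k l} → i ⪯ j → PO._⪯_ (poset Q) j k → j ≢ k → k ⪯ l → PO._⪯_ (poset Q) i l

    normal⇒closed : ∀ {Q} → IsNormal Q → Closed Q
    normal⇒closed {Q} normal {i} {j} {k} {l} i⪯j j⪯k j≢k k⪯l = right (left j≢k) (λ { refl → j≢k (⪯-antisym (subset Q j⪯k) i⪯j) })
      where
      _⪯Q_ = PO._⪯_ (poset Q)
      member : ∀ {u} a b → u ∈ Q → ext u a b ≈ꟳ 1ꟳ → a ⪯Q b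
      member {u} a b m e with T? (order (poset Q) a b)
      ... | yes p = p
      ... | no n = ⊥-elim (1≉0 (≈-trans (≈-sym e) (∈⇒ Q m a b n)))
      -1+1 : -ꟳ 1ꟳ +ꟳ 1ꟳ ≈ꟳ 0ꟳ
      -1+1 = 𝔽.-‿inverseˡ 1ꟳ
      1-1 : 1ꟳ +ꟳ -ꟳ 1ꟳ ≈ꟳ 0ꟳ
      1-1 = 𝔽.-‿inverseʳ 1ꟳ
      left : j ≢ k → i ⪯Q k
      left j≢k with i ≟ j
      ... | yes refl = j⪯k
      ... | no i≢j = member i k (normal (G.elem 1ꟳ) (G.elem (-ꟳ 1ꟳ)) (G.inverses _ _ 1-1) (G.inverses _ _ -1+1)
                                   (N.elem 1ꟳ) (N.elem-∈ Q 1ꟳ j⪯k)) (begin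
        ext (G.elem 1ꟳ · N.elem 1ꟳ · G.elem (-ꟳ 1ꟳ)) i k ≈⟨ G.other-column (G.elem 1ꟳ · N.elem 1ꟳ) _ i (λ e → j≢k (≡.sym e)) ⟩
        ext (G.elem 1ꟳ · N.elem 1ꟳ) i k ≈⟨ G.row 1ꟳ (N.elem 1ꟳ) k ⟩
        ext (N.elem 1ꟳ) i k +ꟳ 1ꟳ *ꟳ ext (N.elem 1ꟳ) j k
          ≈⟨ 𝔽.+-cong (≈-trans (N.ext-elem 1ꟳ i k) (𝔽.+-cong (δ-≢ i≢k) (N.at-missˡ 1ꟳ i≢j)))
               (≈-trans (𝔽.*-identityˡ _) (N.elem-entry 1ꟳ)) ⟩
        (0ꟳ +ꟳ 0ꟳ) +ꟳ 1ꟳ ≈⟨ 𝔽.+-congʳ (𝔽.+-identityˡ 0ꟳ) ⟩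
        0ꟳ +ꟳ 1ꟳ ≈⟨ 𝔽.+-identityˡ 1ꟳ ⟩
        1ꟳ ∎)
        where
        module G = Elementary i⪯j i≢j
        module N = Elementary (subset Q j⪯k) j≢k
        i≢k : i ≢ k
        i≢k refl = i≢j (⪯-antisym i⪯j (subset Q j⪯k))
      right : ∀ {i} → i ⪯Q k → i ≢ k → i ⪯Q l
      right {i} i⪯k i≢k with k ≟ l
      ... | yes refl = i⪯k
      ... | no k≢l = member i l (normal (G.elem (-ꟳ 1ꟳ)) (G.elem 1ꟳ) (G.inverses _ _ -1+1) (G.inverses _ _ 1-1)
                                   (N.elem 1ꟳ) (N.elem-∈ Q 1ꟳ i⪯k)) (begin
        ext (G.elem (-ꟳ 1ꟳ) · N.elem 1ꟳ · G.elem 1ꟳ) i l ≈⟨ G.column (G.elem (-ꟳ 1ꟳ) · N.elem 1ꟳ) 1ꟳ i ⟩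
        ext (G.elem (-ꟳ 1ꟳ) · N.elem 1ꟳ) i l +ꟳ ext (G.elem (-ꟳ 1ꟳ) · N.elem 1ꟳ) i k *ꟳ 1ꟳ
          ≈⟨ 𝔽.+-cong
               (≈-trans (G.other-row _ (N.elem 1ꟳ) l i≢k)
                 (≈-trans (N.ext-elem 1ꟳ i l) (𝔽.+-cong (δ-≢ i≢l) (N.at-missʳ 1ꟳ (λ e → k≢l (≡.sym e))))))
               (≈-trans (𝔽.*-identityʳ _) (≈-trans (G.other-row _ (N.elem 1ꟳ) k i≢k) (N.elem-entry 1ꟳ))) ⟩
        (0ꟳ +ꟳ 0ꟳ) +ꟳ 1ꟳ ≈⟨ 𝔽.+-congʳ (𝔽.+-identityˡ 0ꟳ) ⟩
        0ꟳ +ꟳ 1ꟳ ≈⟨ 𝔽.+-identityˡ 1ꟳ ⟩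
        1ꟳ ∎)
        where
        module G = Elementary k⪯l k≢l
        module N = Elementary (subset Q i⪯k) i≢k
        i≢l : i ≢ l
        i≢l refl = i≢k (⪯-antisym (subset Q i⪯k) k⪯l)

    closed⇒normal : ∀ {Q} → Closed Q → IsNormal Q
    closed⇒normal {Q} closed g h gh≈1 _ n n∈Q = ∈⇐ Q (λ i l il∉Q → begin
      ext (g · n · h) i l                        ≈⟨ ext-· (g · n) h i l ⟩
      ∑ A (λ x → ext (g · n) i x *ꟳ ext h x l)   ≈⟨ ∑-cong (λ x → term i l il∉Q x (T? (order R x l))) ⟩
      ∑ A (λ x → ext g i x *ꟳ ext h x l)         ≈⟨ ext-· g h i l ⟨
      ext (g · h) i l                            ≈⟨ gh i l ⟩
      δ i l                                      ≈⟨ δ-≢ (λ { refl → il∉Q (PO.⪯-refl (poset Q)) }) ⟩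
      0ꟳ ∎)
      where
      gh : ∀ i l → ext (g · h) i l ≈ꟳ δ i l
      gh i l with T? (order R i l)
      ... | yes p = ≈-trans (ext-in (g · h) i l p) (gh≈1 i l p)
      ... | no p = ≈-trans (ext-out (g · h) i l p) (≈-sym (δ-≢ (λ { refl → p ⪯-refl })))
      term : ∀ i l → ¬ PO._⪯_ (poset Q) i l → ∀ x → Dec (x ⪯ l) →
             ext (g · n) i x *ꟳ ext h x l ≈ꟳ ext g i x *ꟳ ext h x l
      term i l il∉Q x (no x⋠l) = ≈-trans (≈-trans (𝔽.*-congˡ (ext-out h x l x⋠l)) (𝔽.zeroʳ _))
        (≈-sym (≈-trans (𝔽.*-congˡ (ext-out h x l x⋠l)) (𝔽.zeroʳ _)))
      term i l il∉Q x (yes x⪯l) = 𝔽.*-congʳ (begin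
        ext (g · n) i x                           ≈⟨ ext-· g n i x ⟩
        ∑ A (λ y → ext g i y *ꟳ ext n y x)        ≈⟨ ∑-single _ x (λ y y≢x → vanish y y≢x (T? (order R i y)) (T? (order (poset Q) y x))) ⟩
        ext g i x *ꟳ ext n x x                    ≈⟨ 𝔽.*-congˡ (ext-unit n x) ⟩
        ext g i x *ꟳ 1ꟳ                           ≈⟨ 𝔽.*-identityʳ _ ⟩
        ext g i x ∎)
        where
        vanish : ∀ y → y ≢ x → Dec (i ⪯ y) → Dec (PO._⪯_ (poset Q) y x) → ext g i y *ꟳ ext n y x ≈ꟳ 0ꟳ
        vanish y y≢x (no n') _ = ≈-trans (𝔽.*-congʳ (ext-out g i y n')) (𝔽.zeroˡ _)
        vanish y y≢x (yes p) (yes p') = ⊥-elim (il∉Q (closed p p' y≢x x⪯l))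
        vanish y y≢x (yes p) (no n') = ≈-trans (𝔽.*-congˡ (∈⇒ Q n∈Q y x n')) (𝔽.zeroʳ _)

    ∃? : {P : El A → Set} → (∀ a → Dec (P a)) → Dec (∃ P)
    ∃? {P} P? = Dec.map′ (λ (k , p) → E.from k , p)
      (λ (a , p) → E.to a , ≡.subst P (≡.sym (E.strictlyInverseʳ a)) p)
      (FinP.any? (λ k → P? (E.from k)))
      where module E = Inverse (enum A)

    ⊆-by-order : ∀ {P Q : Subposet R} → (∀ i j → PO._⪯_ (poset P) i j → PO._⪯_ (poset Q) i j) → ∀ u → u ∈ P → u ∈ Q
    ⊆-by-order {P} {Q} f u m = ∈⇐ Q (λ i j n → ∈⇒ P m i j (λ p → n (f i j p)))

    order-by-⊆ : ∀ {P Q : Subposet R} → (∀ u → u ∈ P → u ∈ Q) → ∀ i j → PO._⪯_ (poset P) i j → PO._⪯_ (poset Q) i j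
    order-by-⊆ {P} {Q} f i j p with i ≟ j
    ... | yes refl = PO.⪯-refl (poset Q)
    ... | no i≢j with T? (order (poset Q) i j)
    ...   | yes q = q
    ...   | no n = ⊥-elim (1≉0 (≈-trans (≈-sym (E.elem-entry 1ꟳ)) (∈⇒ Q (f _ (E.elem-∈ P 1ꟳ p)) i j n)))
      where module E = Elementary (subset P p) i≢j

    subposet-from : (S : El A → El A → Set) → (∀ i j → Dec (S i j)) → (∀ i → S i i) →
                    (∀ {i j k} → S i j → S j k → S i k) → (∀ {i j} → S i j → i ⪯ j) → Subposet R
    subposet-from S S? S-refl S-trans S⊆ = record { poset = Q ; subset = λ p → S⊆ (toWitness p) }
      where
      Q : PO A
      Q .PO._≤ᵇ_ i j = ⌊ S? i j ⌋
      Q .PO.isPartialOrder = record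
        { isPreorder = record
          { isEquivalence = ≡.isEquivalence
          ; reflexive = λ { {i} refl → fromWitness (S-refl i) }
          ; trans = λ p q → fromWitness (S-trans (toWitness p) (toWitness q)) }
        ; antisym = λ p q → ⪯-antisym (S⊆ (toWitness p)) (S⊆ (toWitness q)) }

    -- the smallest element of NPtt(R) containing u
    module Closure (u : UT R) where

      Supported : El A → El A → Set
      Supported i j = i ≡ j ⊎ ∃[ a ] ∃[ b ] i ⪯ a × a ≢ b × ¬ (ext u a b ≈ꟳ 0ꟳ) × b ⪯ j

      supported? : ∀ i j → Dec (Supported i j)
      supported? i j = (i ≟ j) ⊎-dec ∃? (λ a → ∃? (λ b →
        T? (order R i a) ×-dec ¬? (a ≟ b) ×-dec ¬? (ext u a b ≈? 0ꟳ) ×-dec T? (order R b j)))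

      nonzero⇒⪯ : ∀ {a b} → ¬ (ext u a b ≈ꟳ 0ꟳ) → a ⪯ b
      nonzero⇒⪯ {a} {b} n with T? (order R a b)
      ... | yes p = p
      ... | no p = ⊥-elim (n (ext-out u a b p))

      supported⇒⪯ : ∀ {i j} → Supported i j → i ⪯ j
      supported⇒⪯ (inj₁ refl) = ⪯-refl
      supported⇒⪯ (inj₂ (a , b , p , _ , n , p')) = ⪯-trans p (⪯-trans (nonzero⇒⪯ n) p')

      sub : Subposet R
      sub = subposet-from Supported supported? (λ _ → inj₁ refl)
        (λ { (inj₁ refl) s → s
           ; (inj₂ (a , b , p , a≢b , n , p')) s → inj₂ (a , b , p , a≢b , n , ⪯-trans p' (supported⇒⪯ s)) })
        supported⇒⪯

      sub-closed : Closed sub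
      sub-closed i⪯j jk j≢k k⪯l with toWitness jk
      ... | inj₁ e = ⊥-elim (j≢k e)
      ... | inj₂ (a , b , p , a≢b , n , p') = fromWitness (inj₂ (a , b , ⪯-trans i⪯j p , a≢b , n , ⪯-trans p' k⪯l))

      closure : NPtt R
      closure = record { subposet = sub ; normal = closed⇒normal {sub} sub-closed }

      u∈closure : u ∈ sub
      u∈closure = ∈⇐ sub (λ i j n → go i j n (i ≟ j) (ext u i j ≈? 0ꟳ))
        where
        go : ∀ i j → ¬ PO._⪯_ (poset sub) i j → Dec (i ≡ j) → Dec (ext u i j ≈ꟳ 0ꟳ) → ext u i j ≈ꟳ 0ꟳ
        go i j n _ (yes z) = z
        go i j n (yes e) (no _) = ⊥-elim (n (fromWitness (inj₁ e)))
        go i j n (no i≢j) (no z) = ⊥-elim (n (fromWitness (inj₂ (i , j , ⪯-refl , i≢j , z , ⪯-refl))))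

      closure-least : ∀ M → u ∈ subposet M → closure ⊆ M
      closure-least M m = ⊆-by-order {sub} {subposet M} le
        where
        le : ∀ i j → PO._⪯_ (poset sub) i j → PO._⪯_ (poset (subposet M)) i j
        le i j s with toWitness s
        ... | inj₁ refl = PO.⪯-refl (poset (subposet M))
        ... | inj₂ (a , b , p , a≢b , n , p') with T? (order (poset (subposet M)) a b)
        ...   | yes q = normal⇒closed {subposet M} (normal M) p q a≢b p'
        ...   | no q = ⊥-elim (n (∈⇒ (subposet M) m a b q))

      u∈∘closure : u ∈∘ closure
      u∈∘closure = u∈closure , λ M M⋖ m → proj₂ (proj₁ M⋖) (closure-least M m)

    _≃_ : UT R → UT R → Set
    u ≃ v = ∀ (M : NPtt R) → (u ∈ subposet M → v ∈ subposet M) × (v ∈ subposet M → u ∈ subposet M)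

    ≃⇒same-block : ∀ {u v} → u ≃ v → SameBlock u v
    ≃⇒same-block {u} {v} e = closure , u∈∘closure
      , (proj₁ (e closure) u∈closure , λ M M⋖ m → proj₂ u∈∘closure M M⋖ (proj₂ (e M) m))
      where open Closure u

    module Rank where

      total : ∀ {n} → (Fin n → ℕ) → ℕ
      total {zero}  f = 0
      total {suc n} f = f zero ℕ.+ total (λ k → f (suc k))

      total-mono : ∀ {n} {f g : Fin n → ℕ} → (∀ k → f k ℕ.≤ g k) → total f ℕ.≤ total g
      total-mono {zero}  h = ℕ.z≤n
      total-mono {suc n} h = ℕP.+-mono-≤ (h zero) (total-mono (λ k → h (suc k)))

      total-strict : ∀ {n} {f g : Fin n → ℕ} → (∀ k → f k ℕ.≤ g k) → ∀ k → f k ℕ.< g k → total f ℕ.< total g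
      total-strict h zero    p = ℕP.+-mono-<-≤ p (total-mono (λ k → h (suc k)))
      total-strict h (suc k) p = ℕP.+-mono-≤-< (h zero) (total-strict (λ l → h (suc l)) k p)

      absent : Bool → ℕ
      absent b = if b then 0 else 1

      absent-mono : ∀ {b c} → (T b → T c) → absent c ℕ.≤ absent b
      absent-mono {false} {false} f = ℕP.≤-refl
      absent-mono {false} {true}  f = ℕ.z≤n
      absent-mono {true}  {false} f = ⊥-elim (f tt)
      absent-mono {true}  {true}  f = ℕP.≤-refl

      absent-strict : ∀ {b c} → ¬ T b → T c → absent c ℕ.< absent b
      absent-strict {false} {true} n p = ℕP.≤-refl
      absent-strict {true}         n p = ⊥-elim (n tt)

      module E = Inverse (enum A)

      corank : NPtt R → ℕ
      corank K = total (λ k → total (λ l → absent (order (poset (subposet K)) (E.from k) (E.from l))))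

      corank-⊂ : ∀ {K L} → K ⊂ L → corank L ℕ.< corank K
      corank-⊂ {K} {L} (K⊆L , L⊈K) with ∃? (λ i → ∃? (λ j → T? (order (poset (subposet L)) i j) ×-dec ¬? (T? (order (poset (subposet K)) i j))))
      ... | no none = ⊥-elim (L⊈K (⊆-by-order {subposet L} {subposet K} λ i j p → stable i j p))
        where
        stable : ∀ i j → PO._⪯_ (poset (subposet L)) i j → PO._⪯_ (poset (subposet K)) i j
        stable i j p with T? (order (poset (subposet K)) i j)
        ... | yes q = q
        ... | no n = ⊥-elim (none (i , j , p , n))
      ... | yes (i , j , p , n) = total-strict (λ k → total-mono (λ l → le k l)) (E.to i)
          (total-strict (λ l → le (E.to i) l) (E.to j) (absent-strict
            (≡.subst₂ (λ a b → ¬ PO._⪯_ (poset (subposet K)) a b) (≡.sym (E.strictlyInverseʳ i)) (≡.sym (E.strictlyInverseʳ j)) n)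
            (≡.subst₂ (PO._⪯_ (poset (subposet L))) (≡.sym (E.strictlyInverseʳ i)) (≡.sym (E.strictlyInverseʳ j)) p)))
        where
        le : ∀ k l → absent (order (poset (subposet L)) (E.from k) (E.from l)) ℕ.≤ absent (order (poset (subposet K)) (E.from k) (E.from l))
        le k l = absent-mono (order-by-⊆ {subposet K} {subposet L} K⊆L (E.from k) (E.from l))

    ∈∘⇒∉ : ∀ {N u} → u ∈∘ N → ∀ K → K ⊂ N → ¬ (u ∈ subposet K)
    ∈∘⇒∉ {N} {u} u∈∘N K K⊂N u∈K = go K (ℕI.<-wellFounded (Rank.corank K)) K⊂N u∈K
      where
      go : ∀ K → Acc ℕ._<_ (Rank.corank K) → K ⊂ N → ¬ (u ∈ subposet K)
      go K (acc rec) K⊂N u∈K = proj₂ u∈∘N K (K⊂N , λ (L , K⊂L , L⊂N) →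
        go L (rec (Rank.corank-⊂ {K} {L} K⊂L)) L⊂N (proj₁ K⊂L u u∈K)) u∈K

    _∩_ : NPtt R → NPtt R → NPtt R
    M ∩ N = record { subposet = sub ; normal = closed⇒normal {sub} (λ i⪯j jk j≢k k⪯l →
        let (p , q) = toWitness jk in fromWitness
          ( normal⇒closed {subposet M} (normal M) i⪯j p j≢k k⪯l
          , normal⇒closed {subposet N} (normal N) i⪯j q j≢k k⪯l)) }
      where
      module M = PO (poset (subposet M))
      module N = PO (poset (subposet N))
      sub = subposet-from (λ i j → M._⪯_ i j × N._⪯_ i j) (λ i j → T? (i M.≤ᵇ j) ×-dec T? (i N.≤ᵇ j))
        (λ i → M.⪯-refl , N.⪯-refl) (λ (p , q) (p' , q') → M.⪯-trans p p' , N.⪯-trans q q')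
        (λ (p , q) → subset (subposet M) p)

    ∩-∈ : ∀ M N {u} → u ∈ subposet M → u ∈ subposet N → u ∈ subposet (M ∩ N)
    ∩-∈ M N {u} m n = ∈⇐ (subposet (M ∩ N)) (λ i j h → go i j h (T? (order (poset (subposet M)) i j)) (T? (order (poset (subposet N)) i j)))
      where
      go : ∀ i j → ¬ PO._⪯_ (poset (subposet (M ∩ N))) i j → Dec (PO._⪯_ (poset (subposet M)) i j) → Dec (PO._⪯_ (poset (subposet N)) i j) → ext u i j ≈ꟳ 0ꟳ
      go i j h (no p) _ = ∈⇒ (subposet M) m i j p
      go i j h _ (no q) = ∈⇒ (subposet N) n i j q
      go i j h (yes p) (yes q) = ⊥-elim (h (fromWitness (p , q)))

    ∩-⊆ˡ : ∀ M N → (M ∩ N) ⊆ M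
    ∩-⊆ˡ M N = ⊆-by-order {subposet (M ∩ N)} {subposet M} (λ i j p → proj₁ (toWitness p))

    ∩-⊆ʳ : ∀ M N → (M ∩ N) ⊆ N
    ∩-⊆ʳ M N = ⊆-by-order {subposet (M ∩ N)} {subposet N} (λ i j p → proj₂ (toWitness p))

    same-block⇒≃ : ∀ {u v} → SameBlock u v → u ≃ v
    same-block⇒≃ {u} {v} (N , u∈∘N , v∈∘N) M = one u v u∈∘N v∈∘N , one v u v∈∘N u∈∘N
      where
      one : ∀ u v → u ∈∘ N → v ∈∘ N → u ∈ subposet M → v ∈ subposet M
      one u v u∈∘N v∈∘N u∈M with v ∈? subposet M
      ... | yes p = p
      ... | no n = ⊥-elim (∈∘⇒∉ {N} u∈∘N (N ∩ M)
          (∩-⊆ˡ N M , λ N⊆ → n (∩-⊆ʳ N M v (N⊆ v (proj₁ v∈∘N)))) (∩-∈ N M (proj₁ u∈∘N) u∈M))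

module PatternMonoid (K : CommutativeRing 0ℓ 0ℓ) {q : ℕ} (𝔽 : FiniteField q) where

  open LinearAlgebra K
  open Species K
  open PatternGroups 𝔽
  private
    module K = CommutativeRing K
    module 𝔽 = FiniteField 𝔽
    open 𝔽 using () renaming (_≈_ to _≈ꟳ_; 0# to 0ꟳ)

  -- f(UT_R ; Cl(R)); since the blocks cover UT_R, constancy on blocks implies invariance under ≈ᵁ
  -- (value-cong)
  record ClassFunction {A : FinSet} (R : PO A) : Set where
    no-eta-equality
    field
      value    : UT R → K.Carrier
      constant : ∀ {u v} → SameBlock u v → value u K.≈ value v

  open ClassFunction public

  classFunctions : ∀ {A} → PO A → VectorSpace
  classFunctions R = record
    { Carrierᴹ = ClassFunction R
    ; _≈ᴹ_ = λ φ ψ → ∀ u → value φ u K.≈ value ψ u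
    ; _+ᴹ_ = λ φ ψ → record { value = λ u → value φ u K.+ value ψ u ; constant = λ s → K.+-cong (constant φ s) (constant ψ s) }
    ; _*ₗ_ = λ c φ → record { value = λ u → c K.* value φ u ; constant = λ s → K.*-congˡ (constant φ s) }
    ; 0ᴹ = record { value = λ _ → K.0# ; constant = λ _ → K.refl }
    ; -ᴹ_ = λ φ → record { value = λ u → K.- value φ u ; constant = λ s → K.-‿cong (constant φ s) }
    ; isLeftModule = record
      { isLeftSemimodule = record
        { +ᴹ-isCommutativeMonoid = record
          { isMonoid = record
            { isSemigroup = record
              { isMagma = record
                { isEquivalence = record { refl = λ _ → K.refl ; sym = λ e u → K.sym (e u) ; trans = λ d e u → K.trans (d u) (e u) }
                ; ∙-cong = λ d e u → K.+-cong (d u) (e u) }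
              ; assoc = λ _ _ _ _ → K.+-assoc _ _ _ }
            ; identity = (λ _ _ → K.+-identityˡ _) , (λ _ _ → K.+-identityʳ _) }
          ; comm = λ _ _ _ → K.+-comm _ _ }
        ; isPreleftSemimodule = record
          { *ₗ-cong = λ c e u → K.*-cong c (e u)
          ; *ₗ-zeroˡ = λ _ _ → K.zeroˡ _
          ; *ₗ-distribʳ = λ _ _ _ _ → K.distribʳ _ _ _
          ; *ₗ-identityˡ = λ _ _ → K.*-identityˡ _
          ; *ₗ-assoc = λ _ _ _ _ → K.*-assoc _ _ _
          ; *ₗ-zeroʳ = λ _ _ → K.zeroʳ _
          ; *ₗ-distribˡ = λ _ _ _ _ → K.distribˡ _ _ _ } }
      ; -ᴹ‿cong = λ e u → K.-‿cong (e u)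
      ; -ᴹ‿inverse = (λ _ _ → K.-‿inverseˡ _) , (λ _ _ → K.-‿inverseʳ _) } }

  -- PO is compared by ≗ᴾ, so one summand of ⨁ over PO(A) is represented by several R; SameFunction
  -- identifies the copies of a class function over R ≗ᴾ S
  SameEntries : ∀ {A} {R S : PO A} → UT R → UT S → Set
  SameEntries {A} {R} {S} u v = ∀ i j .(p : PO._⪯_ R i j) .(q : PO._⪯_ S i j) → entry u i j p ≈ꟳ entry v i j q

  SameFunction : ∀ {A} {R S : PO A} → ClassFunction R → ClassFunction S → Set
  SameFunction {R = R} {S} φ ψ = R ≗ᴾ S × (∀ u v → SameEntries u v → value φ u K.≈ value ψ v)

  pttObj : FinSet → VectorSpace
  pttObj A = ⨁ (classFunctions {A}) SameFunction

  value-cong : ∀ {A} {R : PO A} (φ : ClassFunction R) {u v} → u ≈ᵁ v → value φ u K.≈ value φ v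
  value-cong φ {u} {v} e = constant φ (Blocks.≃⇒same-block λ M →
    (λ (preimage w d) → preimage w (λ i j p → 𝔽.trans (d i j p) (e i j p))) ,
    (λ (preimage w d) → preimage w (λ i j p → 𝔽.trans (d i j p) (𝔽.sym (e i j p)))))

  module _ {A B : FinSet} (σ : A ≅ B) where

    pull : ∀ {R : PO A} → UT (imagePO σ R) → UT R
    pull {R} u .entry i j p = entry u (to σ i) (to σ j)
      (≡.subst₂ (PO._⪯_ R) (≡.sym (strictlyInverseʳ σ i)) (≡.sym (strictlyInverseʳ σ j)) p)
    pull u .unit i = unit u (to σ i)

    imageNPtt : ∀ {R : PO A} → NPtt R → NPtt (imagePO σ R)
    imageNPtt {R} M = record
      { subposet = S
      ; normal = Blocks.closed⇒normal {Q = S} λ i⪯j jk j≢k k⪯l →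
          Blocks.normal⇒closed {Q = subposet M} (normal M) i⪯j jk
            (λ e → j≢k (≡.trans (≡.sym (strictlyInverseˡ σ _)) (≡.trans (≡.cong (to σ) e) (strictlyInverseˡ σ _)))) k⪯l }
      where
      S : Subposet (imagePO σ R)
      S = record { poset = imagePO σ (poset (subposet M)) ; subset = subset (subposet M) }

    ext-pull : ∀ {R : PO A} (u : UT (imagePO σ R)) i j → ext (pull {R} u) i j ≈ꟳ ext u (to σ i) (to σ j)
    ext-pull {R} u i j with T? (order R i j)
    ... | yes p = 𝔽.trans (ext-in (pull {R} u) i j p) (𝔽.sym (ext-in u (to σ i) (to σ j) p'))
      where p' = ≡.subst₂ (PO._⪯_ R) (≡.sym (strictlyInverseʳ σ i)) (≡.sym (strictlyInverseʳ σ j)) p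
    ... | no n = 𝔽.trans (ext-out (pull {R} u) i j n) (𝔽.sym (ext-out u (to σ i) (to σ j)
                   (λ p' → n (≡.subst₂ (PO._⪯_ R) (strictlyInverseʳ σ i) (strictlyInverseʳ σ j) p'))))

    pull-same-block : ∀ {R : PO A} {u v : UT (imagePO σ R)} → SameBlock u v → SameBlock (pull {R} u) (pull v)
    pull-same-block {R} {u} {v} s = Blocks.≃⇒same-block λ M →
      let (f , g) = Blocks.same-block⇒≃ s (imageNPtt M)
      in (λ m → down v M (f (up u M m))) , (λ m → down u M (g (up v M m)))
      where
      module _ (u : UT (imagePO σ R)) (M : NPtt R) where
        up : pull u ∈ subposet M → u ∈ subposet (imageNPtt M)
        up m = Blocks.∈⇐ (subposet (imageNPtt M)) λ i j n → 𝔽.trans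
          (𝔽.reflexive (≡.sym (≡.cong₂ (ext u) (strictlyInverseˡ σ i) (strictlyInverseˡ σ j))))
          (𝔽.trans (𝔽.sym (ext-pull u (from σ i) (from σ j))) (Blocks.∈⇒ (subposet M) m (from σ i) (from σ j) n))
        down : u ∈ subposet (imageNPtt M) → pull u ∈ subposet M
        down m = Blocks.∈⇐ (subposet M) λ i j n → 𝔽.trans (ext-pull u i j)
          (Blocks.∈⇒ (subposet (imageNPtt M)) m (to σ i) (to σ j)
            (λ p → n (≡.subst₂ (PO._⪯_ (poset (subposet M))) (strictlyInverseʳ σ i) (strictlyInverseʳ σ j) p)))

    relabel : ∀ {R : PO A} → ClassFunction R → ClassFunction (imagePO σ R)
    relabel φ .value u = value φ (pull u)
    relabel φ .constant s = constant φ (pull-same-block s)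

    pttTransport : Vector (pttObj A) → Vector (pttObj B)
    pttTransport = Extension.extend (pttObj B) (λ (R , φ) → gen (imagePO σ R , relabel φ))

    relabel-same : ∀ {R S : PO A} {φ : ClassFunction R} {ψ : ClassFunction S} → SameFunction φ ψ → SameFunction (relabel φ) (relabel ψ)
    relabel-same {R} {S} (e , f) = (λ b b' → e (from σ b) (from σ b')) ,
      λ u v h → f (pull u) (pull v) (λ i j p q → h (to σ i) (to σ j) _ _)

    pttTransport-linear : IsLinear (pttObj A) (pttObj B) pttTransport
    pttTransport-linear = Extension.extend-linear (pttObj B) (⨁-respects _ _ (pttObj B) _
      (λ R → linear-∘ {classFunctions R} {classFunctions (imagePO σ R)} {pttObj B} (inj-linear _ _ (imagePO σ R))
        (isLinear {classFunctions R} {classFunctions (imagePO σ R)} (λ e u → e (pull u)) (λ _ _ _ → K.refl) (λ _ _ _ → K.refl)))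
      (λ {R} {S} {φ} {ψ} e → rel (inj-∼ (relabel-same {R} {S} {φ} {ψ} e))))

  ptt-ext : ∀ {A} (W : VectorSpace) {f g : Vector (pttObj A) → Vector W} → IsLinear (pttObj A) W f → IsLinear (pttObj A) W g →
            (∀ (R : PO A) φ → LeftModule._≈ᴹ_ W (f (gen (R , φ))) (g (gen (R , φ)))) → ∀ x → LeftModule._≈ᴹ_ W (f x) (g x)
  ptt-ext W Lf Lg e = Extension.linear-ext W Lf Lg (λ (R , φ) → e R φ)

  private
    entry-≡ : ∀ {A} {R : PO A} (u : UT R) {i i' j j'} → i ≡ i' → j ≡ j' → .(p : PO._⪯_ R i j) .(p' : PO._⪯_ R i' j') →
              entry u i j p ≈ꟳ entry u i' j' p'
    entry-≡ u refl refl p p' = 𝔽.refl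

  pttSpecies : VectorSpecies
  pttSpecies = record
    { obj = pttObj
    ; transport = pttTransport
    ; transport-linear = pttTransport-linear
    ; transport-cong = λ {A} {B} {σ} {τ} e → ptt-ext (pttObj B) (pttTransport-linear σ) (pttTransport-linear τ)
        (λ R φ → rel (inj-∼ (relabel-cong {σ = σ} {τ} e φ)))
    ; transport-id = λ {A} → ptt-ext (pttObj A) (pttTransport-linear (id≅ A)) (linear-id {pttObj A})
        (λ R φ → rel (inj-∼ {v = relabel (id≅ A) φ} {φ} ((λ _ _ → refl) , λ u v h → value-cong φ (λ i j p → h i j p p))))
    ; transport-∘ = λ {A} {B} {C} τ σ → ptt-ext (pttObj C) (pttTransport-linear (τ ∘≅ σ))
        (linear-∘ {pttObj A} {pttObj B} {pttObj C} (pttTransport-linear τ) (pttTransport-linear σ))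
        (λ R φ → rel (inj-∼ {v = relabel (τ ∘≅ σ) φ} {relabel τ (relabel σ φ)}
          ((λ _ _ → refl) , λ u v h → value-cong φ (λ i j p → h _ _ _ _))))
    }
    where
    relabel-cong : ∀ {A B} {σ τ : A ≅ B} → to σ ≗ to τ → ∀ {R : PO A} (φ : ClassFunction R) → SameFunction (relabel σ φ) (relabel τ φ)
    relabel-cong {A} {B} {σ} {τ} e {R} φ = (λ b b' → ≡.cong₂ (order R) (d b) (d b')) , λ u v h →
      value-cong φ λ i j p → 𝔽.trans
        (entry-≡ u (e i) (e j) _ (≡.subst₂ (λ a a' → PO._⪯_ R a a') (back u i) (back u j) p))
        (h (to τ i) (to τ j) _ _)
      where
      d : ∀ b → from σ b ≡ from τ b
      d b = ≡.trans (≡.sym (strictlyInverseʳ τ (from σ b)))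
              (≡.cong (from τ) (≡.trans (≡.sym (e (from σ b))) (strictlyInverseˡ σ b)))
      back : UT (imagePO σ R) → ∀ i → i ≡ from σ (to τ i)
      back u i = ≡.trans (≡.sym (strictlyInverseʳ σ i)) (≡.cong (from σ) (e i))

  module _ {A B : FinSet} {P : PO A} {Q : PO B} where

    restrictˡ : UT (P ∙ Q) → UT P
    restrictˡ u .entry i j p = entry u (inj₁ i) (inj₁ j) p
    restrictˡ u .unit i = unit u (inj₁ i)

    restrictʳ : UT (P ∙ Q) → UT Q
    restrictʳ u .entry i j p = entry u (inj₂ i) (inj₂ j) p
    restrictʳ u .unit i = unit u (inj₂ i)

    ext-restrictˡ : ∀ u i j → ext (restrictˡ u) i j ≈ꟳ ext u (inj₁ i) (inj₁ j)
    ext-restrictˡ u i j = 𝔽.refl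

    ext-restrictʳ : ∀ u i j → ext (restrictʳ u) i j ≈ꟳ ext u (inj₂ i) (inj₂ j)
    ext-restrictʳ u i j = 𝔽.refl

    -- the preimages of UT_M ◁ UT_P and UT_N ◁ UT_Q under the two restriction maps

    preimageˡ : NPtt P → NPtt (P ∙ Q)
    preimageˡ M = record { subposet = S ; normal = Blocks.closed⇒normal {Q = S} (λ {i} {j} {k} {l} → closed {i} {j} {k} {l}) }
      where
      S : Subposet (P ∙ Q)
      S .poset = poset (subposet M) ∙ Q
      S .subset {inj₁ _} {inj₁ _} p = subset (subposet M) p
      S .subset {inj₁ _} {inj₂ _} p = p
      S .subset {inj₂ _} {inj₂ _} p = p
      closed : Blocks.Closed S
      closed {inj₁ _} {inj₁ _} {inj₁ _} {inj₁ _} p m n p' =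
        Blocks.normal⇒closed {Q = subposet M} (normal M) p m (λ e → n (≡.cong inj₁ e)) p'
      closed {inj₁ _} {_} {_} {inj₂ _} p m n p' = _
      closed {inj₁ _} {inj₂ _} {inj₁ _} {inj₁ _} p () n p'
      closed {inj₁ _} {inj₂ _} {inj₂ _} {inj₁ _} p m n ()
      closed {inj₂ _} {inj₂ _} {inj₂ _} {inj₂ _} p m n p' = PO.⪯-trans Q p (PO.⪯-trans Q m p')

    preimageʳ : NPtt Q → NPtt (P ∙ Q)
    preimageʳ N = record { subposet = S ; normal = Blocks.closed⇒normal {Q = S} (λ {i} {j} {k} {l} → closed {i} {j} {k} {l}) }
      where
      S : Subposet (P ∙ Q)
      S .poset = P ∙ poset (subposet N)
      S .subset {inj₁ _} {inj₁ _} p = p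
      S .subset {inj₁ _} {inj₂ _} p = p
      S .subset {inj₂ _} {inj₂ _} p = subset (subposet N) p
      closed : Blocks.Closed S
      closed {inj₁ _} {inj₁ _} {inj₁ _} {inj₁ _} p m n p' = PO.⪯-trans P p (PO.⪯-trans P m p')
      closed {inj₁ _} {_} {_} {inj₂ _} p m n p' = _
      closed {inj₁ _} {inj₂ _} {inj₁ _} {inj₁ _} p () n p'
      closed {inj₁ _} {inj₂ _} {inj₂ _} {inj₁ _} p m n ()
      closed {inj₂ _} {inj₂ _} {inj₂ _} {inj₂ _} p m n p' =
        Blocks.normal⇒closed {Q = subposet N} (normal N) p m (λ e → n (≡.cong inj₂ e)) p'

    restrictˡ-same-block : ∀ {u v : UT (P ∙ Q)} → SameBlock u v → SameBlock (restrictˡ u) (restrictˡ v)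
    restrictˡ-same-block {u} {v} s = Blocks.≃⇒same-block λ M →
      let (f , g) = Blocks.same-block⇒≃ s (preimageˡ M)
      in (λ m → down v M (f (up u M m))) , (λ m → down u M (g (up v M m)))
      where
      up : ∀ u M → restrictˡ u ∈ subposet M → u ∈ subposet (preimageˡ M)
      up u M m = Blocks.∈⇐ (subposet (preimageˡ M)) λ
        { (inj₁ i) (inj₁ j) n → Blocks.∈⇒ (subposet M) m i j n
        ; (inj₁ i) (inj₂ j) n → ⊥-elim (n _)
        ; (inj₂ i) (inj₁ j) n → ext-out u (inj₂ i) (inj₁ j) id
        ; (inj₂ i) (inj₂ j) n → ext-out u (inj₂ i) (inj₂ j) n }
      down : ∀ u M → u ∈ subposet (preimageˡ M) → restrictˡ u ∈ subposet M
      down u M m = Blocks.∈⇐ (subposet M) λ i j n → Blocks.∈⇒ (subposet (preimageˡ M)) m (inj₁ i) (inj₁ j) n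

    restrictʳ-same-block : ∀ {u v : UT (P ∙ Q)} → SameBlock u v → SameBlock (restrictʳ u) (restrictʳ v)
    restrictʳ-same-block {u} {v} s = Blocks.≃⇒same-block λ M →
      let (f , g) = Blocks.same-block⇒≃ s (preimageʳ M)
      in (λ m → down v M (f (up u M m))) , (λ m → down u M (g (up v M m)))
      where
      up : ∀ u M → restrictʳ u ∈ subposet M → u ∈ subposet (preimageʳ M)
      up u M m = Blocks.∈⇐ (subposet (preimageʳ M)) λ
        { (inj₁ i) (inj₁ j) n → ext-out u (inj₁ i) (inj₁ j) n
        ; (inj₁ i) (inj₂ j) n → ⊥-elim (n _)
        ; (inj₂ i) (inj₁ j) n → ext-out u (inj₂ i) (inj₁ j) id
        ; (inj₂ i) (inj₂ j) n → Blocks.∈⇒ (subposet M) m i j n }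
      down : ∀ u M → u ∈ subposet (preimageʳ M) → restrictʳ u ∈ subposet M
      down u M m = Blocks.∈⇐ (subposet M) λ i j n → Blocks.∈⇒ (subposet (preimageʳ M)) m (inj₂ i) (inj₂ j) n

    inflate : ClassFunction P → ClassFunction Q → ClassFunction (P ∙ Q)
    inflate φ ψ .value u = value φ (restrictˡ u) K.* value ψ (restrictʳ u)
    inflate φ ψ .constant s = K.*-cong (constant φ (restrictˡ-same-block s)) (constant ψ (restrictʳ-same-block s))

  module _ {A B : FinSet} where

    pttMult : Vector (pttObj A) → Vector (pttObj B) → Vector (pttObj (A ⊔ B))
    pttMult = Extension.extend₂ (pttObj (A ⊔ B)) (λ (P , φ) (Q , ψ) → gen (P ∙ Q , inflate φ ψ))

    pttMult-bilinear : IsBilinear (pttObj A) (pttObj B) (pttObj (A ⊔ B)) pttMult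
    pttMult-bilinear = Extension.extend₂-bilinear (pttObj (A ⊔ B)) _
      (λ (Q , ψ) → ⨁-respects _ _ (pttObj (A ⊔ B)) _
        (λ P → linear-∘ {classFunctions P} {classFunctions (P ∙ Q)} {pttObj (A ⊔ B)} (inj-linear _ _ (P ∙ Q))
          (isLinear {classFunctions P} {classFunctions (P ∙ Q)}
            (λ e u → K.*-congʳ (e (restrictˡ u))) (λ _ _ _ → K.distribʳ _ _ _) (λ _ _ _ → K.*-assoc _ _ _)))
        (λ {P} {P'} {φ} {φ'} (e , f) → rel (inj-∼ {v = inflate φ ψ} {inflate φ' ψ}
          ( (λ { (inj₁ i) (inj₁ j) → e i j ; (inj₁ i) (inj₂ j) → refl ; (inj₂ i) (inj₁ j) → refl ; (inj₂ i) (inj₂ j) → refl })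
          , λ u v h → K.*-cong (f (restrictˡ u) (restrictˡ v) (λ i j p q → h (inj₁ i) (inj₁ j) p q))
                               (value-cong ψ (λ i j p → h (inj₂ i) (inj₂ j) p p))))))
      (λ (P , φ) → ⨁-respects _ _ (pttObj (A ⊔ B)) _
        (λ Q → linear-∘ {classFunctions Q} {classFunctions (P ∙ Q)} {pttObj (A ⊔ B)} (inj-linear _ _ (P ∙ Q))
          (isLinear {classFunctions Q} {classFunctions (P ∙ Q)}
            (λ e u → K.*-congˡ (e (restrictʳ u))) (λ _ _ _ → K.distribˡ _ _ _)
            (λ c ψ u → K.trans (K.sym (K.*-assoc _ _ _)) (K.trans (K.*-congʳ (K.*-comm _ _)) (K.*-assoc _ _ _)))))
        (λ {Q} {Q'} {ψ} {ψ'} (e , f) → rel (inj-∼ {v = inflate φ ψ} {inflate φ ψ'}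
          ( (λ { (inj₁ i) (inj₁ j) → refl ; (inj₁ i) (inj₂ j) → refl ; (inj₂ i) (inj₁ j) → refl ; (inj₂ i) (inj₂ j) → e i j })
          , λ u v h → K.*-cong (value-cong φ (λ i j p → h (inj₁ i) (inj₁ j) p p))
                               (f (restrictʳ u) (restrictʳ v) (λ i j p q → h (inj₂ i) (inj₂ j) p q))))))

  private module Mult {A B} = IsBilinear (pttMult-bilinear {A} {B})

  pttUnit : Vector (pttObj ∅)
  pttUnit = gen (∅-order , one)
    where
    one : ClassFunction ∅-order
    one .value _ = K.1#
    one .constant _ = K.refl

  ptt : MonoidInSpecies
  ptt = record
    { species = pttSpecies
    ; unit = pttUnit
    ; mult = pttMult
    ; bilinear = pttMult-bilinear
    ; natural = λ {A} {A'} {B} {B'} σ τ x y → let W = pttObj (A' ⊔ B') in ptt-ext W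
        (linear-∘ {pttObj A} {pttObj (A ⊔ B)} {W} (pttTransport-linear (σ ⊔≅ τ)) (Mult.linearˡ y))
        (linear-∘ {pttObj A} {pttObj A'} {W} (Mult.linearˡ (pttTransport τ y)) (pttTransport-linear σ))
        (λ P φ → ptt-ext W
          (linear-∘ {pttObj B} {pttObj (A ⊔ B)} {W} (pttTransport-linear (σ ⊔≅ τ)) (Mult.linearʳ (gen (P , φ))))
          (linear-∘ {pttObj B} {pttObj B'} {W} (Mult.linearʳ (pttTransport σ (gen (P , φ)))) (pttTransport-linear τ))
          (λ Q ψ → rel (inj-∼ {v = relabel (σ ⊔≅ τ) (inflate φ ψ)} {inflate (relabel σ φ) (relabel τ ψ)}
            ( (λ { (inj₁ _) (inj₁ _) → refl ; (inj₁ _) (inj₂ _) → refl ; (inj₂ _) (inj₁ _) → refl ; (inj₂ _) (inj₂ _) → refl })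
            , λ u v h → K.*-cong (value-cong φ (λ i j p → h _ _ _ _)) (value-cong ψ (λ i j p → h _ _ _ _))))) y) x
    ; assoc = λ {A} {B} {C} x y z → let W = pttObj (A ⊔ (B ⊔ C)) ; a = ⊔-assoc A B C in ptt-ext W
        (linear-∘ {pttObj A} {pttObj ((A ⊔ B) ⊔ C)} {W} (pttTransport-linear a)
          (linear-∘ {pttObj A} {pttObj (A ⊔ B)} {pttObj ((A ⊔ B) ⊔ C)} (Mult.linearˡ z) (Mult.linearˡ y)))
        (Mult.linearˡ (pttMult y z))
        (λ P φ → ptt-ext W
          (linear-∘ {pttObj B} {pttObj ((A ⊔ B) ⊔ C)} {W} (pttTransport-linear a)
            (linear-∘ {pttObj B} {pttObj (A ⊔ B)} {pttObj ((A ⊔ B) ⊔ C)} (Mult.linearˡ z) (Mult.linearʳ (gen (P , φ)))))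
          (linear-∘ {pttObj B} {pttObj (B ⊔ C)} {W} (Mult.linearʳ (gen (P , φ))) (Mult.linearˡ z))
          (λ Q ψ → ptt-ext W
            (linear-∘ {pttObj C} {pttObj ((A ⊔ B) ⊔ C)} {W} (pttTransport-linear a)
              (Mult.linearʳ (pttMult (gen (P , φ)) (gen (Q , ψ)))))
            (linear-∘ {pttObj C} {pttObj (B ⊔ C)} {W} (Mult.linearʳ (gen (P , φ))) (Mult.linearʳ (gen (Q , ψ))))
            (λ S χ → rel (inj-∼ {v = relabel a (inflate (inflate φ ψ) χ)} {inflate φ (inflate ψ χ)}
              ( (λ { (inj₁ _) (inj₁ _) → refl ; (inj₁ _) (inj₂ (inj₁ _)) → refl ; (inj₁ _) (inj₂ (inj₂ _)) → refl
                   ; (inj₂ (inj₁ _)) (inj₁ _) → refl ; (inj₂ (inj₂ _)) (inj₁ _) → refl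
                   ; (inj₂ (inj₁ _)) (inj₂ (inj₁ _)) → refl ; (inj₂ (inj₁ _)) (inj₂ (inj₂ _)) → refl
                   ; (inj₂ (inj₂ _)) (inj₂ (inj₁ _)) → refl ; (inj₂ (inj₂ _)) (inj₂ (inj₂ _)) → refl })
              , λ u v h → K.trans (K.*-assoc _ _ _) (K.*-cong (value-cong φ (λ i j p → h _ _ _ _))
                  (K.*-cong (value-cong ψ (λ i j p → h _ _ _ _)) (value-cong χ (λ i j p → h _ _ _ _))))))) z) y) x
    ; identityˡ = λ {A} → ptt-ext (pttObj A)
        (linear-∘ {pttObj A} {pttObj (∅ ⊔ A)} {pttObj A} (pttTransport-linear (⊔-identityˡ A)) (Mult.linearʳ pttUnit))
        (linear-id {pttObj A})
        (λ R φ → rel (inj-∼ ((λ _ _ → refl) , λ u v h → K.trans (K.*-identityˡ _) (value-cong φ (λ i j p → h i j p p)))))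
    ; identityʳ = λ {A} → ptt-ext (pttObj A)
        (linear-∘ {pttObj A} {pttObj (A ⊔ ∅)} {pttObj A} (pttTransport-linear (⊔-identityʳ A)) (Mult.linearˡ pttUnit))
        (linear-id {pttObj A})
        (λ R φ → rel (inj-∼ ((λ _ _ → refl) , λ u v h → K.trans (K.*-identityʳ _) (value-cong φ (λ i j p → h i j p p)))))
    }

-- Inflation multiplies the indicator functions of normal pattern subgroups like the pairs of posets
-- they come from: 1_M ⊗ 1_N, for UT_M ◁ UT_P and UT_N ◁ UT_Q, goes to 1_{M.N}, for UT_{M.N} ◁ UT_{P.Q}.
-- Since N ⊆ R, a factorization of N as an ordinal sum is one of R as well, and every poset N is in a
-- unique way an ordinal sum of irreducible ones.  Hence the pairs (R , N) form a free monoid of set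
-- species on the pairs with N irreducible, and the indicators 1_N are a basis of f(UT_R ; Cl(R)), by
-- inclusion-exclusion over the intervals of R.
module Submission where

import Algebra.Module.Construct.TensorUnit as TensorUnit
open import Algebra.Bundles using (CommutativeRing)
open import Algebra.Module.Bundles using (LeftModule)
open import Algebra.Module.Morphism.Structures using (module LeftModuleMorphisms)
open import Data.Bool.Base using (Bool; true; false; T; not; if_then_else_)
open import Data.Bool.Properties using (T?; T-irrelevant; T-≡)
open import Data.Empty using (⊥; ⊥-elim)
open import Data.Fin.Base using (Fin; zero; suc)
import Data.Fin.Properties as FinP
import Data.Fin.Subset as FinSubset
open import Data.Fin.Subset.Properties using (∣p∣≤n; p⊆q⇒∣p∣≤∣q∣; p⊂q⇒∣p∣<∣q∣)
open import Data.List.Base using (List; []; _∷_; _++_; map; allFin; cartesianProduct)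
import Data.List.Membership.DecPropositional as DecMembership
open import Data.List.Membership.Propositional using (_∈_)
import Data.List.Membership.Propositional.Properties as ∈P
open import Data.List.Relation.Binary.Pointwise.Base using (Pointwise; []; _∷_)
open import Data.List.Relation.Unary.All as All using (All; []; _∷_)
import Data.List.Relation.Unary.All.Properties as AllP
open import Data.List.Relation.Unary.AllPairs using (AllPairs; []; _∷_)
open import Data.List.Relation.Unary.Any as Any using (Any; here; there)
open import Data.Nat.Base as ℕ using (ℕ; zero; suc; _≤_; _<_; z≤n; s≤s)
import Data.Nat.Properties as ℕP
open import Data.Product.Base using (_×_; _,_; proj₁; proj₂; ∃; Σ; Σ-syntax; ∃-syntax)
open import Data.Product.Properties using (≡-dec)
open import Data.Sum.Base using (_⊎_; inj₁; inj₂; [_,_]′)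
open import Data.Unit.Base using (tt)
open import Data.Vec.Base using (tabulate)
open import Data.Vec.Functional using (tail) renaming ([] to []ᵛ; _∷_ to _∷ᵛ_)
open import Data.Vec.Properties using (lookup∘tabulate; []=⇒lookup; lookup⇒[]=)
open import Function.Base using (_∘_; id)
open import Function.Bundles using (Inverse; Equivalence)
open import Level using (0ℓ)
open import Relation.Binary.Definitions using (tri<; tri≈; tri>)
open import Relation.Binary.PropositionalEquality as ≡ using (_≡_; _≢_; _≗_; refl)
open import Relation.Nullary.Decidable as Dec
  using (Dec; yes; no; ⌊_⌋; toWitness; fromWitness; toWitnessFalse; fromWitnessFalse; _×-dec_; _⊎-dec_; _→-dec_; ¬?; decidable-stable)
open import Relation.Nullary.Negation using (¬_)
open import Defs
open PO using () renaming (_≤ᵇ_ to order)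
open Enumeration using (Σ-≡)

-- The space `pairs A`, with the pairs (R , N) as basis, stands between the free monoid and the
-- class functions. Inverses are built on both sides of it; naturality and products are checked only
-- for the maps towards the class functions. Unique factorization rests on cuts. The cuts of N form
-- a chain under inclusion that is described by N alone, and the irreducible blocks are the steps of
-- this chain. Posets and blocks are given only up to pointwise equality, so factoring must be shown
-- independent of representatives, and uniqueness is what shows it. The indicators are a basis
-- because the block of u in Cl(R) is known once it is known, for each interval e, whether u has a
-- nonzero off-diagonal entry inside e. So a class function is a polynomial in the functions z_e,
-- where z_e(u) is 1 if there is no such entry and 0 otherwise. These are idempotent, and their
-- products are again indicators of normal pattern subgroups.

T-ext : ∀ {b c} → (T b → T c) → (T c → T b) → b ≡ c
T-ext {false} {false} f g = refl
T-ext {false} {true}  f g = ⊥-elim (g tt)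
T-ext {true}  {false} f g = ⊥-elim (f tt)
T-ext {true}  {true}  f g = refl

-- Decidable quantification over a finite set and over its subsets

module _ (A : FinSet) where

  private module E = Inverse (enum A)

  all? : {P : El A → Set} → (∀ a → Dec (P a)) → Dec (∀ a → P a)
  all? {P} P? = Dec.map′ (λ h a → ≡.subst P (E.strictlyInverseʳ a) (h (E.to a))) (λ h k → h (E.from k))
    (FinP.all? (λ k → P? (E.from k)))

  any? : {P : El A → Set} → (∀ a → Dec (P a)) → Dec (∃ P)
  any? {P} P? = Dec.map′ (λ (k , p) → E.from k , p)
    (λ (a , p) → E.to a , ≡.subst P (≡.sym (E.strictlyInverseʳ a)) p) (FinP.any? (λ k → P? (E.from k)))

-- Used to decide `≲` below, which quantifies over all cuts. A function is only pointwise equal to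
-- its head consed onto its tail, so `P` has to respect `≗`.
allBoolVectors? : ∀ n {P : (Fin n → Bool) → Set} → (∀ {f g} → f ≗ g → P f → P g) → (∀ f → Dec (P f)) → Dec (∀ f → P f)
allBoolVectors? zero resp P? = Dec.map′ (λ p f → resp (λ ()) p) (λ h → h []ᵛ) (P? []ᵛ)
allBoolVectors? (suc n) {P} resp P? = Dec.map′ assemble split (at false ×-dec at true)
  where
  Rest : Bool → Set
  Rest b = ∀ f → P (b ∷ᵛ f)
  at : ∀ b → Dec (Rest b)
  at b = allBoolVectors? n (λ e → resp (λ { zero → refl ; (suc k) → e k })) (λ f → P? (b ∷ᵛ f))
  assemble : Rest false × Rest true → ∀ f → P f
  assemble (p , q) f with f zero in eq
  ... | false = resp (λ { zero → ≡.sym eq ; (suc k) → refl }) (p (tail f))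
  ... | true  = resp (λ { zero → ≡.sym eq ; (suc k) → refl }) (q (tail f))
  split : (∀ f → P f) → Rest false × Rest true
  split h = (λ f → h _) , (λ f → h _)

allSubsets? : ∀ A {P : Subset A → Set} → (∀ {S S'} → S ≗ S' → P S → P S') → (∀ S → Dec (P S)) → Dec (∀ S → P S)
allSubsets? A {P} resp P? = Dec.map′
  (λ h S → resp (λ a → ≡.cong S (E.strictlyInverseʳ a)) (h (S ∘ E.from))) (λ h f → h (f ∘ E.to))
  (allBoolVectors? (size A) (λ e → resp (λ a → e (E.to a))) (λ f → P? (f ∘ E.to)))
  where module E = Inverse (enum A)

-- Normal pairs: their relabellings, ordinal sums and restrictions

-- UT_part ◁ UT_R, with normality in the form of Blocks.Closed, which does not refer to the field
record NormalPart {A : FinSet} (R : PO A) : Set where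
  no-eta-equality
  field
    part   : PO A
    part⊆  : ∀ {i j} → PO._⪯_ part i j → PO._⪯_ R i j
    closed : ∀ {i j k l} → PO._⪯_ R i j → PO._⪯_ part j k → j ≢ k → PO._⪯_ R k l → PO._⪯_ part i l

open NormalPart public

NormalPair : FinSet → Set
NormalPair A = Σ (PO A) NormalPart

whole : ∀ {A} → NormalPair A → PO A
whole = proj₁

inner : ∀ {A} → NormalPair A → PO A
inner p = part (proj₂ p)

infix 4 _≈ₙ_

record _≈ₙ_ {A} (p p' : NormalPair A) : Set where
  constructor _,_
  field
    whole-≗ : whole p ≗ᴾ whole p'
    inner-≗ : inner p ≗ᴾ inner p'

open _≈ₙ_ public

≈ₙ-refl : ∀ {A} {p : NormalPair A} → p ≈ₙ p
≈ₙ-refl = (λ _ _ → refl) , (λ _ _ → refl)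

≈ₙ-sym : ∀ {A} {p p' : NormalPair A} → p ≈ₙ p' → p' ≈ₙ p
≈ₙ-sym (e , f) = (λ i j → ≡.sym (e i j)) , (λ i j → ≡.sym (f i j))

imagePair : ∀ {A B} → A ≅ B → NormalPair A → NormalPair B
imagePair σ (R , N) .proj₁ = imagePO σ R
imagePair σ (R , N) .proj₂ .part = imagePO σ (part N)
imagePair σ (R , N) .proj₂ .part⊆ = part⊆ N
imagePair σ (R , N) .proj₂ .closed i⪯j jk j≢k k⪯l = closed N i⪯j jk
  (λ e → j≢k (≡.trans (≡.sym (strictlyInverseˡ σ _)) (≡.trans (≡.cong (to σ) e) (strictlyInverseˡ σ _)))) k⪯l

infixr 5 _∙ₙ_

_∙ₙ_ : ∀ {A B} → NormalPair A → NormalPair B → NormalPair (A ⊔ B)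
((R , M) ∙ₙ (S , N)) .proj₁ = R ∙ S
((R , M) ∙ₙ (S , N)) .proj₂ .part = part M ∙ part N
((R , M) ∙ₙ (S , N)) .proj₂ .part⊆ {inj₁ _} {inj₁ _} p = part⊆ M p
((R , M) ∙ₙ (S , N)) .proj₂ .part⊆ {inj₁ _} {inj₂ _} p = tt
((R , M) ∙ₙ (S , N)) .proj₂ .part⊆ {inj₂ _} {inj₂ _} p = part⊆ N p
((R , M) ∙ₙ (S , N)) .proj₂ .closed {inj₁ _} {inj₁ _} {inj₁ _} {inj₁ _} p m n p' = closed M p m (n ∘ ≡.cong inj₁) p'
((R , M) ∙ₙ (S , N)) .proj₂ .closed {inj₁ _} {_} {_} {inj₂ _} p m n p' = tt
((R , M) ∙ₙ (S , N)) .proj₂ .closed {inj₁ _} {inj₁ _} {inj₂ _} {inj₁ _} p m n ()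
((R , M) ∙ₙ (S , N)) .proj₂ .closed {inj₁ _} {inj₂ _} {inj₂ _} {inj₁ _} p m n ()
((R , M) ∙ₙ (S , N)) .proj₂ .closed {inj₂ _} {inj₂ _} {inj₂ _} {inj₂ _} p m n p' = closed N p m (n ∘ ≡.cong inj₂) p'

restrictPO : ∀ {A} (S : Subset A) → PO A → PO (A ↾ S)
restrictPO S R .PO._≤ᵇ_ (a , _) (b , _) = order R a b
restrictPO S R .PO.isPartialOrder = record
  { isPreorder = record
    { isEquivalence = ≡.isEquivalence
    ; reflexive = λ { refl → PO.⪯-refl R }
    ; trans = PO.⪯-trans R }
  ; antisym = λ p q → Σ-≡ (PO.⪯-antisym R p q) }

restrictPair : ∀ {A} (S : Subset A) → NormalPair A → NormalPair (A ↾ S)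
restrictPair S (R , N) .proj₁ = restrictPO S R
restrictPair S (R , N) .proj₂ .part = restrictPO S (part N)
restrictPair S (R , N) .proj₂ .part⊆ = part⊆ N
restrictPair S (R , N) .proj₂ .closed p m n p' = closed N p m (n ∘ Σ-≡) p'

-- Irreducible posets and the generators of the free monoid

-- P is the ordinal sum of its restrictions to C and to A ∖ C
IsCut : ∀ {A} → PO A → Subset A → Set
IsCut P C = ∀ a b → T (C a) → ¬ T (C b) → PO._⪯_ P a b

Irreducible : ∀ {A} → PO A → Set
Irreducible P = ∀ C → IsCut P C → ∀ a b → T (C a) → T (C b)

-- `point` excludes the empty pair, which is vacuously irreducible: as a generator it would spoil
-- both unique factorization and the vanishing at `∅`.
record Atom (A : FinSet) : Set where
  no-eta-equality
  field
    pair        : NormalPair A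
    point       : El A
    irreducible : Irreducible (inner pair)

open Atom public

imageAtom : ∀ {A B} → A ≅ B → Atom A → Atom B
imageAtom σ g .pair = imagePair σ (pair g)
imageAtom σ g .point = to σ (point g)
imageAtom σ g .irreducible C cut a b Ca = ≡.subst (T ∘ C) (strictlyInverseˡ σ b)
  (irreducible g (C ∘ to σ)
    (λ i j p n → ≡.subst₂ (PO._⪯_ (inner (pair g))) (strictlyInverseʳ σ i) (strictlyInverseʳ σ j) (cut (to σ i) (to σ j) p n))
    (from σ a) (from σ b) (≡.subst (T ∘ C) (≡.sym (strictlyInverseˡ σ a)) Ca))

infix 4 _≈ₐ_

-- `point` only witnesses that the set is nonempty, so it is not compared.
record _≈ₐ_ {A} (g h : Atom A) : Set where
  constructor atom-≈
  field pair-≈ : pair g ≈ₙ pair h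

open _≈ₐ_ public

≈ₐ-refl : ∀ {A} {g : Atom A} → g ≈ₐ g
≈ₐ-refl = atom-≈ ≈ₙ-refl

imagePair-resp : ∀ {A B} (σ : A ≅ B) {p p' : NormalPair A} → p ≈ₙ p' → imagePair σ p ≈ₙ imagePair σ p'
imagePair-resp σ (e , f) = (λ i j → e (from σ i) (from σ j)) , (λ i j → f (from σ i) (from σ j))

imagePair-cong : ∀ {A B} {σ τ : A ≅ B} → to σ ≗ to τ → ∀ (p : NormalPair A) → imagePair σ p ≈ₙ imagePair τ p
imagePair-cong {A} {B} {σ} {τ} e p = (λ i j → ≡.cong₂ (order (whole p)) (d i) (d j)) , (λ i j → ≡.cong₂ (order (inner p)) (d i) (d j))
  where
  d : from σ ≗ from τ
  d b = ≡.trans (≡.sym (strictlyInverseʳ τ (from σ b)))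
          (≡.cong (from τ) (≡.trans (≡.sym (e (from σ b))) (strictlyInverseˡ σ b)))

-- Stacking orders on the blocks of a set composition

module _ {A : FinSet} where

  index : List (Subset A) → El A → ℕ
  index []       a = 0
  index (S ∷ Ss) a with T? (S a)
  ... | yes _ = 0
  ... | no _  = suc (index Ss a)

  Covered : List (Subset A) → El A → Set
  Covered Ss a = Any (λ S → T (S a)) Ss

  Orders : List (Subset A) → Set
  Orders = All (λ S → PO (A ↾ S))

  -- an element of several blocks counts for the first of them
  stack-step : ∀ {S} → PO (A ↾ S) → ∀ {a b} → Bool → Dec (T (S a)) → Dec (T (S b)) → Bool
  stack-step P rest (yes p) (yes q) = order P (_ , p) (_ , q)
  stack-step P rest (yes _) (no _)  = true
  stack-step P rest (no _)  (yes _) = false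
  stack-step P rest (no _)  (no _)  = rest

  stack : ∀ {Ss} → Orders Ss → El A → El A → Bool
  stack []               a b = false
  stack (_∷_ {S} P Ps) a b = stack-step P (stack Ps a b) (T? (S a)) (T? (S b))

  stack-refl : ∀ {Ss} (Ps : Orders Ss) {a} → Covered Ss a → T (stack Ps a a)
  stack-refl (_∷_ {S} P Ps) {a} c with T? (S a) | c
  ... | yes p | _       = PO.⪯-refl P
  ... | no n  | here p  = ⊥-elim (n p)
  ... | no n  | there c = stack-refl Ps c

  stack-trans : ∀ {Ss} (Ps : Orders Ss) {a b c} → T (stack Ps a b) → T (stack Ps b c) → T (stack Ps a c)
  stack-trans (_∷_ {S} P Ps) {a} {b} {c} p q with T? (S a) | T? (S b) | T? (S c)
  ... | yes _ | yes _ | yes _ = PO.⪯-trans P p q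
  ... | yes _ | no _  | yes _ = ⊥-elim q
  ... | yes _ | _     | no _  = tt
  ... | no _  | no _  | no _  = stack-trans Ps p q

  stack-antisym : ∀ {Ss} (Ps : Orders Ss) {a b} → T (stack Ps a b) → T (stack Ps b a) → a ≡ b
  stack-antisym (_∷_ {S} P Ps) {a} {b} p q with T? (S a) | T? (S b)
  ... | yes _ | yes _ = ≡.cong proj₁ (PO.⪯-antisym P p q)
  ... | no _  | no _  = stack-antisym Ps p q

  stack-before : ∀ {Ss} (Ps : Orders Ss) {a b} → index Ss a < index Ss b → T (stack Ps a b)
  stack-before (_∷_ {S} P Ps) {a} {b} lt with T? (S a) | T? (S b)
  ... | yes _ | no _ = tt
  stack-before (_∷_ {S} P Ps) {a} {b} (s≤s lt) | no _ | no _ = stack-before Ps lt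

  stackPO : ∀ {Ss} → (∀ a → Covered Ss a) → Orders Ss → PO A
  stackPO c Ps .PO._≤ᵇ_ = stack Ps
  stackPO c Ps .PO.isPartialOrder = record
    { isPreorder = record
      { isEquivalence = ≡.isEquivalence
      ; reflexive = λ { {a} refl → stack-refl Ps (c a) }
      ; trans = stack-trans Ps }
    ; antisym = stack-antisym Ps }

  Atoms : List (Subset A) → Set
  Atoms = All (λ S → Atom (A ↾ S))

  wholes inners : ∀ {Ss} → Atoms Ss → Orders Ss
  wholes = All.map (whole ∘ pair)
  inners = All.map (inner ∘ pair)

  stack-⊆ : ∀ {Ss} (gs : Atoms Ss) {a b} → T (stack (inners gs) a b) → T (stack (wholes gs) a b)
  stack-⊆ (_∷_ {S} g gs) {a} {b} p with T? (S a) | T? (S b)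
  ... | yes _ | yes _ = part⊆ (proj₂ (pair g)) p
  ... | yes _ | no _  = tt
  ... | no _  | no _  = stack-⊆ gs p

  -- The chain i, j, k, l never moves back to an earlier block. If l is in a later block than i, the
  -- conclusion holds in any stack; otherwise all four elements share a block, where closedness of
  -- its atom applies.
  stack-closed : ∀ {Ss} (gs : Atoms Ss) {i j k l} → T (stack (wholes gs) i j) → T (stack (inners gs) j k) → j ≢ k →
                 T (stack (wholes gs) k l) → T (stack (inners gs) i l)
  stack-closed (_∷_ {S} g gs) {i} {j} {k} {l} p m n q with T? (S i) | T? (S j) | T? (S k) | T? (S l)
  ... | yes _ | yes _ | yes _ | yes _ = closed (proj₂ (pair g)) p m (n ∘ ≡.cong proj₁) q
  ... | yes _ | _     | no _  | yes _ = ⊥-elim q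
  ... | yes _ | no _  | yes _ | yes _ = ⊥-elim m
  ... | yes _ | _     | _     | no _  = tt
  ... | no _  | no _  | no _  | no _  = stack-closed gs p m n q

  glue : ∀ {Ss} → (∀ a → Covered Ss a) → Atoms Ss → NormalPair A
  glue c gs .proj₁ = stackPO c (wholes gs)
  glue c gs .proj₂ .part = stackPO c (inners gs)
  glue c gs .proj₂ .part⊆ = stack-⊆ gs
  glue c gs .proj₂ .closed = stack-closed gs

  Disjoint : Subset A → Subset A → Set
  Disjoint S S' = ∀ a → T (S a) → T (S' a) → ⊥

  Covered-tail : ∀ {S Ss a} → ¬ T (S a) → Covered (S ∷ Ss) a → Covered Ss a
  Covered-tail n (here p)  = ⊥-elim (n p)
  Covered-tail n (there c) = c

  disjoint⇒∉ : ∀ {S Ss a} → All (Disjoint S) Ss → Covered Ss a → ¬ T (S a)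
  disjoint⇒∉ (d ∷ ds) (here p)  q = d _ q p
  disjoint⇒∉ (d ∷ ds) (there c) q = disjoint⇒∉ ds c q

  index-head : ∀ {S Ss a} → T (S a) → index (S ∷ Ss) a ≡ 0
  index-head {S} {a = a} p with T? (S a)
  ... | yes _ = refl
  ... | no n  = ⊥-elim (n p)

  index-zero : ∀ {S Ss a} → index (S ∷ Ss) a ≤ 0 → T (S a)
  index-zero {S} {a = a} le with T? (S a)
  ... | yes p = p
  index-zero {S} {a = a} () | no _

  index-tail : ∀ {S Ss a} → ¬ T (S a) → index (S ∷ Ss) a ≡ suc (index Ss a)
  index-tail {S} {a = a} n with T? (S a)
  ... | yes p = ⊥-elim (n p)
  ... | no _  = refl

  stack-head : ∀ {S Ss} (P : PO (A ↾ S)) (Ps : Orders Ss) {a b} (p : T (S a)) (q : T (S b)) →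
               stack (P ∷ Ps) a b ≡ order P (a , p) (b , q)
  stack-head {S} P Ps {a} {b} p q with T? (S a) | T? (S b)
  ... | yes p' | yes q' = ≡.cong₂ (λ x y → order P (a , x) (b , y)) (T-irrelevant p' p) (T-irrelevant q' q)
  ... | no n   | _      = ⊥-elim (n p)
  ... | yes _  | no n   = ⊥-elim (n q)

  stack-tail : ∀ {S Ss} (P : PO (A ↾ S)) (Ps : Orders Ss) {a b} → ¬ T (S a) → ¬ T (S b) →
               stack (P ∷ Ps) a b ≡ stack Ps a b
  stack-tail {S} P Ps {a} {b} m n with T? (S a) | T? (S b)
  ... | no _  | no _  = refl
  ... | yes p | _     = ⊥-elim (m p)
  ... | no _  | yes p = ⊥-elim (n p)

  data Restricts (p : NormalPair A) : ∀ {Ss} → Atoms Ss → Set where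
    []  : Restricts p []
    _∷_ : ∀ {S Ss} {g : Atom (A ↾ S)} {gs : Atoms Ss} → restrictPair S p ≈ₙ pair g → Restricts p gs → Restricts p (g ∷ gs)

  -- Limited to covered elements so that it passes to the tail of the list, whose blocks no longer
  -- cover `A`.
  Agree : ∀ {Ss} → PO A → Orders Ss → Set
  Agree {Ss} P Ps = ∀ a b → Covered Ss a → Covered Ss b → order P a b ≡ stack Ps a b

  agree-head : ∀ {S Ss P} {P₀ : PO (A ↾ S)} {Ps : Orders Ss} → Agree P (P₀ ∷ Ps) → restrictPO S P ≗ᴾ P₀
  agree-head {P₀ = P₀} {Ps} e (a , p) (b , q) = ≡.trans (e a b (here p) (here q)) (stack-head P₀ Ps p q)

  agree-tail : ∀ {S Ss P} {P₀ : PO (A ↾ S)} {Ps : Orders Ss} → All (Disjoint S) Ss → Agree P (P₀ ∷ Ps) → Agree P Ps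
  agree-tail {P₀ = P₀} {Ps} d e a b ca cb =
    ≡.trans (e a b (there ca) (there cb)) (stack-tail P₀ Ps (disjoint⇒∉ d ca) (disjoint⇒∉ d cb))

  restricts : ∀ {p Ss} (gs : Atoms Ss) → AllPairs Disjoint Ss → Agree (whole p) (wholes gs) → Agree (inner p) (inners gs) →
              Restricts p gs
  restricts []       []       e f = []
  restricts {p} (g ∷ gs) (d ∷ ds) e f = (agree-head {P = whole p} {Ps = wholes gs} e , agree-head {P = inner p} {Ps = inners gs} f)
    ∷ restricts gs ds (agree-tail {P = whole p} {Ps = wholes gs} d e) (agree-tail {P = inner p} {Ps = inners gs} d f)

  -- Uniqueness of the decomposition into atoms

  -- b lies in the same block of the finest ordinal sum decomposition of P as a or in a later one
  infix 4 _⊢_≲_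

  _⊢_≲_ : PO A → El A → El A → Set
  P ⊢ a ≲ b = ∀ C → IsCut P C → T (C b) → T (C a)

  -- A cut containing b but not a would put b below a, against antisymmetry.
  ⪯⇒≲ : ∀ P {a b} → PO._⪯_ P a b → a ≢ b → P ⊢ a ≲ b
  ⪯⇒≲ P {a} {b} p a≢b C cut Cb = decidable-stable (T? (C a)) (λ n → a≢b (PO.⪯-antisym P p (cut b a Cb n)))

  -- A cut of `inner p` restricts to a cut of the block that holds both elements, and by
  -- irreducibility such a cut contains all of the block once it contains b.
  same-index⇒≲ : ∀ {p Ss} {gs : Atoms Ss} {a b} → Restricts p gs → Covered Ss a → Covered Ss b → index Ss a ≡ index Ss b →
                 inner p ⊢ a ≲ b
  same-index⇒≲ {p} {S ∷ Ss} {g ∷ gs} {a} {b} (r ∷ rs) ca cb e C cut Cb with T? (S a) | T? (S b)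
  ... | yes Sa | yes Sb = irreducible g (C ∘ proj₁)
    (λ i j Ci n → ≡.subst T (inner-≗ r i j) (cut (proj₁ i) (proj₁ j) Ci n)) (b , Sb) (a , Sa) Cb
  ... | no m   | no n   = same-index⇒≲ rs (Covered-tail m ca) (Covered-tail n cb) (ℕP.suc-injective e) C cut Cb

  record Decomposition (p : NormalPair A) : Set where
    no-eta-equality
    field
      composition : SetComposition A
      atoms       : Atoms (blocks composition)
      glued       : p ≈ₙ glue (covering composition) atoms

    position : El A → ℕ
    position = index (blocks composition)

    restrictions : Restricts p atoms
    restrictions = restricts atoms (disjoint composition) (λ a b _ _ → whole-≗ glued a b) (λ a b _ _ → inner-≗ glued a b)

    position-< : ∀ {a b} → position a < position b → PO._⪯_ (inner p) a b
    position-< {a} {b} lt = ≡.subst T (≡.sym (inner-≗ glued a b)) (stack-before (inners atoms) lt)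

    position⇒≲ : ∀ {a b} → position a ≤ position b → inner p ⊢ a ≲ b
    position⇒≲ {a} {b} le with ℕP.m≤n⇒m<n∨m≡n le
    ... | inj₁ lt = ⪯⇒≲ (inner p) (position-< lt) (λ { refl → ℕP.<-irrefl refl lt })
    ... | inj₂ e  = same-index⇒≲ restrictions (covering composition a) (covering composition b) e

    -- The elements positioned no later than b form a cut that contains b. With the converse above,
    -- the positions order `A` exactly by `≲`, a relation that does not mention the decomposition.
    ≲⇒position : ∀ {a b} → inner p ⊢ a ≲ b → position a ≤ position b
    ≲⇒position {a} {b} a≲b = toWitness (a≲b (λ x → ⌊ position x ℕP.≤? position b ⌋)
      (λ i j le nle → position-< (ℕP.≤-<-trans (toWitness le) (ℕP.≰⇒> (λ h → nle (fromWitness h)))))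
      (fromWitness (ℕP.≤-refl {position b})))

  _OrderedLike_ : List (Subset A) → List (Subset A) → Set
  Ss OrderedLike Ts = ∀ a b → Covered Ss a → Covered Ss b → index Ss a ≤ index Ss b → index Ts a ≤ index Ts b

  Inhabited : Subset A → Set
  Inhabited S = ∃[ a ] T (S a)

  -- An element t of `S'` has index 0 in the second list. In the first list a has index 0, so it is
  -- not after t there, hence not after t in the second list either.
  ordered-head : ∀ {S S' Ss Ts} → Inhabited S' → (∀ a → Covered (S' ∷ Ts) a → Covered (S ∷ Ss) a) →
                 (S ∷ Ss) OrderedLike (S' ∷ Ts) → ∀ a → T (S a) → T (S' a)
  ordered-head {S} {S'} {Ss} {Ts} (t , S't) c o a Sa = index-zero {S'} {Ts} (≡.subst (_ ≤_) (index-head {S'} {Ts} S't)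
    (o a t (here Sa) (c t (here S't)) (≡.subst (_≤ index (S ∷ Ss) t) (≡.sym (index-head {S} {Ss} Sa)) z≤n)))

  ordered-tail : ∀ {S S' Ss Ts} → All (Disjoint S) Ss → (∀ a → T (S' a) → T (S a)) →
                 (S ∷ Ss) OrderedLike (S' ∷ Ts) → Ss OrderedLike Ts
  ordered-tail {S} {S'} {Ss} {Ts} d f o a b ca cb le =
    ℕP.≤-pred (≡.subst₂ _≤_ (index-tail {S'} {Ts} (m a ca)) (index-tail {S'} {Ts} (m b cb))
      (o a b (there ca) (there cb) (≡.subst₂ _≤_ (≡.sym (index-tail {S} {Ss} (disjoint⇒∉ d ca)))
        (≡.sym (index-tail {S} {Ss} (disjoint⇒∉ d cb))) (s≤s le))))
    where
    m : ∀ a → Covered Ss a → ¬ T (S' a)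
    m a c p = disjoint⇒∉ d c (f a p)

  covered-tail : ∀ {S S' Ss Ts} → All (Disjoint S) Ss → (∀ a → T (S' a) → T (S a)) →
                 (∀ a → Covered (S ∷ Ss) a → Covered (S' ∷ Ts) a) → ∀ a → Covered Ss a → Covered Ts a
  covered-tail d f c a ca = Covered-tail (λ p → disjoint⇒∉ d ca (f a p)) (c a (there ca))

  -- The first block is the set of elements of least index, so the two preorders, being equal, give
  -- equal heads; removing these leaves the hypotheses intact. An empty block would shift the
  -- indices without changing the preorder, whence `Inhabited`.
  blocks-unique : ∀ {Ss Ts} → All Inhabited Ss → All Inhabited Ts → AllPairs Disjoint Ss → AllPairs Disjoint Ts →
                  (∀ a → Covered Ss a → Covered Ts a) → (∀ a → Covered Ts a → Covered Ss a) →
                  Ss OrderedLike Ts → Ts OrderedLike Ss → Pointwise _≗_ Ss Ts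
  blocks-unique []      []            _ _ _ _ _ _ = []
  blocks-unique []      ((t , p) ∷ _) _ _ _ c _ _ with c t (here p)
  ... | ()
  blocks-unique ((s , p) ∷ _) []      _ _ c _ _ _ with c s (here p)
  ... | ()
  blocks-unique {S ∷ Ss} {S' ∷ Ts} (i ∷ is) (j ∷ js) (d ∷ ds) (e ∷ es) c c' o o' =
    (λ a → T-ext (f a) (g a)) ∷ blocks-unique is js ds es
      (covered-tail d g c) (covered-tail e f c') (ordered-tail d g o) (ordered-tail e f o')
    where
    f = ordered-head {S} {S'} j c' o
    g = ordered-head {S'} {S} i c o'

  -- Both positions are compared through `≲`, which is the same relation for `inner p` and
  -- `inner p'` because they have the same cuts.
  decomposition-unique : ∀ {p p'} → p ≈ₙ p' → (D : Decomposition p) (D' : Decomposition p') →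
    Pointwise _≗_ (blocks (Decomposition.composition D)) (blocks (Decomposition.composition D'))
  decomposition-unique {p} {p'} (_ , e) D D' = blocks-unique
    (nonempty D.composition) (nonempty D'.composition) (disjoint D.composition) (disjoint D'.composition)
    (λ a _ → covering D'.composition a) (λ a _ → covering D.composition a)
    (λ a b _ _ le → D'.≲⇒position (λ C cut → D.position⇒≲ le C (λ i j Ci n → ≡.subst T (≡.sym (e i j)) (cut i j Ci n))))
    (λ a b _ _ le → D.≲⇒position (λ C cut → D'.position⇒≲ le C (λ i j Ci n → ≡.subst T (e i j) (cut i j Ci n))))
    where
    module D = Decomposition D
    module D' = Decomposition D'

  -- Existence of the decomposition into atoms

  cut? : ∀ (P : PO A) (C : Subset A) → Dec (IsCut P C)
  cut? P C = all? A (λ a → all? A (λ b → T? (C a) →-dec ¬? (T? (C b)) →-dec T? (order P a b)))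

  ≲? : ∀ P a b → Dec (P ⊢ a ≲ b)
  ≲? P a b = allSubsets? A
    (λ {C} {C'} e h cut C'b → ≡.subst T (e a)
      (h (λ i j Ci n → cut i j (≡.subst T (e i) Ci) (λ p → n (≡.subst T (≡.sym (e j)) p))) (≡.subst T (≡.sym (e b)) C'b)))
    (λ C → (cut? P C →-dec T? (C b) →-dec T? (C a)))

  -- If b ≲ a fails, some cut contains a but not b and so puts a below b. The cut is never
  -- extracted; as the order is decidable, a contradiction is enough.
  ≴⇒⪯ : ∀ P {a b} → ¬ (P ⊢ b ≲ a) → PO._⪯_ P a b
  ≴⇒⪯ P {a} {b} n = decidable-stable (T? (order P a b))
    (λ a⋠b → n (λ C cut Ca → decidable-stable (T? (C b)) (λ nCb → a⋠b (cut a b Ca nCb))))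

  ≴⇒≲ : ∀ P {a b} → ¬ (P ⊢ b ≲ a) → P ⊢ a ≲ b
  ≴⇒≲ P {a} {b} n = ⪯⇒≲ P (≴⇒⪯ P n) (λ { refl → n (λ _ _ Ca → Ca) })

  module Levels (p : NormalPair A) where

    private
      module E = Inverse (enum A)
      P = inner p

    below : El A → FinSubset.Subset (size A)
    below a = tabulate (λ k → not ⌊ ≲? P a (E.from k) ⌋)

    ∈below⇒ : ∀ {a k} → k FinSubset.∈ below a → ¬ (P ⊢ a ≲ E.from k)
    ∈below⇒ {a} {k} m = toWitnessFalse (Equivalence.from T-≡
      (≡.trans (≡.sym (lookup∘tabulate _ k)) ([]=⇒lookup m)))

    ∈below⇐ : ∀ {a k} → ¬ (P ⊢ a ≲ E.from k) → k FinSubset.∈ below a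
    ∈below⇐ {a} {k} n = lookup⇒[]= k (below a) (≡.trans (lookup∘tabulate _ k) (Equivalence.to T-≡ (fromWitnessFalse n)))

    below-⊆ : ∀ {a b} → P ⊢ a ≲ b → below a FinSubset.⊆ below b
    below-⊆ a≲b m = ∈below⇐ (λ h → ∈below⇒ m (λ C cut Cx → a≲b C cut (h C cut Cx)))

    -- the number of elements in strictly earlier blocks
    rank : El A → ℕ
    rank a = FinSubset.∣ below a ∣

    ≲⇒rank : ∀ {a b} → P ⊢ a ≲ b → rank a ≤ rank b
    ≲⇒rank a≲b = p⊆q⇒∣p∣≤∣q∣ (below-⊆ a≲b)

    -- If a ≲ b fails, then b lies strictly before a, so `below b` is contained in `below a` and
    -- misses b, which `below a` has. Hence the rank of b is strictly smaller.
    rank⇒≲ : ∀ {a b} → rank a ≤ rank b → P ⊢ a ≲ b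
    rank⇒≲ {a} {b} le = decidable-stable (≲? P a b) (λ n → ℕP.<⇒≱ (p⊂q⇒∣p∣<∣q∣
      ( below-⊆ (≴⇒≲ P n)
      , E.to b
      , ∈below⇐ (≡.subst (λ x → ¬ (P ⊢ a ≲ x)) (≡.sym (E.strictlyInverseʳ b)) n)
      , λ m → ∈below⇒ m (≡.subst (P ⊢ b ≲_) (≡.sym (E.strictlyInverseʳ b)) (λ _ _ Cb → Cb)))) le)

    rank-< : ∀ {a b} → rank a < rank b → PO._⪯_ P a b
    rank-< lt = ≴⇒⪯ P (λ b≲a → ℕP.<⇒≱ lt (≲⇒rank b≲a))

    level : ℕ → Subset A
    level s a = ⌊ rank a ℕP.≟ s ⌋

    -- Elements of equal rank lie in the same cuts of `P`, and every cut of a level extends to a cut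
    -- of `P`; so a cut of the level that contains one element contains all.
    level-atom : ∀ s → Inhabited (level s) → Atom (A ↾ level s)
    level-atom s i .pair = restrictPair (level s) p
    level-atom s i .point = i
    level-atom s i .irreducible C cut (a , p) (b , q) Ca =
      [ (λ lt → ⊥-elim (ℕP.<-irrefl (toWitness q) lt)) , (λ (q' , Cb) → ≡.subst (λ q → T (C (b , q))) (T-irrelevant q' q) Cb) ]′
      (toWitness (rank⇒≲ (ℕP.≤-reflexive (≡.trans (toWitness q) (≡.sym (toWitness p)))) (λ x → ⌊ extended? x ⌋) extended-cut
        (fromWitness (inj₂ (p , Ca)))))
      where
      -- a cut of one level becomes a cut of P by adding all the earlier levels
      Extended : El A → Set
      Extended x = rank x < s ⊎ Σ[ q ∈ T (level s x) ] T (C (x , q))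
      extended? : ∀ x → Dec (Extended x)
      extended? x = (rank x ℕP.<? s) ⊎-dec here?
        where
        here? : Dec (Σ[ q ∈ T (level s x) ] T (C (x , q)))
        here? with T? (level s x)
        ... | no n = no (λ (q , _) → n q)
        ... | yes q = Dec.map′ (q ,_) (λ (q' , h) → ≡.subst (λ q → T (C (x , q))) (T-irrelevant q' q) h) (T? (C (x , q)))
      extended-cut : IsCut P (λ x → ⌊ extended? x ⌋)
      extended-cut x y h n with toWitness h | ℕP.<-cmp (rank y) s
      ... | _             | tri< lt _ _ = ⊥-elim (n (fromWitness (inj₁ lt)))
      ... | inj₁ lt       | tri≈ _ e _  = rank-< (ℕP.<-≤-trans lt (ℕP.≤-reflexive (≡.sym e)))
      ... | inj₁ lt       | tri> _ _ gt = rank-< (ℕP.<-trans lt gt)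
      ... | inj₂ (q , Cx) | tri≈ _ e _  = cut (x , q) (y , fromWitness e) Cx (λ Cy → n (fromWitness (inj₂ (fromWitness e , Cy))))
      ... | inj₂ (q , Cx) | tri> _ _ gt = rank-< (ℕP.≤-<-trans (ℕP.≤-reflexive (toWitness q)) gt)

    inhabited? : ∀ s → Dec (Inhabited (level s))
    inhabited? s = any? A (λ a → T? (level s a))

    -- From one block to the next the rank grows by the size of the block, so some values are
    -- skipped. Their levels are empty and must be left out, since the blocks of a set composition
    -- are nonempty.
    levels : ℕ → ℕ → List (Subset A)
    levels s zero    = []
    levels s (suc n) with inhabited? s
    ... | yes _ = level s ∷ levels (suc s) n
    ... | no _  = levels (suc s) n

    levels-nonempty : ∀ s n → All Inhabited (levels s n)
    levels-nonempty s zero = []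
    levels-nonempty s (suc n) with inhabited? s
    ... | yes i = i ∷ levels-nonempty (suc s) n
    ... | no _  = levels-nonempty (suc s) n

    level-disjoint : ∀ {r} s n → r < s → All (Disjoint (level r)) (levels s n)
    level-disjoint s zero lt = []
    level-disjoint s (suc n) lt with inhabited? s
    ... | yes i = (λ a p q → ℕP.<-irrefl (≡.trans (≡.sym (toWitness p)) (toWitness q)) lt) ∷ level-disjoint (suc s) n (ℕP.m<n⇒m<1+n lt)
    ... | no _  = level-disjoint (suc s) n (ℕP.m<n⇒m<1+n lt)

    levels-disjoint : ∀ s n → AllPairs Disjoint (levels s n)
    levels-disjoint s zero = []
    levels-disjoint s (suc n) with inhabited? s
    ... | yes i = level-disjoint (suc s) n (ℕP.n<1+n s) ∷ levels-disjoint (suc s) n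
    ... | no _  = levels-disjoint (suc s) n

    InRange : ℕ → ℕ → El A → Set
    InRange s n a = s ≤ rank a × rank a < s ℕ.+ n

    range-empty : ∀ {s a} → ¬ InRange s 0 a
    range-empty {s} (l , u) = ℕP.<⇒≱ (ℕP.<-≤-trans u (ℕP.≤-reflexive (ℕP.+-identityʳ s))) l

    range-next : ∀ {s n a} → InRange s (suc n) a → rank a ≢ s → InRange (suc s) n a
    range-next {s} {n} (l , u) ne = ℕP.≤∧≢⇒< l (ne ∘ ≡.sym) , ℕP.<-≤-trans u (ℕP.≤-reflexive (ℕP.+-suc s n))

    levels-covering : ∀ s n a → InRange s n a → Covered (levels s n) a
    levels-covering s zero a r = ⊥-elim (range-empty {s} {a} r)
    levels-covering s (suc n) a r with inhabited? s | rank a ℕP.≟ s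
    ... | yes _ | yes e = here (fromWitness e)
    ... | yes _ | no ne = there (levels-covering (suc s) n a (range-next {s} {n} {a} r ne))
    ... | no m  | yes e = ⊥-elim (m (a , fromWitness e))
    ... | no _  | no ne = levels-covering (suc s) n a (range-next {s} {n} {a} r ne)

    level-atoms : ∀ s n → Atoms (levels s n)
    level-atoms s zero = []
    level-atoms s (suc n) with inhabited? s
    ... | yes i = level-atom s i ∷ level-atoms (suc s) n
    ... | no _  = level-atoms (suc s) n

    -- Between levels both sides follow the rank; within a level the atom carries the restriction of
    -- `O`. Any `O` that contains the strict rank order will do, so the lemma serves `inner p` and,
    -- by `part⊆`, also `whole p`.
    stack-levels : (which : ∀ {B} → NormalPair B → PO B) (O : PO A) →
      (∀ s i a b → order (which (pair (level-atom s i))) a b ≡ order O (proj₁ a) (proj₁ b)) →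
      (∀ {a b} → rank a < rank b → PO._⪯_ O a b) →
      ∀ s n a b → InRange s n a → InRange s n b → order O a b ≡ stack (All.map (which ∘ pair) (level-atoms s n)) a b
    stack-levels which O ≗O rank<⇒⪯ s zero a b ra rb = ⊥-elim (range-empty {s} {a} ra)
    stack-levels which O ≗O rank<⇒⪯ s (suc n) a b ra rb with inhabited? s
    ... | no m = stack-levels which O ≗O rank<⇒⪯ (suc s) n a b (range-next {s} {n} {a} ra (λ e → m (a , fromWitness e))) (range-next {s} {n} {b} rb (λ e → m (b , fromWitness e)))
    ... | yes i with T? (level s a) | T? (level s b)
    ...   | yes p | yes q = ≡.sym (≗O s i (a , p) (b , q))
    ...   | yes p | no n' = T-ext (λ _ → tt) (λ _ → rank<⇒⪯ (ℕP.≤-<-trans (ℕP.≤-reflexive (toWitness p)) (proj₁ (range-next {s} {n} {b} rb (λ e → n' (fromWitness e))))))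
    ...   | no n' | yes q = T-ext (λ a⪯b → ℕP.<-irrefl (≡.cong rank (PO.⪯-antisym O (rank<⇒⪯ (b<a n' q)) a⪯b)) (b<a n' q)) ⊥-elim
      where
      b<a : ¬ T (level s a) → T (level s b) → rank b < rank a
      b<a n' q = ℕP.≤-<-trans (ℕP.≤-reflexive (toWitness q)) (proj₁ (range-next {s} {n} {a} ra (λ e → n' (fromWitness e))))
    ...   | no n' | no n'' = stack-levels which O ≗O rank<⇒⪯ (suc s) n a b (range-next {s} {n} {a} ra (λ e → n' (fromWitness e))) (range-next {s} {n} {b} rb (λ e → n'' (fromWitness e)))

    -- A rank is at most `size A`, and the range is half-open, hence the successor.
    bound : ℕ
    bound = suc (size A)

    in-range : ∀ a → InRange 0 bound a
    in-range a = z≤n , s≤s (∣p∣≤n (below a))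

    -- Since decompositions are unique, only the existence of one matters from here on.
    abstract
      decompose : Decomposition p
      decompose .Decomposition.composition = record
        { blocks = levels 0 bound
        ; nonempty = levels-nonempty 0 bound
        ; disjoint = levels-disjoint 0 bound
        ; covering = λ a → levels-covering 0 bound a (in-range a) }
      decompose .Decomposition.atoms = level-atoms 0 bound
      decompose .Decomposition.glued =
          (λ a b → stack-levels whole (whole p) (λ _ _ _ _ → refl) (part⊆ (proj₂ p) ∘ rank-<) 0 bound a b (in-range a) (in-range b))
        , (λ a b → stack-levels inner P (λ _ _ _ _ → refl) rank-< 0 bound a b (in-range a) (in-range b))

-- Vector spaces spanned by generators up to identification, and multilinear maps out of them

module Spans (K : CommutativeRing 0ℓ 0ℓ) where

  private module K = CommutativeRing K
  open LinearAlgebra K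
  open Species K using (linear-∘; linear-id; VectorSpecies)

  data Identify {G : Set} (_~_ : G → G → Set) : Comb G → Comb G → Set where
    identify : ∀ {g h} → g ~ h → Identify _~_ (gen g) (gen h)

  -- The vector space whose basis is the set of classes of the equivalence relation generated by
  -- `_~_`.
  Span : (G : Set) → (G → G → Set) → VectorSpace
  Span G _~_ = Presented (Identify _~_)

  span-resp : ∀ (W : VectorSpace) {G : Set} {_~_ : G → G → Set} {f : G → Vector W} →
              (∀ {g h} → g ~ h → LeftModule._≈ᴹ_ W (f g) (f h)) → Extension.Respects W (Identify _~_) f
  span-resp W r (identify e) = r e

  extend-∘ : ∀ {V W : VectorSpace} {F : Vector V → Vector W} → IsLinear V W F → ∀ {G : Set} (f : G → Vector V) x →
             LeftModule._≈ᴹ_ W (F (Extension.extend V f x)) (Extension.extend W (F ∘ f) x)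
  extend-∘ {V} {W} {F} L f = go
    where
    module W = LeftModule W
    module L = LeftModuleMorphisms.IsLeftModuleHomomorphism L
    go : ∀ x → F (Extension.extend V f x) W.≈ᴹ Extension.extend W (F ∘ f) x
    go 𝟘       = L.0ᴹ-homo
    go (gen g) = W.≈ᴹ-refl
    go (x ⊞ y) = W.≈ᴹ-trans (L.+ᴹ-homo _ _) (W.+ᴹ-cong (go x) (go y))
    go (c ⊡ x) = W.≈ᴹ-trans (L.*ₗ-homo c _) (W.*ₗ-cong K.refl (go x))

  inverse⇒isomorphism : ∀ {V W : VectorSpace} {f : Vector V → Vector W} {g : Vector W → Vector V} →
    IsLinear V W f → IsLinear W V g → (∀ x → LeftModule._≈ᴹ_ V (g (f x)) x) → (∀ y → LeftModule._≈ᴹ_ W (f (g y)) y) →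
    IsLinearIsomorphism V W f
  inverse⇒isomorphism {V} {W} {f} {g} F G gf fg = record
    { isLeftModuleMonomorphism = record
      { isLeftModuleHomomorphism = F
      ; injective = λ {x} {y} e → V.≈ᴹ-trans (V.≈ᴹ-sym (gf x)) (V.≈ᴹ-trans (G.⟦⟧-cong e) (gf y)) }
    ; surjective = λ y → g y , λ e → W.≈ᴹ-trans (F.⟦⟧-cong e) (fg y) }
    where
    module V = LeftModule V
    module W = LeftModule W
    module F = LeftModuleMorphisms.IsLeftModuleHomomorphism F
    module G = LeftModuleMorphisms.IsLeftModuleHomomorphism G

  module Multilinear {I : Set} (V : I → VectorSpace) (W : VectorSpace) where

    private
      module V i = LeftModule (V i)
      module W = LeftModule W

    record IsMultilinear {is : List I} (F : Vectors V is → Vector W) : Set where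
      field
        additive    : ∀ {us vs ws} → AddAt V us vs ws → F us W.≈ᴹ F vs W.+ᴹ F ws
        homogeneous : ∀ {c us vs} → ScaleAt V c us vs → F us W.≈ᴹ c W.*ₗ F vs

    open IsMultilinear public

    -- Congruence comes from homogeneity: `ScaleAt` with the scalar 1 changes an entry up to `≈ᴹ`.
    linear-head : ∀ {i is} {F : Vectors V (i ∷ is) → Vector W} → IsMultilinear F →
                  (∀ {v w vs} → V._≈ᴹ_ i v w → F (v ∷ vs) W.≈ᴹ F (w ∷ vs))
    linear-head {i} {F = F} M {v} {w} {vs} e = W.≈ᴹ-trans
      (homogeneous M {c = K.1#} (here (V.≈ᴹ-trans i e (V.≈ᴹ-sym i (V.*ₗ-identityˡ i w))))) (W.*ₗ-identityˡ _)

    tail-multilinear : ∀ {i is} {F : Vectors V (i ∷ is) → Vector W} → IsMultilinear F → ∀ v → IsMultilinear (λ vs → F (v ∷ vs))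
    tail-multilinear M v .additive p = additive M (there p)
    tail-multilinear M v .homogeneous p = homogeneous M (there p)

    head-linear : ∀ {i is} {F : Vectors V (i ∷ is) → Vector W} → IsMultilinear F → ∀ vs → IsLinear (V i) W (λ v → F (v ∷ vs))
    head-linear {i} M vs = isLinear {V i} {W} (linear-head M) (λ v w → additive M (here (V.≈ᴹ-refl i)))
      (λ c v → homogeneous M (here (V.≈ᴹ-refl i)))

  module MultilinearExtension {I : Set} {G : I → Set} (_~_ : ∀ {i} → G i → G i → Set) (W : VectorSpace) where

    private
      module W = LeftModule W
      V : I → VectorSpace
      V i = Span (G i) _~_
      module V i = LeftModule (V i)

    open Extension W
    open Multilinear V W public

    gens : ∀ {is} → All G is → Vectors V is
    gens = All.map gen

    multi : ∀ {is} → (All G is → Vector W) → Vectors V is → Vector W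
    multi k []       = k []
    multi k (v ∷ vs) = extend (λ g → multi (λ gs → k (g ∷ gs)) vs) v

    multi-gens : ∀ {is} (k : All G is → Vector W) gs → multi k (gens gs) ≡ k gs
    multi-gens k []       = refl
    multi-gens k (g ∷ gs) = multi-gens (λ gs → k (g ∷ gs)) gs

    multilinear-ext : ∀ {is} {F F' : Vectors V is → Vector W} → IsMultilinear F → IsMultilinear F' →
                      (∀ gs → F (gens gs) W.≈ᴹ F' (gens gs)) → ∀ vs → F vs W.≈ᴹ F' vs
    multilinear-ext M M' e []       = e []
    multilinear-ext M M' e (v ∷ vs) = linear-ext (head-linear M vs) (head-linear M' vs)
      (λ g → multilinear-ext (tail-multilinear M (gen g)) (tail-multilinear M' (gen g)) (λ gs → e (g ∷ gs)) vs) v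

    multi-≗ : ∀ {is} {k k' : All G is → Vector W} → (∀ gs → k gs W.≈ᴹ k' gs) → ∀ vs → multi k vs W.≈ᴹ multi k' vs
    multi-≗ e []       = e []
    multi-≗ e (v ∷ vs) = extend-≗ (λ g → multi-≗ (λ gs → e (g ∷ gs)) vs) v

    data _~*_ : ∀ {is} → All G is → All G is → Set where
      []  : [] ~* []
      _∷_ : ∀ {i is} {g h : G i} {gs hs : All G is} → g ~ h → gs ~* hs → (g ∷ gs) ~* (h ∷ hs)

    module _ (~-refl : ∀ {i} {g : G i} → g ~ g) where

      ~*-refl : ∀ {is} {gs : All G is} → gs ~* gs
      ~*-refl {gs = []}     = []
      ~*-refl {gs = g ∷ gs} = ~-refl ∷ ~*-refl

      multi-≋ : ∀ {is} {k : All G is → Vector W} → (∀ {gs hs} → gs ~* hs → k gs W.≈ᴹ k hs) →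
                ∀ {vs ws} → _≋_ V vs ws → multi k vs W.≈ᴹ multi k ws
      multi-≋ r [] = r []
      multi-≋ r (_∷_ {w = w} {vs} {ws} e es) = W.≈ᴹ-trans
        (extend-cong (span-resp W (λ g~h → multi-≗ (λ gs → r (g~h ∷ ~*-refl)) vs)) e)
        (extend-≗ (λ g → multi-≋ (λ h → r (~-refl ∷ h)) es) w)

      multi-multilinear : ∀ {is} {k : All G is → Vector W} → (∀ {gs hs} → gs ~* hs → k gs W.≈ᴹ k hs) → IsMultilinear (multi k)
      multi-multilinear r .additive (here {vs = vs} e) = extend-cong (span-resp W (λ g~h → multi-≗ (λ gs → r (g~h ∷ ~*-refl)) vs)) e
      multi-multilinear r .additive (there {v = v} p) = W.≈ᴹ-trans
        (extend-≗ (λ g → additive (multi-multilinear (λ h → r (~-refl ∷ h))) p) v) (extend-+ _ _ v)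
      multi-multilinear r .homogeneous (here {vs = vs} e) = extend-cong (span-resp W (λ g~h → multi-≗ (λ gs → r (g~h ∷ ~*-refl)) vs)) e
      multi-multilinear r .homogeneous {c} (there {v = v} p) = W.≈ᴹ-trans
        (extend-≗ (λ g → homogeneous (multi-multilinear (λ h → r (~-refl ∷ h))) p) v) (extend-* c _ v)

      multi-linear : ∀ {is} {k : All G is → Vector W} → (∀ {gs hs} → gs ~* hs → k gs W.≈ᴹ k hs) → IsLinear (⨂ V is) W (extend (multi k))
      multi-linear r = extend-linear λ
        { (pure-≋ e) → multi-≋ r e
        ; (pure-+ p) → additive (multi-multilinear r) p
        ; (pure-* p) → homogeneous (multi-multilinear r) p }

  module _ (G : FinSet → Set) (_~_ : ∀ {A} → G A → G A → Set) (act : ∀ {A B} → A ≅ B → G A → G B)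
    (act-resp : ∀ {A B} (σ : A ≅ B) {g h} → g ~ h → act σ g ~ act σ h)
    (act-cong : ∀ {A B} {σ τ : A ≅ B} → to σ ≗ to τ → ∀ g → act σ g ~ act τ g)
    (act-id : ∀ {A} (g : G A) → act (id≅ A) g ~ g)
    (act-∘ : ∀ {A B C} (τ : B ≅ C) (σ : A ≅ B) (g : G A) → act (τ ∘≅ σ) g ~ act τ (act σ g)) where

    private
      S : FinSet → VectorSpace
      S A = Span (G A) _~_

      act* : ∀ {A B} → A ≅ B → Comb (G A) → Comb (G B)
      act* {B = B} σ = Extension.extend (S B) (λ g → gen (act σ g))

      act*-linear : ∀ {A B} (σ : A ≅ B) → IsLinear (S A) (S B) (act* σ)
      act*-linear {B = B} σ = Extension.extend-linear (S B) (span-resp (S B) (λ e → rel (identify (act-resp σ e))))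

    linearization : VectorSpecies
    linearization = record
      { obj = S
      ; transport = act*
      ; transport-linear = act*-linear
      ; transport-cong = λ {A} {B} {σ} {τ} e → Extension.linear-ext (S B) (act*-linear σ) (act*-linear τ)
          (λ g → rel (identify (act-cong {σ = σ} {τ} e g)))
      ; transport-id = λ {A} → Extension.linear-ext (S A) (act*-linear (id≅ A)) (linear-id {S A}) (λ g → rel (identify (act-id g)))
      ; transport-∘ = λ {A} {B} {C} τ σ → Extension.linear-ext (S C) (act*-linear (τ ∘≅ σ))
          (linear-∘ {S A} {S B} {S C} (act*-linear τ) (act*-linear σ)) (λ g → rel (identify (act-∘ τ σ g)))
      }

-- Gluing under change of representatives, relabelling and concatenation

module _ {A : FinSet} where

  -- Blocks that agree only up to `≗` give different types of elements, so the orders are compared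
  -- on the underlying elements of `A`, for all membership proofs.
  SameOrder : ∀ {S S' : Subset A} → PO (A ↾ S) → PO (A ↾ S') → Set
  SameOrder {S} {S'} P P' = ∀ {a b} (p : T (S a)) (q : T (S b)) (p' : T (S' a)) (q' : T (S' b)) →
    order P (a , p) (b , q) ≡ order P' (a , p') (b , q')

  record SameAtom {S S' : Subset A} (g : Atom (A ↾ S)) (h : Atom (A ↾ S')) : Set where
    constructor same-atom
    field
      same-block : S ≗ S'
      same-whole : SameOrder (whole (pair g)) (whole (pair h))
      same-inner : SameOrder (inner (pair g)) (inner (pair h))

  data SameAtoms : ∀ {Ss Ts : List (Subset A)} → Atoms {A} Ss → Atoms {A} Ts → Set where
    []  : SameAtoms [] []
    _∷_ : ∀ {S S' Ss Ts} {g : Atom (A ↾ S)} {h : Atom (A ↾ S')} {gs : Atoms {A} Ss} {hs : Atoms {A} Ts} →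
          SameAtom g h → SameAtoms gs hs → SameAtoms (g ∷ gs) (h ∷ hs)

  same-step : ∀ {S S' : Subset A} {P : PO (A ↾ S)} {P' : PO (A ↾ S')} → S ≗ S' → SameOrder P P' → ∀ {a b r r'} → r ≡ r' →
              stack-step P {a} {b} r (T? (S a)) (T? (S b)) ≡ stack-step P' r' (T? (S' a)) (T? (S' b))
  same-step {S} {S'} e f {a} {b} h with T? (S a) | T? (S' a) | T? (S b) | T? (S' b)
  ... | yes p | yes p' | yes q | yes q' = f p q p' q'
  ... | yes _ | yes _  | no _  | no _   = refl
  ... | no _  | no _   | yes _ | yes _  = refl
  ... | no _  | no _   | no _  | no _   = h
  ... | yes p | no n   | _     | _      = ⊥-elim (n (≡.subst T (e a) p))
  ... | no n  | yes p  | _     | _      = ⊥-elim (n (≡.subst T (≡.sym (e a)) p))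
  ... | _     | _      | yes p | no n   = ⊥-elim (n (≡.subst T (e b) p))
  ... | _     | _      | no n  | yes p  = ⊥-elim (n (≡.subst T (≡.sym (e b)) p))

  same-stack : ∀ {Ss Ts} {gs : Atoms {A} Ss} {hs : Atoms {A} Ts} → SameAtoms gs hs →
               ∀ (a b : El A) → stack (wholes gs) a b ≡ stack (wholes hs) a b × stack (inners gs) a b ≡ stack (inners hs) a b
  same-stack [] a b = refl , refl
  same-stack (_∷_ {g = g} {h} (same-atom e f f') es) a b = same-step {P = whole (pair g)} {whole (pair h)} e f (proj₁ (same-stack es a b))
                                  , same-step {P = inner (pair g)} {inner (pair h)} e f' (proj₂ (same-stack es a b))

  ≈ₐ⇒SameAtom : ∀ {S : Subset A} {g h : Atom (A ↾ S)} → g ≈ₐ h → SameAtom g h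
  ≈ₐ⇒SameAtom {S} {g} {h} (atom-≈ (e , f)) = same-atom (λ _ → refl) (by (whole (pair g)) (whole (pair h)) e) (by (inner (pair g)) (inner (pair h)) f)
    where
    by : ∀ P P' → P ≗ᴾ P' → SameOrder P P'
    by P P' e p q p' q' = ≡.trans (e _ _) (≡.cong₂ (λ x y → order P' (_ , x) (_ , y)) (T-irrelevant p p') (T-irrelevant q q'))

  ↾-cong-SameAtom : ∀ {S S' : Subset A} (e : S ≗ S') (g : Atom (A ↾ S)) → SameAtom g (imageAtom (↾-cong {A} e) g)
  ↾-cong-SameAtom {S} {S'} e g = same-atom e (by (whole (pair g))) (by (inner (pair g)))
    where
    by : ∀ P → SameOrder P (imagePO (↾-cong {A} e) P)
    by P p q p' q' = ≡.cong₂ (λ x y → order P (_ , x) (_ , y)) (T-irrelevant p _) (T-irrelevant q _)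

module PushAtoms {A B : FinSet} (f : Subset A → Subset B) (σ : ∀ S → A ↾ S ≅ B ↾ f S) where

  pushAtoms : ∀ {Ss} → Atoms {A} Ss → Atoms {B} (map f Ss)
  pushAtoms []             = []
  pushAtoms (_∷_ {S} g gs) = imageAtom (σ S) g ∷ pushAtoms gs

-- Stacking treats `whole` and `inner` alike; with this tag one induction covers both.
data Side : Set where
  outside inside : Side

side : ∀ {A} → Side → NormalPair A → PO A
side outside = whole
side inside  = inner

image-side : ∀ {A B} s (σ : A ≅ B) p i j → order (side s (imagePair σ p)) i j ≡ order (side s p) (from σ i) (from σ j)
image-side outside σ p i j = refl
image-side inside  σ p i j = refl

sideStack : ∀ {A} → Side → ∀ {Ss} → Atoms {A} Ss → El A → El A → Bool
sideStack s gs = stack (All.map (side s ∘ pair) gs)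

module _ {A B : FinSet} (σ : A ≅ B) where

  open PushAtoms {A} {B} (image σ) (image-≅ σ)

  stack-image : ∀ s {Ss} (gs : Atoms {A} Ss) b b' → sideStack s (pushAtoms gs) b b' ≡ sideStack s gs (from σ b) (from σ b')
  stack-image s []             b b' = refl
  stack-image s (_∷_ {S} g gs) b b' with T? (S (from σ b)) | T? (S (from σ b'))
  ... | yes p | yes q = image-side s (image-≅ σ S) (pair g) _ _
  ... | yes _ | no _  = refl
  ... | no _  | yes _ = refl
  ... | no _  | no _  = stack-image s gs b b'

module _ {A B : FinSet} where

  private
    module L = PushAtoms {A} {A ⊔ B} (inl A B) (inl-≅ A B)
    module R = PushAtoms {B} {A ⊔ B} (inr A B) (inr-≅ A B)

  concatAtoms : ∀ {Ss Ts} → Atoms {A} Ss → Atoms {B} Ts → Atoms {A ⊔ B} (map (inl A B) Ss ++ map (inr A B) Ts)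
  concatAtoms gs hs = AllP.++⁺ (L.pushAtoms gs) (R.pushAtoms hs)

  stack-inl-inl : ∀ s {Ss Ts} (gs : Atoms {A} Ss) (hs : Atoms {B} Ts) a a' →
                  sideStack s (concatAtoms gs hs) (inj₁ a) (inj₁ a') ≡ sideStack s gs a a'
  stack-inl-inl s []             []       a a' = refl
  stack-inl-inl s []             (h ∷ hs) a a' = stack-inl-inl s [] hs a a'
  stack-inl-inl s (_∷_ {S} g gs) hs       a a' with T? (S a) | T? (S a')
  ... | yes p | yes q = image-side s (inl-≅ A B S) (pair g) _ _
  ... | yes _ | no _  = refl
  ... | no _  | yes _ = refl
  ... | no _  | no _  = stack-inl-inl s gs hs a a'

  stack-inl-inr : ∀ s {Ss Ts} (gs : Atoms {A} Ss) (hs : Atoms {B} Ts) a b → Covered {A} Ss a →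
                  sideStack s (concatAtoms gs hs) (inj₁ a) (inj₂ b) ≡ true
  stack-inl-inr s (_∷_ {S} g gs) hs a b c with T? (S a)
  ... | yes _ = refl
  ... | no n  = stack-inl-inr s gs hs a b (Covered-tail {A} n c)

  stack-inr-inl : ∀ s {Ss Ts} (gs : Atoms {A} Ss) (hs : Atoms {B} Ts) b a → Covered {A} Ss a →
                  sideStack s (concatAtoms gs hs) (inj₂ b) (inj₁ a) ≡ false
  stack-inr-inl s (_∷_ {S} g gs) hs b a c with T? (S a)
  ... | yes _ = refl
  ... | no n  = stack-inr-inl s gs hs b a (Covered-tail {A} n c)

  stack-inr-inr : ∀ s {Ss Ts} (gs : Atoms {A} Ss) (hs : Atoms {B} Ts) b b' →
                  sideStack s (concatAtoms gs hs) (inj₂ b) (inj₂ b') ≡ sideStack s hs b b'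
  stack-inr-inr s (g ∷ gs) hs             b b' = stack-inr-inr s gs hs b b'
  stack-inr-inr s []       []             b b' = refl
  stack-inr-inr s []       (_∷_ {S} h hs) b b' with T? (S b) | T? (S b')
  ... | yes p | yes q = image-side s (inr-≅ A B S) (pair h) _ _
  ... | yes _ | no _  = refl
  ... | no _  | yes _ = refl
  ... | no _  | no _  = stack-inr-inr s [] hs b b'

glue-image : ∀ {A B} (σ : A ≅ B) (α : SetComposition A) (gs : Atoms (blocks α)) →
             glue (covering (image-composition σ α)) (PushAtoms.pushAtoms (image σ) (image-≅ σ) gs) ≈ₙ imagePair σ (glue (covering α) gs)
glue-image σ α gs = stack-image σ outside gs , stack-image σ inside gs

glue-concat : ∀ {A B} (α : SetComposition A) (β : SetComposition B) (gs : Atoms (blocks α)) (hs : Atoms (blocks β)) →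
              glue (covering (α ⋅ β)) (concatAtoms gs hs) ≈ₙ glue (covering α) gs ∙ₙ glue (covering β) hs
glue-concat {A} {B} α β gs hs =
    (λ { (inj₁ a) (inj₁ a') → stack-inl-inl outside gs hs a a'
       ; (inj₁ a) (inj₂ b)  → stack-inl-inr outside gs hs a b (covering α a)
       ; (inj₂ b) (inj₁ a)  → stack-inr-inl outside gs hs b a (covering α a)
       ; (inj₂ b) (inj₂ b') → stack-inr-inr outside gs hs b b' })
  , (λ { (inj₁ a) (inj₁ a') → stack-inl-inl inside gs hs a a'
       ; (inj₁ a) (inj₂ b)  → stack-inl-inr inside gs hs a b (covering α a)
       ; (inj₂ b) (inj₁ a)  → stack-inr-inl inside gs hs b a (covering α a)
       ; (inj₂ b) (inj₂ b') → stack-inr-inr inside gs hs b b' })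

-- The free monoid on the atoms is spanned by the normal pairs

module FreeOnAtoms (K : CommutativeRing 0ℓ 0ℓ) where

  private module K = CommutativeRing K
  open LinearAlgebra K
  open Species K
  open Spans K

  atomSpecies : VectorSpecies
  atomSpecies = linearization Atom _≈ₐ_ imageAtom (λ σ (atom-≈ e) → atom-≈ (imagePair-resp σ e))
    (λ {A} {B} {σ} {τ} e g → atom-≈ (imagePair-cong {σ = σ} {τ} e (pair g)))
    (λ g → atom-≈ ((λ _ _ → refl) , (λ _ _ → refl))) (λ τ σ g → atom-≈ ((λ _ _ → refl) , (λ _ _ → refl)))

  atomSpecies-vanishes : VanishesAt∅ atomSpecies
  atomSpecies-vanishes = Extension.linear-ext V (linear-id {V})
    (isLinear {V} {V} (λ _ → V.≈ᴹ-refl) (λ _ _ → V.≈ᴹ-sym (V.+ᴹ-identityˡ _)) (λ c _ → V.≈ᴹ-sym (V.*ₗ-zeroʳ c)))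
    (λ g → ⊥-elim (point g))
    where
    V = VectorSpecies.obj atomSpecies ∅
    module V = LeftModule V

  open Free atomSpecies

  pairs : FinSet → VectorSpace
  pairs A = Span (NormalPair A) _≈ₙ_

  identifyPairs : ∀ {A} {p p' : NormalPair A} → p ≈ₙ p' → LeftModule._≈ᴹ_ (pairs A) (gen p) (gen p')
  identifyPairs e = rel (identify e)

  module _ {A : FinSet} where

    private
      module P = LeftModule (pairs A)
      module M = MultilinearExtension {I = Subset A} {G = λ S → Atom (A ↾ S)} _≈ₐ_

    atomTuple : ∀ {Ss} → Atoms {A} Ss → Tuple A Ss
    atomTuple = All.map gen

    -- This makes gluing well defined on `SameTensor`. In each slot the two vectors agree after
    -- transport along `↾-cong e`. Moving the transport from the vector to the function turns the
    -- claim into one about an atom and its image, which are related by `SameAtom`.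
    multi-same : (W : VectorSpace) (let open LeftModule W) → ∀ {Ss Ts} {k : Atoms {A} Ss → Vector W} {k' : Atoms {A} Ts → Vector W} →
                 (∀ {gs hs} → SameAtoms gs hs → k gs ≈ᴹ k' hs) → (∀ {gs hs} → SameAtoms gs hs → k' gs ≈ᴹ k' hs) →
                 ∀ {vs ws} → SameTuple vs ws → M.multi W k vs ≈ᴹ M.multi W k' ws
    multi-same W r r' [] = r []
    multi-same W {k = k} {k'} r r' (_∷_ {S} {S'} {v = v} {w} {vs} {ws} (e , v~w) es) = ≈ᴹ-trans
      (extend-≗ (λ g → multi-same W (λ h → r (↾-cong-SameAtom e g ∷ h)) (λ h → r' (same g ∷ h)) es) v)
      (≈ᴹ-trans (≈ᴹ-sym (extend-∘ {VectorSpecies.obj atomSpecies (A ↾ S')} {W} (extend-linear resp) (λ g → gen (imageAtom (↾-cong {A} e) g)) v))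
        (extend-cong resp v~w))
      where
      open LeftModule W
      open Extension W
      same : ∀ g → SameAtom (imageAtom (↾-cong {A} e) g) (imageAtom (↾-cong {A} e) g)
      same g = ≈ₐ⇒SameAtom ≈ₐ-refl
      ≈ₐ⇒SameAtoms : ∀ {Ts} {gs hs : Atoms {A} Ts} → M._~*_ W gs hs → SameAtoms gs hs
      ≈ₐ⇒SameAtoms M.[] = []
      ≈ₐ⇒SameAtoms (p M.∷ ps) = ≈ₐ⇒SameAtom p ∷ ≈ₐ⇒SameAtoms ps
      resp : Respects (Identify _≈ₐ_) (λ g → M.multi W (λ gs → k' (g ∷ gs)) ws)
      resp = span-resp W (λ g~h → M.multi-≗ W (λ gs → r' (≈ₐ⇒SameAtom g~h ∷ ≈ₐ⇒SameAtoms (M.~*-refl W ≈ₐ-refl {gs = gs}))) ws)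

    open MultilinearExtension {I = Subset A} {G = λ S → Atom (A ↾ S)} _≈ₐ_ (pairs A) using (multi; multi-gens; multi-linear; _~*_; []; _∷_)

    ~*⇒SameAtoms : ∀ {Ss} {gs hs : Atoms {A} Ss} → gs ~* hs → SameAtoms gs hs
    ~*⇒SameAtoms [] = []
    ~*⇒SameAtoms (p ∷ ps) = ≈ₐ⇒SameAtom p ∷ ~*⇒SameAtoms ps

    glued : (α : SetComposition A) → Atoms {A} (blocks α) → Vector (pairs A)
    glued α gs = gen (glue (covering α) gs)

    glued-same : ∀ (α β : SetComposition A) {gs : Atoms {A} (blocks α)} {hs : Atoms {A} (blocks β)} → SameAtoms gs hs → glued α gs P.≈ᴹ glued β hs
    glued-same α β e = identifyPairs ((λ a b → proj₁ (same-stack e a b)) , (λ a b → proj₂ (same-stack e a b)))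

    glueTensor : (α : SetComposition A) → Vector (Tensor A α) → Vector (pairs A)
    glueTensor α = Extension.extend (pairs A) (multi (glued α))

    glueTensor-linear : ∀ α → IsLinear (Tensor A α) (pairs A) (glueTensor α)
    glueTensor-linear α = multi-linear ≈ₐ-refl (λ e → glued-same α α (~*⇒SameAtoms e))

    glueMap : Vector (freeObj A) → Vector (pairs A)
    glueMap = Extension.extend (pairs A) (λ (α , t) → glueTensor α t)

    glueMap-linear : IsLinear (freeObj A) (pairs A) glueMap
    glueMap-linear = Extension.extend-linear (pairs A) (⨁-respects _ _ (pairs A) glueTensor glueTensor-linear
      (λ { (same-pure {α} {β} e) → multi-same (pairs A) (glued-same α β) (glued-same β β) e }))

    glueMap-pure : ∀ α gs → glueMap (pure α (atomTuple gs)) ≡ glued α gs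
    glueMap-pure α gs = multi-gens (glued α) gs

    free-atom-ext : (W : VectorSpace) {f g : Vector (freeObj A) → Vector W} → IsLinear (freeObj A) W f → IsLinear (freeObj A) W g →
      (∀ α gs → LeftModule._≈ᴹ_ W (f (pure α (atomTuple gs))) (g (pure α (atomTuple gs)))) → ∀ x → LeftModule._≈ᴹ_ W (f x) (g x)
    free-atom-ext W {f} {g} Lf Lg e = free-ext W Lf Lg (λ α → M.multilinear-ext W (pure-multilinear Lf α) (pure-multilinear Lg α) (e α))
      where
      module W = LeftModule W
      pure-multilinear : ∀ {f} → IsLinear (freeObj A) W f → ∀ α → M.IsMultilinear W (λ vs → f (pure α vs))
      pure-multilinear L α = record
        { additive = λ p → W.≈ᴹ-trans (L.⟦⟧-cong (≈-trans (rel (inj-≈ (rel (pure-+ p)))) (rel (inj-+ _ _)))) (L.+ᴹ-homo _ _)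
        ; homogeneous = λ p → W.≈ᴹ-trans (L.⟦⟧-cong (≈-trans (rel (inj-≈ (rel (pure-* p)))) (rel (inj-* _ _)))) (L.*ₗ-homo _ _) }
        where module L = LeftModuleMorphisms.IsLeftModuleHomomorphism L

    -- An atom of a decomposition is the restriction of the glued pair to its block, so equal blocks
    -- of equal pairs carry equal atoms.
    same-atomTuple : ∀ {p p'} → p ≈ₙ p' → ∀ {Ss Ts} {gs : Atoms {A} Ss} {hs : Atoms {A} Ts} → Pointwise _≗_ Ss Ts →
                     Restricts p gs → Restricts p' hs → SameTuple (atomTuple gs) (atomTuple hs)
    same-atomTuple (f , f') [] [] [] = []
    same-atomTuple (f , f') (e ∷ es) ((r , r') ∷ rs) ((s , s') ∷ ss) =
      (e , rel (identify (atom-≈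
        ( (λ (a , p) (b , q) → ≡.trans (≡.sym (r _ _)) (≡.trans (f a b) (s (a , p) (b , q))))
        , (λ (a , p) (b , q) → ≡.trans (≡.sym (r' _ _)) (≡.trans (f' a b) (s' (a , p) (b , q))))))))
      ∷ same-atomTuple (f , f') es rs ss

    factor : ∀ {p : NormalPair A} → Decomposition p → Vector (freeObj A)
    factor D = pure (Decomposition.composition D) (atomTuple (Decomposition.atoms D))

    factor-unique : ∀ {p p' : NormalPair A} → p ≈ₙ p' → (D : Decomposition p) (D' : Decomposition p') →
                    LeftModule._≈ᴹ_ (freeObj A) (factor D) (factor D')
    factor-unique e D D' = pure-same {α = Decomposition.composition D} {Decomposition.composition D'}
      (same-atomTuple e (decomposition-unique e D D') (Decomposition.restrictions D) (Decomposition.restrictions D'))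

    factorMap : Vector (pairs A) → Vector (freeObj A)
    factorMap = Extension.extend (freeObj A) (λ p → factor (Levels.decompose p))

    factorMap-linear : IsLinear (pairs A) (freeObj A) factorMap
    factorMap-linear = Extension.extend-linear (freeObj A) (span-resp (freeObj A) (λ {p} {p'} e → factor-unique e (Levels.decompose p) (Levels.decompose p')))

    glue-factor : ∀ x → glueMap (factorMap x) P.≈ᴹ x
    glue-factor = Extension.linear-ext (pairs A) (linear-∘ {pairs A} {freeObj A} {pairs A} glueMap-linear factorMap-linear) (linear-id {pairs A})
      (λ p → let open Decomposition (Levels.decompose p) hiding (glued) in P.≈ᴹ-trans (P.≈ᴹ-reflexive (glueMap-pure composition atoms))
        (identifyPairs (≈ₙ-sym {p = p} (Decomposition.glued (Levels.decompose p)))))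

    -- The pair glued from `gs` has two decompositions, the computed one and the one it was glued
    -- from; uniqueness identifies their tensors.
    factor-glue : ∀ x → LeftModule._≈ᴹ_ (freeObj A) (factorMap (glueMap x)) x
    factor-glue = free-atom-ext (freeObj A) (linear-∘ {freeObj A} {pairs A} {freeObj A} factorMap-linear glueMap-linear) (linear-id {freeObj A})
      (λ α gs → F.≈ᴹ-trans (F.≈ᴹ-reflexive (≡.cong factorMap (glueMap-pure α gs)))
        (factor-unique ≈ₙ-refl (Levels.decompose (glue (covering α) gs))
          (record { composition = α ; atoms = gs ; glued = ≈ₙ-refl {p = glue (covering α) gs} })))
      where module F = LeftModule (freeObj A)

  pairsTransport : ∀ {A B} → A ≅ B → Vector (pairs A) → Vector (pairs B)
  pairsTransport {B = B} σ = Extension.extend (pairs B) (λ p → gen (imagePair σ p))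

  pairsTransport-linear : ∀ {A B} (σ : A ≅ B) → IsLinear (pairs A) (pairs B) (pairsTransport σ)
  pairsTransport-linear {B = B} σ = Extension.extend-linear (pairs B)
    (span-resp (pairs B) (λ {p} {p'} e → identifyPairs (imagePair-resp σ {p} {p'} e)))

  push-atomTuple : ∀ {A B} (f : Subset A → Subset B) (σ : ∀ S → A ↾ S ≅ B ↾ f S) {Ss} (gs : Atoms {A} Ss) →
                   Push.push f σ (atomTuple gs) ≡ atomTuple (PushAtoms.pushAtoms f σ gs)
  push-atomTuple f σ []       = refl
  push-atomTuple f σ (g ∷ gs) = ≡.cong (_ ∷_) (push-atomTuple f σ gs)

  ++-atomTuple : ∀ {A Ss Ts} (gs : Atoms {A} Ss) (hs : Atoms {A} Ts) →
                 AllP.++⁺ (atomTuple gs) (atomTuple hs) ≡ atomTuple (AllP.++⁺ gs hs)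
  ++-atomTuple []       hs = refl
  ++-atomTuple (g ∷ gs) hs = ≡.cong (_ ∷_) (++-atomTuple gs hs)

  glueMap-natural : ∀ {A B} (σ : A ≅ B) x → LeftModule._≈ᴹ_ (pairs B) (glueMap (freeTransport σ x)) (pairsTransport σ (glueMap x))
  glueMap-natural {A} {B} σ = free-atom-ext (pairs B)
    (linear-∘ {freeObj A} {freeObj B} {pairs B} glueMap-linear (freeTransport-linear σ))
    (linear-∘ {freeObj A} {pairs A} {pairs B} (pairsTransport-linear σ) glueMap-linear)
    (λ α gs → P.≈ᴹ-trans
      (P.≈ᴹ-reflexive (≡.trans (≡.cong (λ vs → glueMap (pure (image-composition σ α) vs)) (push-atomTuple (image σ) (image-≅ σ) gs))
        (glueMap-pure (image-composition σ α) _)))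
      (P.≈ᴹ-trans (identifyPairs (glue-image σ α gs)) (P.≈ᴹ-reflexive (≡.cong (pairsTransport σ) (≡.sym (glueMap-pure α gs))))))
    where module P = LeftModule (pairs B)

  module _ {A B : FinSet} where

    private
      W = pairs (A ⊔ B)
      module W = LeftModule W

    pairsMult : Vector (pairs A) → Vector (pairs B) → Vector (pairs (A ⊔ B))
    pairsMult = Extension.extend₂ W (λ p p' → gen (p ∙ₙ p'))

    pairsMult-bilinear : IsBilinear (pairs A) (pairs B) W pairsMult
    pairsMult-bilinear = Extension.extend₂-bilinear W _
      (λ p' → span-resp W (λ {p} {p''} (e , f) → identifyPairs {p = p ∙ₙ p'} {p'' ∙ₙ p'} (∙-cong e (λ _ _ → refl) , ∙-cong f (λ _ _ → refl))))
      (λ p → span-resp W (λ {p'} {p''} (e , f) → identifyPairs {p = p ∙ₙ p'} {p ∙ₙ p''} (∙-cong (λ _ _ → refl) e , ∙-cong (λ _ _ → refl) f)))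
      where
      ∙-cong : ∀ {P P' : PO A} {Q Q' : PO B} → P ≗ᴾ P' → Q ≗ᴾ Q' → P ∙ Q ≗ᴾ P' ∙ Q'
      ∙-cong e f (inj₁ i) (inj₁ j) = e i j
      ∙-cong e f (inj₁ i) (inj₂ j) = refl
      ∙-cong e f (inj₂ i) (inj₁ j) = refl
      ∙-cong e f (inj₂ i) (inj₂ j) = f i j

    private
      module PM = IsBilinear pairsMult-bilinear
      module FM = IsBilinear (freeMult-bilinear {A} {B})

    glueMap-mult : ∀ x y → glueMap (freeMult x y) W.≈ᴹ pairsMult (glueMap x) (glueMap y)
    glueMap-mult x y = free-atom-ext W
      (linear-∘ {freeObj A} {freeObj (A ⊔ B)} {W} glueMap-linear (FM.linearˡ y))
      (linear-∘ {freeObj A} {pairs A} {W} (PM.linearˡ (glueMap y)) glueMap-linear)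
      (λ α gs → free-atom-ext W
        (linear-∘ {freeObj B} {freeObj (A ⊔ B)} {W} glueMap-linear (FM.linearʳ (pure α (atomTuple gs))))
        (linear-∘ {freeObj B} {pairs B} {W} (PM.linearʳ (glueMap (pure α (atomTuple gs)))) glueMap-linear)
        (λ β hs → W.≈ᴹ-trans
          (W.≈ᴹ-reflexive (≡.trans (≡.cong (λ vs → glueMap (pure (α ⋅ β) vs)) (concat-atomTuple gs hs)) (glueMap-pure (α ⋅ β) _)))
          (W.≈ᴹ-trans (identifyPairs (glue-concat α β gs hs))
            (W.≈ᴹ-reflexive (≡.sym (≡.cong₂ pairsMult (glueMap-pure α gs) (glueMap-pure β hs)))))) y) x
      where
      concat-atomTuple : ∀ {Ss Ts} (gs : Atoms {A} Ss) (hs : Atoms {B} Ts) →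
                         concatTuple (atomTuple gs) (atomTuple hs) ≡ atomTuple (concatAtoms gs hs)
      concat-atomTuple gs hs = ≡.trans
        (≡.cong₂ AllP.++⁺ (push-atomTuple (inl A B) (inl-≅ A B) gs) (push-atomTuple (inr A B) (inr-≅ A B) hs))
        (++-atomTuple {A ⊔ B} (PushAtoms.pushAtoms (inl A B) (inl-≅ A B) gs) _)

-- Intervals and inclusion-exclusion

Interval : FinSet → Set
Interval A = El A × El A

-- All pairs of elements, so that the list does not depend on the order `R` and the expansion has
-- the same shape over equal posets. If a and b are equal or a ⪯ b fails, the function z of the pair
-- is constantly 1.
intervals : ∀ A → List (Interval A)
intervals A = cartesianProduct (map E.from (allFin (size A))) (map E.from (allFin (size A)))
  where module E = Inverse (enum A)

∈-intervals : ∀ A e → e ∈ intervals A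
∈-intervals A (a , b) = ∈P.∈-cartesianProduct⁺ (element a) (element b)
  where
  module E = Inverse (enum A)
  element : ∀ a → a ∈ map E.from (allFin (size A))
  element a = ≡.subst (_∈ map E.from (allFin (size A))) (E.strictlyInverseʳ a) (∈P.∈-map⁺ E.from (∈P.∈-allFin (E.to a)))

module Selection {X : Set} {P : X → Set} (P? : ∀ x → Dec (P x)) where

  -- The accumulator mirrors the way `expand` conses intervals onto its lists, so that the term that
  -- survives there is literally the selected list.
  select : List X → List X → List X
  select []       acc = acc
  select (x ∷ xs) acc with P? x
  ... | yes _ = select xs (x ∷ acc)
  ... | no _  = select xs acc

  ∈-select⁺-acc : ∀ xs {acc x} → x ∈ acc → x ∈ select xs acc
  ∈-select⁺-acc []       m = m
  ∈-select⁺-acc (x ∷ xs) m with P? x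
  ... | yes _ = ∈-select⁺-acc xs (there m)
  ... | no _  = ∈-select⁺-acc xs m

  ∈-select⁺ : ∀ xs {acc x} → x ∈ xs → P x → x ∈ select xs acc
  ∈-select⁺ (x ∷ xs) (here refl) p with P? x
  ... | yes _ = ∈-select⁺-acc xs (here refl)
  ... | no n  = ⊥-elim (n p)
  ∈-select⁺ (x ∷ xs) (there m) p with P? x
  ... | yes _ = ∈-select⁺ xs m p
  ... | no _  = ∈-select⁺ xs m p

  select-All : ∀ xs {acc} → All P acc → All P (select xs acc)
  select-All []       h = h
  select-All (x ∷ xs) h with P? x
  ... | yes p = select-All xs (p ∷ h)
  ... | no _  = select-All xs h

-- Indicators of normal pattern subgroups as a morphism of monoids

module Indicators (K : CommutativeRing 0ℓ 0ℓ) {q : ℕ} (𝔽 : FiniteField q) where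

  private
    module K = CommutativeRing K
    module 𝔽 = FiniteField 𝔽
  open LinearAlgebra K
  open Species K using (linear-∘; linear-id)
  open Spans K
  open FreeOnAtoms K
  open PatternGroups 𝔽 renaming (_∈_ to _∈ᵁ_)
  open PatternMonoid K 𝔽
  open 𝔽 using () renaming (_≈_ to _≈ꟳ_; 0# to 0ꟳ; 1# to 1ꟳ)

  module _ {A : FinSet} {R : PO A} where

    asSubposet : NormalPart R → Subposet R
    asSubposet N = record { poset = part N ; subset = part⊆ N }

    asNPtt : NormalPart R → NPtt R
    asNPtt N = record { subposet = asSubposet N ; normal = Blocks.closed⇒normal {Q = asSubposet N} (closed N) }

    infix 4 _∈ₙ_

    _∈ₙ_ : UT R → NormalPart R → Set
    u ∈ₙ N = u ∈ᵁ asSubposet N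

    ∈ₙ⇒ : ∀ N {u} → u ∈ₙ N → ∀ i j → ¬ PO._⪯_ (part N) i j → ext u i j ≈ꟳ 0ꟳ
    ∈ₙ⇒ N = Blocks.∈⇒ (asSubposet N)

    ∈ₙ⇐ : ∀ N {u} → (∀ i j → ¬ PO._⪯_ (part N) i j → ext u i j ≈ꟳ 0ꟳ) → u ∈ₙ N
    ∈ₙ⇐ N = Blocks.∈⇐ (asSubposet N)

    abstract

      χ : NormalPart R → UT R → K.Carrier
      χ N u = if ⌊ Blocks._∈?_ u (asSubposet N) ⌋ then K.1# else K.0#

      ∈ₙ? : ∀ u N → Dec (u ∈ₙ N)
      ∈ₙ? u N = Blocks._∈?_ u (asSubposet N)

      χ-in : ∀ {N u} → u ∈ₙ N → χ N u K.≈ K.1#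
      χ-in {N} {u} m with Blocks._∈?_ u (asSubposet N)
      ... | yes _ = K.refl
      ... | no n  = ⊥-elim (n m)

      χ-out : ∀ {N u} → ¬ (u ∈ₙ N) → χ N u K.≈ K.0#
      χ-out {N} {u} n with Blocks._∈?_ u (asSubposet N)
      ... | yes m = ⊥-elim (n m)
      ... | no _  = K.refl

  χ-cong : ∀ {A B} {R : PO A} {S : PO B} {N : NormalPart R} {M : NormalPart S} {u v} →
           (u ∈ₙ N → v ∈ₙ M) → (v ∈ₙ M → u ∈ₙ N) → χ N u K.≈ χ M v
  χ-cong {N = N} {M} {u} {v} f g with ∈ₙ? u N
  ... | yes m = K.trans (χ-in m) (K.sym (χ-in (f m)))
  ... | no n  = K.trans (χ-out n) (K.sym (χ-out (n ∘ g)))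

  χ-* : ∀ {A B C} {R : PO A} {S : PO B} {Q : PO C} {L : NormalPart R} {M : NormalPart S} {N : NormalPart Q} {u v w} →
        (w ∈ₙ N → u ∈ₙ L × v ∈ₙ M) → (u ∈ₙ L → v ∈ₙ M → w ∈ₙ N) → χ N w K.≈ χ L u K.* χ M v
  χ-* {L = L} {M} {u = u} {v} f g with ∈ₙ? u L | ∈ₙ? v M
  ... | yes l | yes m = K.trans (χ-in (g l m)) (K.sym (K.trans (K.*-cong (χ-in l) (χ-in m)) (K.*-identityˡ _)))
  ... | no n  | _     = K.trans (χ-out (n ∘ proj₁ ∘ f)) (K.sym (K.trans (K.*-congʳ (χ-out n)) (K.zeroˡ _)))
  ... | _     | no n  = K.trans (χ-out (n ∘ proj₂ ∘ f)) (K.sym (K.trans (K.*-congˡ (χ-out n)) (K.zeroʳ _)))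

  -- Elements of one block of Cl(R) lie in the same normal pattern subgroups.
  indicator : ∀ {A} {R : PO A} → NormalPart R → ClassFunction R
  indicator N .value = χ N
  indicator N .constant s = let (f , g) = Blocks.same-block⇒≃ s (asNPtt N) in χ-cong f g

  SameEntries-ext : ∀ {A} {R S : PO A} (u : UT R) (v : UT S) → R ≗ᴾ S → SameEntries u v → ∀ i j → ext u i j ≈ꟳ ext v i j
  SameEntries-ext {R = R} {S} u v e h i j with T? (order R i j)
  ... | yes p = 𝔽.trans (ext-in u i j p) (𝔽.trans (h i j p (≡.subst T (e i j) p)) (𝔽.sym (ext-in v i j (≡.subst T (e i j) p))))
  ... | no n  = 𝔽.trans (ext-out u i j n) (𝔽.sym (ext-out v i j (λ p → n (≡.subst T (≡.sym (e i j)) p))))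

  indicator-resp : ∀ {A} {p p' : NormalPair A} → p ≈ₙ p' → SameFunction (indicator (proj₂ p)) (indicator (proj₂ p'))
  indicator-resp {A} {R , N} {R' , N'} (e , f) = e , λ u v h → χ-cong
    (λ m → ∈ₙ⇐ N' (λ i j n → 𝔽.trans (𝔽.sym (SameEntries-ext u v e h i j)) (∈ₙ⇒ N m i j (λ p → n (≡.subst T (f i j) p)))))
    (λ m → ∈ₙ⇐ N (λ i j n → 𝔽.trans (SameEntries-ext u v e h i j) (∈ₙ⇒ N' m i j (λ p → n (≡.subst T (≡.sym (f i j)) p)))))

  module _ {A : FinSet} where

    indicatorMap : Vector (pairs A) → Vector (pttObj A)
    indicatorMap = Extension.extend (pttObj A) (λ (R , N) → gen (R , indicator N))

    indicatorMap-linear : IsLinear (pairs A) (pttObj A) indicatorMap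
    indicatorMap-linear = Extension.extend-linear (pttObj A)
      (span-resp (pttObj A) (λ {p} {p'} e → rel (inj-∼ (indicator-resp {p = p} {p'} e))))

  indicatorMap-natural : ∀ {A B} (σ : A ≅ B) x →
    LeftModule._≈ᴹ_ (pttObj B) (indicatorMap (pairsTransport σ x)) (pttTransport σ (indicatorMap x))
  indicatorMap-natural {A} {B} σ = Extension.linear-ext (pttObj B)
    (linear-∘ {pairs A} {pairs B} {pttObj B} indicatorMap-linear (pairsTransport-linear σ))
    (linear-∘ {pairs A} {pttObj A} {pttObj B} (pttTransport-linear σ) indicatorMap-linear)
    (λ (R , N) → rel (inj-≈ (λ u → χ-cong (down u N) (up u N))))
    where
    module _ {R : PO A} (u : UT (imagePO σ R)) (N : NormalPart R) where
      σN = proj₂ (imagePair σ (R , N))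
      down : u ∈ₙ σN → pull σ u ∈ₙ N
      down m = ∈ₙ⇐ N λ i j n → 𝔽.trans (ext-pull σ u i j) (∈ₙ⇒ σN m (to σ i) (to σ j)
        (λ p → n (≡.subst₂ (PO._⪯_ (part N)) (strictlyInverseʳ σ i) (strictlyInverseʳ σ j) p)))
      up : pull σ u ∈ₙ N → u ∈ₙ σN
      up m = ∈ₙ⇐ σN λ i j n → 𝔽.trans
        (𝔽.reflexive (≡.sym (≡.cong₂ (ext u) (strictlyInverseˡ σ i) (strictlyInverseˡ σ j))))
        (𝔽.trans (𝔽.sym (ext-pull σ u (from σ i) (from σ j))) (∈ₙ⇒ N m (from σ i) (from σ j) n))

  module _ {A B : FinSet} where

    private
      W = pttObj (A ⊔ B)
      module PM = IsBilinear (pairsMult-bilinear {A} {B})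
      module TM = IsBilinear (pttMult-bilinear {A} {B})

    -- An element lies in the ordinal sum subgroup exactly when its two restrictions lie in the
    -- factors: all pairs from `A` to `B` belong to the inner order, so the entries there are
    -- unconstrained.
    indicatorMap-mult : ∀ x y → LeftModule._≈ᴹ_ W (indicatorMap (pairsMult x y)) (pttMult (indicatorMap x) (indicatorMap y))
    indicatorMap-mult x y = Extension.linear-ext W
      (linear-∘ {pairs A} {pairs (A ⊔ B)} {W} indicatorMap-linear (PM.linearˡ y))
      (linear-∘ {pairs A} {pttObj A} {W} (TM.linearˡ (indicatorMap y)) indicatorMap-linear)
      (λ p → Extension.linear-ext W
        (linear-∘ {pairs B} {pairs (A ⊔ B)} {W} indicatorMap-linear (PM.linearʳ (gen p)))
        (linear-∘ {pairs B} {pttObj B} {W} (TM.linearʳ (indicatorMap (gen p))) indicatorMap-linear)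
        (λ p' → rel (inj-≈ (λ u → χ-* (λ m → left p p' u m , right p p' u m) (both p p' u)))) y) x
      where
      module _ (p : NormalPair A) (p' : NormalPair B) (u : UT (whole p ∙ whole p')) where
        MN = proj₂ (p ∙ₙ p')
        left : u ∈ₙ MN → restrictˡ u ∈ₙ proj₂ p
        left m = ∈ₙ⇐ (proj₂ p) λ i j → ∈ₙ⇒ MN m (inj₁ i) (inj₁ j)
        right : u ∈ₙ MN → restrictʳ u ∈ₙ proj₂ p'
        right m = ∈ₙ⇐ (proj₂ p') λ i j → ∈ₙ⇒ MN m (inj₂ i) (inj₂ j)
        both : restrictˡ u ∈ₙ proj₂ p → restrictʳ u ∈ₙ proj₂ p' → u ∈ₙ MN
        both l r = ∈ₙ⇐ MN λ
          { (inj₁ i) (inj₁ j) n → ∈ₙ⇒ (proj₂ p) l i j n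
          ; (inj₁ i) (inj₂ j) n → ⊥-elim (n _)
          ; (inj₂ i) (inj₁ j) n → ext-out u (inj₂ i) (inj₁ j) id
          ; (inj₂ i) (inj₂ j) n → ∈ₙ⇒ (proj₂ p') r i j n }

  indicatorMap-unit : ∀ (p : NormalPair ∅) → LeftModule._≈ᴹ_ (pttObj ∅) (indicatorMap (gen p)) pttUnit
  indicatorMap-unit p = rel (inj-∼ ((λ ()) , λ u v h → χ-in (∈ₙ⇐ (proj₂ p) (λ ()))))

  -- Expansion of class functions in indicators

  module _ {A : FinSet} where

    private _≟_ = decEq A

    Zero : ∀ {R : PO A} → UT R → Interval A → Set
    Zero {R} u (a , b) = ∀ i j → i ≢ j → PO._⪯_ R a i → PO._⪯_ R j b → ext u i j ≈ꟳ 0ꟳ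

    module _ (R : PO A) where

      open PO R

      Inside : El A → El A → Interval A → Set
      Inside i j (a , b) = a ⪯ i × j ⪯ b

      inside? : ∀ i j e → Dec (Inside i j e)
      inside? i j (a , b) = T? (order R a i) ×-dec T? (order R j b)

      Avoids : List (Interval A) → El A → El A → Set
      Avoids E i j = i ⪯ j × (i ≡ j ⊎ All (λ e → ¬ Inside i j e) E)

      avoids? : ∀ E i j → Dec (Avoids E i j)
      avoids? E i j = T? (order R i j) ×-dec ((i ≟ j) ⊎-dec All.all? (λ e → ¬? (inside? i j e)) E)

      avoids-trans : ∀ {E i j k} → Avoids E i j → Avoids E j k → Avoids E i k
      avoids-trans (p , inj₁ refl) s = s
      avoids-trans (p , inj₂ h) (q , _) = ⪯-trans p q , inj₂ (All.map (λ n (l , r) → n (l , ⪯-trans q r)) h)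

      -- For a single interval e with distinct endpoints, this is the largest normal part without e:
      -- by closedness, losing e forces out every nontrivial interval inside e. For a list it is the
      -- intersection of these.
      avoiding : List (Interval A) → NormalPart R
      avoiding E = record
        { part = poset sub
        ; part⊆ = subset sub
        ; closed = λ i⪯j jk j≢k k⪯l → fromWitness (close i⪯j (toWitness jk) j≢k k⪯l) }
        where
        sub = Blocks.subposet-from {R = R} (Avoids E) (avoids? E) (λ _ → ⪯-refl , inj₁ refl) avoids-trans proj₁
        close : ∀ {i j k l} → i ⪯ j → Avoids E j k → j ≢ k → k ⪯ l → Avoids E i l
        close i⪯j (_ , inj₁ e) j≢k k⪯l = ⊥-elim (j≢k e)
        close i⪯j (j⪯k , inj₂ h) j≢k k⪯l = ⪯-trans i⪯j (⪯-trans j⪯k k⪯l)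
          , inj₂ (All.map (λ n (l , r) → n (⪯-trans l i⪯j , ⪯-trans k⪯l r)) h)

      ∈avoiding⇒ : ∀ {E u} → u ∈ₙ avoiding E → All (Zero u) E
      ∈avoiding⇒ {E} {u} m = All.tabulate (λ {e} e∈E i j i≢j l r → ∈ₙ⇒ (avoiding E) m i j (λ s → not-inside e∈E i≢j (l , r) (toWitness s)))
        where
        not-inside : ∀ {e i j} → e ∈ E → i ≢ j → Inside i j e → ¬ Avoids E i j
        not-inside e∈E i≢j in' (_ , inj₁ e) = i≢j e
        not-inside e∈E i≢j in' (_ , inj₂ h) = All.lookup h e∈E in'

      ∈avoiding⇐ : ∀ {E u} → All (Zero u) E → u ∈ₙ avoiding E
      ∈avoiding⇐ {E} {u} h = ∈ₙ⇐ (avoiding E) (λ i j n → go i j (λ s → n (fromWitness s)))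
        where
        go : ∀ i j → ¬ Avoids E i j → ext u i j ≈ꟳ 0ꟳ
        go i j n with T? (order R i j) | i ≟ j | Any.any? (inside? i j) E
        ... | no i⋠j  | _      | _       = ext-out u i j i⋠j
        ... | yes i⪯j | yes e  | _       = ⊥-elim (n (i⪯j , inj₁ e))
        ... | yes i⪯j | no _   | no none = ⊥-elim (n (i⪯j , inj₂ (AllP.¬Any⇒All¬ E none)))
        ... | yes _   | no i≢j | yes any = let (z , (l , r)) = All.lookupAny h any in z i j i≢j l r

      -- Sample points whose values serve as coefficients. Membership in a pattern subgroup sees
      -- only which entries vanish, so the single nonzero value 1 suffices.
      pattern₀₁ : List (Interval A) → UT R
      pattern₀₁ J .entry i j _ = if ⌊ (i ≟ j) ⊎-dec (DecMembership._∈?_ (≡-dec _≟_ _≟_) (i , j) J) ⌋ then 1ꟳ else 0ꟳ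
      pattern₀₁ J .unit i with i ≟ i
      ... | yes _ = 𝔽.refl
      ... | no n  = ⊥-elim (n refl)

      Contained : Subposet R → Interval A → Set
      Contained M (a , b) = a ⪯ b → PO._⪯_ (poset M) a b

      pattern∈⇒ : ∀ M {J} → pattern₀₁ J ∈ᵁ M → All (Contained M) J
      pattern∈⇒ M {J} m = All.tabulate (λ { {a , b} e∈J a⪯b → decidable-stable (T? (order (poset M) a b))
        (λ n → 𝔽.1≉0 (𝔽.trans (𝔽.sym (one a b e∈J)) (𝔽.trans (𝔽.sym (ext-in (pattern₀₁ J) a b a⪯b)) (Blocks.∈⇒ M m a b n)))) })
        where
        one : ∀ a b → (a , b) ∈ J → (if ⌊ (a ≟ b) ⊎-dec (DecMembership._∈?_ (≡-dec _≟_ _≟_) (a , b) J) ⌋ then 1ꟳ else 0ꟳ) ≈ꟳ 1ꟳ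
        one a b e∈J with (a ≟ b) ⊎-dec (DecMembership._∈?_ (≡-dec _≟_ _≟_) (a , b) J)
        ... | yes _ = 𝔽.refl
        ... | no n  = ⊥-elim (n (inj₂ e∈J))

      pattern∈⇐ : ∀ M {J} → All (Contained M) J → pattern₀₁ J ∈ᵁ M
      pattern∈⇐ M {J} h = Blocks.∈⇐ M go
        where
        zero-entry : ∀ i j → i ⪯ j → ¬ PO._⪯_ (poset M) i j →
                     (if ⌊ (i ≟ j) ⊎-dec (DecMembership._∈?_ (≡-dec _≟_ _≟_) (i , j) J) ⌋ then 1ꟳ else 0ꟳ) ≈ꟳ 0ꟳ
        zero-entry i j i⪯j n with (i ≟ j) ⊎-dec (DecMembership._∈?_ (≡-dec _≟_ _≟_) (i , j) J)
        ... | yes (inj₁ refl) = ⊥-elim (n (PO.⪯-refl (poset M)))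
        ... | yes (inj₂ m)    = ⊥-elim (n (All.lookup h m i⪯j))
        ... | no _            = 𝔽.refl
        go : ∀ i j → ¬ PO._⪯_ (poset M) i j → ext (pattern₀₁ J) i j ≈ꟳ 0ꟳ
        go i j n with T? (order R i j)
        ... | yes i⪯j = 𝔽.trans (ext-in (pattern₀₁ J) i j i⪯j) (zero-entry i j i⪯j n)
        ... | no i⋠j  = ext-out (pattern₀₁ J) i j i⋠j

    avoiding-resp : ∀ {R S : PO A} → R ≗ᴾ S → ∀ E → (R , avoiding R E) ≈ₙ (S , avoiding S E)
    avoiding-resp {R} {S} e E = e , λ i j → T-ext
      (λ s → fromWitness (transfer R S e (toWitness s))) (λ s → fromWitness (transfer S R (λ i j → ≡.sym (e i j)) (toWitness s)))
      where
      transfer : ∀ (R S : PO A) → R ≗ᴾ S → ∀ {i j} → Avoids R E i j → Avoids S E i j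
      transfer R S e (p , inj₁ eq) = ≡.subst T (e _ _) p , inj₁ eq
      transfer R S e (p , inj₂ h) = ≡.subst T (e _ _) p
        , inj₂ (All.map (λ n (l , r) → n (≡.subst T (≡.sym (e _ _)) l , ≡.subst T (≡.sym (e _ _)) r)) h)

    -- A class function is a multilinear polynomial in the functions z_e = indicator (avoiding [e]);
    -- expanding it one interval at a time as f(z_e = 0) + z_e (f(z_e = 1) − f(z_e = 0)), the term (J , E)
    -- stands for the value at z = 0 on J, z = 1 elsewhere, times ∏_{e ∈ E} z_e = indicator (avoiding E).
    expand : List (Interval A) → List (Interval A) → List (Interval A) → Comb (List (Interval A) × List (Interval A))
    expand []       J E = gen (J , E)
    expand (e ∷ es) J E = expand es (e ∷ J) E ⊞ (expand es J (e ∷ E) ⊞ K.- K.1# ⊡ expand es (e ∷ J) (e ∷ E))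

    expansion : Comb (List (Interval A) × List (Interval A))
    expansion = expand (intervals A) [] []

    private
      P = pairs A
      Q = pttObj A
      module P = LeftModule P
      module Q = LeftModule Q

    coefficient : ∀ {R : PO A} → ClassFunction R → List (Interval A) → K.Carrier
    coefficient {R} φ J = value φ (pattern₀₁ R J)

    expandFunction : ∀ R → ClassFunction R → Vector P
    expandFunction R φ = Extension.extend P (λ (J , E) → coefficient φ J ⊡ gen (R , avoiding R E)) expansion

    expandMap : Vector Q → Vector P
    expandMap = Extension.extend P (λ (R , φ) → expandFunction R φ)

    expandMap-linear : IsLinear Q P expandMap
    expandMap-linear = Extension.extend-linear P (⨁-respects _ _ P expandFunction
      (λ R → isLinear {classFunctions R} {P}
        (λ e → Extension.extend-≗ P (λ (J , E) → ⊡-cong (e (pattern₀₁ R J)) ≈-refl) expansion)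
        (λ φ ψ → P.≈ᴹ-trans (Extension.extend-≗ P (λ (J , E) → ⊡-distribʳ _ _ _) expansion) (Extension.extend-+ P _ _ expansion))
        (λ c φ → P.≈ᴹ-trans (Extension.extend-≗ P (λ (J , E) → ⊡-assoc _ _ _) expansion) (Extension.extend-* P c _ expansion)))
      (λ {R} {S} (e , f) → Extension.extend-≗ P (λ (J , E) → ⊡-cong (f (pattern₀₁ R J) (pattern₀₁ S J) (λ _ _ _ _ → 𝔽.refl))
        (identifyPairs (avoiding-resp e E))) expansion))

    module _ (W : VectorSpace) where

      open LeftModule W

      private
        cancel : ∀ {z b} → z ≈ᴹ b → b +ᴹ (K.- K.1#) *ₗ z ≈ᴹ 0ᴹ
        cancel {z} {b} h = ≈ᴹ-trans (+ᴹ-cong (≈ᴹ-sym (*ₗ-identityˡ b)) (*ₗ-congˡ h))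
          (≈ᴹ-trans (≈ᴹ-sym (*ₗ-distribʳ b K.1# (K.- K.1#))) (≈ᴹ-trans (*ₗ-congʳ (K.-‿inverseʳ K.1#)) (*ₗ-zeroˡ b)))

      -- This and `exchange` are the two ways in which a step x + (y - z) of `expand` collapses: y
      -- cancels z, or x does. The space `W` is `K` when evaluating at an element and `pairs A` when
      -- expanding an indicator.
      drop-difference : ∀ {x y z a b} → x ≈ᴹ a → y ≈ᴹ b → z ≈ᴹ b → x +ᴹ (y +ᴹ (K.- K.1#) *ₗ z) ≈ᴹ a
      drop-difference x≈a y≈b z≈b = ≈ᴹ-trans (+ᴹ-cong x≈a (≈ᴹ-trans (+ᴹ-congʳ y≈b) (cancel z≈b))) (+ᴹ-identityʳ _)

      exchange : ∀ {x y z a b} → x ≈ᴹ a → y ≈ᴹ b → z ≈ᴹ a → x +ᴹ (y +ᴹ (K.- K.1#) *ₗ z) ≈ᴹ b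
      exchange {x} {y} {z} x≈a y≈b z≈a = ≈ᴹ-trans (≈ᴹ-sym (+ᴹ-assoc x y _)) (≈ᴹ-trans (+ᴹ-congʳ (+ᴹ-comm x y))
        (≈ᴹ-trans (+ᴹ-assoc y x _) (drop-difference y≈b x≈a z≈a)))

    module _ {R : PO A} (u : UT R) where

      abstract
        zero? : ∀ e → Dec (Zero u e)
        zero? e = Dec.map′ (All.head ∘ ∈avoiding⇒ R) (λ z → ∈avoiding⇐ R (z ∷ [])) (∈ₙ? u (avoiding R (e ∷ [])))

      open Selection (λ e → ¬? (zero? e))

      -- At a given u each z_e is 0 or 1, so each step keeps one summand: e joins J if z_e(u) is 0.
      -- Otherwise e joins E, where it does not change the value of the indicator at u.
      expand-value : ∀ (φ : ClassFunction R) es J E →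
        value (Extension.extend (classFunctions R) (λ (J , E) → LeftModule._*ₗ_ (classFunctions R) (coefficient φ J) (indicator (avoiding R E))) (expand es J E)) u
          K.≈ coefficient φ (select es J) K.* χ (avoiding R E) u
      expand-value φ []       J E = K.refl
      expand-value φ (e ∷ es) J E with zero? e
      ... | yes z = exchange TensorUnit.leftModule (expand-value φ es (e ∷ J) E)
        (K.trans (expand-value φ es J (e ∷ E)) (K.*-congˡ same)) (K.trans (expand-value φ es (e ∷ J) (e ∷ E)) (K.*-congˡ same))
        where
        same : χ (avoiding R (e ∷ E)) u K.≈ χ (avoiding R E) u
        same = χ-cong (∈avoiding⇐ R ∘ All.tail ∘ ∈avoiding⇒ R) (λ m → ∈avoiding⇐ R (z ∷ ∈avoiding⇒ R m))
      ... | no nz = drop-difference TensorUnit.leftModule (expand-value φ es (e ∷ J) E)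
        (K.trans (expand-value φ es J (e ∷ E)) vanish) (K.trans (expand-value φ es (e ∷ J) (e ∷ E)) vanish)
        where
        vanish : ∀ {c} → c K.* χ (avoiding R (e ∷ E)) u K.≈ K.0#
        vanish = K.trans (K.*-congˡ (χ-out (nz ∘ All.head ∘ ∈avoiding⇒ R))) (K.zeroʳ _)

      support : List (Interval A)
      support = select (intervals A) []

      -- `support` is not the set of nonzero positions of u: it has every pair with a nonzero
      -- off-diagonal entry inside. Passing to it changes no membership, since a normal part that
      -- contains the position of such an entry contains every interval around it.
      pattern-support : Blocks._≃_ (pattern₀₁ R support) u
      pattern-support N = there-and-back
        where
        M = subposet N
        there-and-back : (pattern₀₁ R support ∈ᵁ M → u ∈ᵁ M) × (u ∈ᵁ M → pattern₀₁ R support ∈ᵁ M)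
        there-and-back .proj₁ m = Blocks.∈⇐ M go
          where
          go : ∀ i j → ¬ PO._⪯_ (poset M) i j → ext u i j ≈ꟳ 0ꟳ
          go i j n with T? (order R i j) | i ≟ j | zero? (i , j)
          ... | no i⋠j  | _        | _     = ext-out u i j i⋠j
          ... | yes _   | yes refl | _     = ⊥-elim (n (PO.⪯-refl (poset M)))
          ... | yes _   | no i≢j   | yes z = z i j i≢j (PO.⪯-refl R) (PO.⪯-refl R)
          ... | yes i⪯j | no _     | no nz = ⊥-elim (n (All.lookup (pattern∈⇒ R M m) (∈-select⁺ (intervals A) (∈-intervals A (i , j)) nz) i⪯j))
        there-and-back .proj₂ m = pattern∈⇐ R M (All.map contained (select-All (intervals A) []))
          where
          contained : ∀ {e} → ¬ Zero u e → Contained R M e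
          contained {a , b} nz a⪯b = decidable-stable (T? (order (poset M) a b)) (λ n → nz (λ i j i≢j a⪯i j⪯b →
            Blocks.∈⇒ M m i j (λ i⪯j → n (Blocks.normal⇒closed {Q = M} (normal N) a⪯i i⪯j i≢j j⪯b))))

      expansion-value : ∀ (φ : ClassFunction R) →
        value (Extension.extend (classFunctions R) (λ (J , E) → LeftModule._*ₗ_ (classFunctions R) (coefficient φ J) (indicator (avoiding R E))) expansion) u
          K.≈ value φ u
      expansion-value φ = K.trans (expand-value φ (intervals A) [] []) (K.trans (K.*-cong
        (constant φ (Blocks.≃⇒same-block pattern-support)) (χ-in (∈avoiding⇐ R []))) (K.*-identityʳ _))

    indicator-expand : ∀ x → indicatorMap (expandMap x) Q.≈ᴹ x
    indicator-expand = ptt-ext Q (linear-∘ {Q} {P} {Q} indicatorMap-linear expandMap-linear) (linear-id {Q}) (λ R φ →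
      let C = classFunctions R
          term = λ (J , E) → LeftModule._*ₗ_ C (coefficient φ J) (indicator (avoiding R E))
      in Q.≈ᴹ-trans (extend-∘ {P} {Q} indicatorMap-linear (λ (J , E) → coefficient φ J ⊡ gen (R , avoiding R E)) expansion)
        (Q.≈ᴹ-trans (Extension.extend-≗ Q (λ (J , E) → ≈-sym (rel (inj-* _ (indicator (avoiding R E))))) expansion)
          (Q.≈ᴹ-trans (Q.≈ᴹ-sym (extend-∘ {C} {Q} (inj-linear classFunctions SameFunction R) term expansion))
            (rel (inj-≈ (λ u → expansion-value u φ))))))

    module _ {R : PO A} (M : NormalPart R) where

      contained? : ∀ e → Dec (Contained R (asSubposet M) e)
      contained? (a , b) = T? (order R a b) →-dec T? (order (part M) a b)

      open Selection (λ e → ¬? (contained? e))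

      private
        c = coefficient (indicator M)

      -- The coefficient of J is 1 when J is contained in M and 0 otherwise. An interval of M leaves
      -- it unchanged and its terms cancel; an interval outside M annihilates the terms that have it
      -- in J and so goes to E. One term survives, whose E collects what M misses.
      expand-indicator-step : ∀ es J E →
        Extension.extend P (λ (J , E) → c J ⊡ gen (R , avoiding R E)) (expand es J E) P.≈ᴹ c J ⊡ gen (R , avoiding R (select es E))
      expand-indicator-step []       J E = P.≈ᴹ-refl
      expand-indicator-step (e ∷ es) J E with contained? e
      ... | yes h = drop-difference P
        (P.≈ᴹ-trans (expand-indicator-step es (e ∷ J) E) (⊡-cong same ≈-refl))
        (expand-indicator-step es J (e ∷ E))
        (P.≈ᴹ-trans (expand-indicator-step es (e ∷ J) (e ∷ E)) (⊡-cong same ≈-refl))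
        where
        same : c (e ∷ J) K.≈ c J
        same = χ-cong (pattern∈⇐ R (asSubposet M) ∘ All.tail ∘ pattern∈⇒ R (asSubposet M))
                 (λ m → pattern∈⇐ R (asSubposet M) (h ∷ pattern∈⇒ R (asSubposet M) m))
      ... | no nc = exchange P
        (P.≈ᴹ-trans (expand-indicator-step es (e ∷ J) E) vanish)
        (expand-indicator-step es J (e ∷ E))
        (P.≈ᴹ-trans (expand-indicator-step es (e ∷ J) (e ∷ E)) vanish)
        where
        vanish : ∀ {x} → c (e ∷ J) ⊡ x P.≈ᴹ 𝟘
        vanish {x} = ≈-trans (⊡-cong (χ-out (nc ∘ All.head ∘ pattern∈⇒ R (asSubposet M))) ≈-refl) (⊡-zeroˡ x)

      -- A normal part is the intersection of the largest normal parts that omit one of its missing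
      -- intervals: by closedness, none of its nontrivial intervals lies inside a missing one.
      avoiding-missing : (R , avoiding R (select (intervals A) [])) ≈ₙ (R , M)
      avoiding-missing = (λ _ _ → refl) , λ i j → T-ext (λ s → onto i j (toWitness s)) (λ p → fromWitness (back i j p))
        where
        missing = select (intervals A) []
        onto : ∀ i j → Avoids R missing i j → PO._⪯_ (part M) i j
        onto i j (i⪯j , inj₁ refl) = PO.⪯-refl (part M)
        onto i j (i⪯j , inj₂ h) = decidable-stable (T? (order (part M) i j)) (λ n →
          All.lookup h (∈-select⁺ (intervals A) (∈-intervals A (i , j)) (λ f → n (f i⪯j))) (PO.⪯-refl R , PO.⪯-refl R))
        back : ∀ i j → PO._⪯_ (part M) i j → Avoids R missing i j
        back i j p with i ≟ j
        ... | yes e  = part⊆ M p , inj₁ e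
        ... | no i≢j = part⊆ M p , inj₂ (All.map (λ nc (l , r) → nc (λ _ → closed M l p i≢j r)) (select-All (intervals A) []))

      expand-indicator-gen : expandFunction R (indicator M) P.≈ᴹ gen (R , M)
      expand-indicator-gen = P.≈ᴹ-trans (expand-indicator-step (intervals A) [] [])
        (P.≈ᴹ-trans (⊡-cong (χ-in (pattern∈⇐ R (asSubposet M) [])) (identifyPairs avoiding-missing)) (⊡-identityˡ _))

    expand-indicator : ∀ x → expandMap (indicatorMap x) P.≈ᴹ x
    expand-indicator = Extension.linear-ext P (linear-∘ {P} {Q} {P} expandMap-linear indicatorMap-linear) (linear-id {P})
      (λ (R , M) → expand-indicator-gen M)

-- The isomorphism of monoids

module _ (K : CommutativeRing 0ℓ 0ℓ) {q : ℕ} (𝔽 : FiniteField q) where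

  open LinearAlgebra K
  open Species K
  open Spans K
  open FreeOnAtoms K
  open Free atomSpecies
  open PatternMonoid K 𝔽
  open Indicators K 𝔽

  private
    module F A = LeftModule (freeObj A)
    module Q A = LeftModule (pttObj A)

  ptt-free-on-atoms : MonoidIsomorphism freeMonoid ptt
  ptt-free-on-atoms = record
    { hom = λ A → indicatorMap ∘ glueMap
    ; hom-isomorphism = λ A → inverse⇒isomorphism {freeObj A} {pttObj A}
          (linear-∘ {freeObj A} {pairs A} {pttObj A} indicatorMap-linear glueMap-linear)
          (linear-∘ {pttObj A} {pairs A} {freeObj A} factorMap-linear expandMap-linear)
          (λ x → F.≈ᴹ-trans A (⟦factor⟧-cong (expand-indicator (glueMap x))) (factor-glue x))
          (λ y → Q.≈ᴹ-trans A (⟦indicator⟧-cong (glue-factor (expandMap y))) (indicator-expand y))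
    ; hom-natural = λ {A} {B} σ x → Q.≈ᴹ-trans B (⟦indicator⟧-cong (glueMap-natural σ x)) (indicatorMap-natural σ (glueMap x))
    ; hom-unit = indicatorMap-unit (glue (covering empty-composition) [])
    ; hom-mult = λ {A} {B} x y → Q.≈ᴹ-trans (A ⊔ B) (⟦indicator⟧-cong (glueMap-mult x y)) (indicatorMap-mult (glueMap x) (glueMap y))
    }
    where
    ⟦factor⟧-cong : ∀ {A x y} → LeftModule._≈ᴹ_ (pairs A) x y → F._≈ᴹ_ A (factorMap x) (factorMap y)
    ⟦factor⟧-cong = LeftModuleMorphisms.IsLeftModuleHomomorphism.⟦⟧-cong factorMap-linear
    ⟦indicator⟧-cong : ∀ {A x y} → LeftModule._≈ᴹ_ (pairs A) x y → Q._≈ᴹ_ A (indicatorMap x) (indicatorMap y)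
    ⟦indicator⟧-cong = LeftModuleMorphisms.IsLeftModuleHomomorphism.⟦⟧-cong indicatorMap-linear

proposition4p7 : (q : ℕ) (𝔽 : FiniteField q) →
    Σ[ 𝐪 ∈ Species.VectorSpecies ℂ ]
    (Species.VanishesAt∅ ℂ 𝐪 ×
    Species.MonoidIsomorphism ℂ (Species.Free.freeMonoid ℂ 𝐪) (PatternMonoid.ptt ℂ 𝔽))
proposition4p7 q 𝔽 = atomSpecies , atomSpecies-vanishes , ptt-free-on-atoms ℂ 𝔽
  where open FreeOnAtoms ℂ using (atomSpecies; atomSpecies-vanishes)
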